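{- Let $F$ be a free group on finitely many generators $X_1,\ldots,X_n$, and let $\mathbb{Q}F=\mathbb{Q}\langle X_1,X_1^{ -1},\ldots,X_n,X_n^{ -1}\rangle$ be its group algebra over $\mathbb{Q}$ (the algebra of noncommutative Laurent polynomials with rational coefficients). Let $d\geq 1$ and let $M$ be a $d\times d$ matrix with entries in $\mathbb{Q}F$. For $n\geq 1$ let $a_n(M)\in\mathbb{Q}$ be the coefficient of the identity element $1\in F$ in the trace $\mathrm{Tr}(M^n)\in\mathbb{Q}F$, and set $$P_M=\exp\Big(\sum_{n\geq 1} a_n(M)\,\frac{t^n}{n}\Big)\in\mathbb{Q}[[t]].$$ Then $P_M$ is algebraic over $\mathbb{Q}(t)$.
   Context: Every element $a\in\mathbb{Q}F$ is uniquely a finite sum $a=\sum_{g\in F}(a,g)\,g$ with $(a,g)\in\mathbb{Q}$; the coefficient of $1$ in $\mathrm{Tr}(M^n)$ means $(\mathrm{Tr}(M^n),1)$. The power series $P_M$ is called the zeta function of $M$. -}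

module Defs where

open import Data.Nat as ℕ using (ℕ; zero; suc; _!; _∸_)
open import Data.Nat.Properties using (_!≢0)
open import Data.Integer using (+_)
open import Data.Rational as ℚ using (ℚ; 0ℚ; 1ℚ; _/_)
open import Data.Fin as Fin using (Fin)
open import Data.Fin.Properties as FinP using ()
open import Data.Bool using (Bool; true; false; if_then_else_; _∧_; _xor_)
open import Data.Bool.Properties as BoolP using ()
open import Data.Product using (_×_; _,_; Σ)
open import Data.List as List using (List; []; _∷_; _++_; map; foldr; concatMap; allFin; upTo; lookup)
open import Data.List.Properties as ListP using ()
open import Data.List.Relation.Unary.Any using (Any)
open import Data.Product.Properties as ProdP using ()
open import Relation.Nullary using (¬_; does)
open import Relation.Binary.PropositionalEquality using (_≡_)

-- a letter (i , true) is X_i, (i , false) is X_i⁻¹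
Letter : ℕ → Set
Letter n = Fin n × Bool

-- words in the letters; the group element of a word is its free reduction
Word : ℕ → Set
Word n = List (Letter n)

cancels : ∀ {n} → Letter n → Letter n → Bool
cancels (i , b) (j , c) = does (i Fin.≟ j) ∧ (b xor c)

push : ∀ {n} → Letter n → Word n → Word n
push x [] = x ∷ []
push x (y ∷ w) = if cancels x y then w else x ∷ y ∷ w

-- free reduction; reduced words are the normal forms of elements of F
reduce : ∀ {n} → Word n → Word n
reduce = foldr push []

-- The group algebra ℚF.  An element is represented by a formal finite sum
-- Σ q_k · w_k  (a list of (coefficient, word) pairs), standing for the
-- element Σ q_k · [reduce w_k] of ℚF.  Every element of ℚF arises this way.

QF : ℕ → Set
QF n = List (ℚ × Word n)

sumℚ : List ℚ → ℚ
sumℚ = foldr ℚ._+_ 0ℚ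

coeff : ∀ {n} → QF n → Word n → ℚ
coeff a g =
  sumℚ (map (λ { (q , w) → if does (ListP.≡-dec (ProdP.≡-dec FinP._≟_ BoolP._≟_) (reduce w) (reduce g)) then q else 0ℚ }) a)

zeroF : ∀ {n} → QF n
zeroF = []

oneF : ∀ {n} → QF n
oneF = (1ℚ , []) ∷ []

_+F_ : ∀ {n} → QF n → QF n → QF n
_+F_ = _++_

_*F_ : ∀ {n} → QF n → QF n → QF n
a *F b = concatMap (λ { (p , u) → map (λ { (q , v) → (p ℚ.* q , u ++ v) }) b }) a

sumF : ∀ {n} → List (QF n) → QF n
sumF = foldr _+F_ zeroF

Mat : ℕ → ℕ → Set
Mat n d = Fin d → Fin d → QF n

idMat : ∀ {n d} → Mat n d
idMat i j = if does (i Fin.≟ j) then oneF else zeroF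

_*M_ : ∀ {n d} → Mat n d → Mat n d → Mat n d
(A *M B) i j = sumF (map (λ k → A i k *F B k j) (allFin _))

_^M_ : ∀ {n d} → Mat n d → ℕ → Mat n d
M ^M zero = idMat
M ^M suc k = M *M (M ^M k)

Tr : ∀ {n d} → Mat n d → QF n
Tr A = sumF (map (λ i → A i i) (allFin _))

aCoeff : ∀ {n d} → Mat n d → ℕ → ℚ
aCoeff M k = coeff (Tr (M ^M k)) []

PS : Set
PS = ℕ → ℚ

_*P_ : PS → PS → PS
(f *P g) k = sumℚ (map (λ i → f i ℚ.* g (k ∸ i)) (upTo (suc k)))

_+P_ : PS → PS → PS
(f +P g) k = f k ℚ.+ g k

zeroP : PS
zeroP _ = 0ℚ

oneP : PS
oneP zero = 1ℚ
oneP (suc _) = 0ℚ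

_^P_ : PS → ℕ → PS
f ^P zero = oneP
f ^P suc m = f *P (f ^P m)

-- exp of a series S with zero constant term: exp S = Σ_m S^m / m!
-- (for such S, only m ≤ k contribute to the coefficient of t^k)
expP : PS → PS
expP S k = sumℚ (map (λ m → (S ^P m) k ℚ.* (_/_ (+ 1) (m !) ⦃ m !≢0 ⦄)) (upTo (suc k)))

logSeries : ∀ {n d} → Mat n d → PS
logSeries M zero = 0ℚ
logSeries M (suc k) = aCoeff M (suc k) ℚ.* ((+ 1) / suc k)

zeta : ∀ {n d} → Mat n d → PS
zeta M = expP (logSeries M)

polyPS : List ℚ → PS
polyPS [] _ = 0ℚ
polyPS (c ∷ cs) zero = c
polyPS (c ∷ cs) (suc k) = polyPS cs k

evalY : List (List ℚ) → PS → PS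
evalY [] P = zeroP
evalY (c ∷ cs) P = polyPS c +P (P *P evalY cs P)

-- P is algebraic over ℚ(t): some nonzero Q(t,y) ∈ ℚ[t][y] (denominators
-- cleared) has Q(t, P) = 0 in ℚ[[t]]
IsAlgebraicOverℚt : PS → Set
IsAlgebraicOverℚt P =
  Σ (List (List ℚ)) λ cs →
    Any (Any (λ q → ¬ (q ≡ 0ℚ))) cs × (∀ k → evalY cs P k ≡ 0ℚ)

{-# OPTIONS --safe #-}
module Submission where

-- Write θ = t d/dt; then θP = (Σ a_k t^k) P for P = P_M, and any solution of this equation is shown algebraic.
--
-- Writing M = A B, where A carries the first letters of the words, and N = (0 A; B 0), one has a_{2k}(N) = 2 a_k(M)
-- and a_{2k+1}(N) = 0, hence P_N(t) = P_M(t²) up to a constant. Iterating, all words have length at most 1, that is,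
-- M = N₀ + Σ_y N_y y with rational matrices N_y indexed by the letters.
--
-- Then 1 − tM is a nearest-neighbour operator on the Cayley tree. Let G_x be the Green function at x of the subtree
-- of words beginning with x, W_y = t² N_y G_y N_{y⁻¹}, K = 1 − tN₀ − Σ_y W_y and K_x = K + W_{x⁻¹} = G_x⁻¹.
-- The Green function at the root is K⁻¹, so Σ_{k≥1} a_k t^k = tr K⁻¹ − tr 1, and this is the logarithmic derivative of
-- det K⁻¹ · Π_i det K / det K_{x_i}, the product being over the generators (the Bethe formula for determinants on a tree).
--
-- The entries of the G_x solve a system f = c + t p(f). The solution of the deformed system f = c + t (p(f) + ε f^(B+1))
-- with B ≥ deg p generates a module of finite rank over ℚ[t, ε, (tε)⁻¹], so its coordinates satisfy nonzero polynomial
-- relations; these are divided by powers of ε until they survive setting ε = 0.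

open import Defs
open import Level using (0ℓ)
open import Algebra.Bundles using (Ring; CommutativeRing)
open import Algebra.Structures using (IsCommutativeRing)
open import Data.Bool using (Bool; true; false; not; if_then_else_; _∧_; _xor_)
import Data.Bool.Properties as Boolₚ
open import Data.Fin as Fin using (Fin; zero; suc; punchIn; toℕ)
import Data.Fin.Properties as Finₚ
open import Data.Integer as ℤ using (+_)
import Data.Integer.Properties as ℤₚ
open import Data.List as List using (List; []; _∷_; _++_; applyUpTo; foldr; length; lookup; map; replicate; tabulate)
import Data.List.Properties as Listₚ
open import Data.List.Membership.Propositional using (_∈_)
open import Data.List.Membership.Propositional.Properties using (∈-allFin; ∈-map⁺; ∈-++⁺ˡ; ∈-++⁺ʳ; ∈-cartesianProduct⁺; ∈-cartesianProductWith⁺)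
open import Data.List.Relation.Unary.All as All using (All; []; _∷_)
open import Data.List.Relation.Unary.Any using (Any; here; there; index)
open import Data.List.Relation.Unary.Any.Properties using (lookup-index)
open import Data.Nat as ℕ using (ℕ; zero; suc; z≤n; s≤s; _≤_; _!; NonZero)
import Data.Nat.Properties as ℕₚ
open import Data.Product using (_×_; _,_; ∃; proj₁; proj₂)
import Data.Product.Properties as Productₚ
open import Data.Rational as ℚ using (ℚ; 0ℚ; 1ℚ; _/_)
import Data.Rational.Properties as ℚₚ
open import Data.Rational.Unnormalised as ℚᵘ using (mkℚᵘ; *≡*)
import Data.Rational.Unnormalised.Properties as ℚᵘₚ
open import Data.Sum using (_⊎_; inj₁; inj₂)
open import Data.Unit using (⊤; tt)
open import Data.Vec.Functional using (insertAt)
open import Data.Vec.Functional.Properties using (insertAt-lookup; insertAt-punchIn)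
open import Function using (_∘_; mk⇔)
open import Relation.Binary.PropositionalEquality as ≡ using (_≡_)
open import Relation.Nullary using (¬_; Dec; yes; no; does; contradiction)
open import Relation.Nullary.Decidable using (does-⇔)

-- Words of length at most 1 matter because only then does a walk on the Cayley tree move along
-- edges: from `x w` it reaches the root only through `w`, so Green functions factor along paths.
--
-- Neither determinants nor fraction fields are formed. A determinant enters through its logarithmic
-- derivative, and `LogAlg g` records that g is θu/u for an algebraic unit u. Since θf = h f with
-- h(0) = 0 fixes f up to a constant factor, one such u for h = Σ a_k t^k makes every solution
-- algebraic; hence the induction speaks of all solutions and not of the exponential alone.
--
-- The obstacle in f = c + t p(f) is that the leading forms of p can degenerate, so that elimination
-- may collapse to the trivial relation. With ε present, the only terms of top degree are the pure
-- powers f_j^(B+1), with coefficient tε. Every long monomial contains such a power and is rewritten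
-- with shorter ones, which leaves linear algebra over a domain with decidable zero. The same
-- rewriting gives closure of algebraic elements under sum and product.

infixl 6 _+ᵒ_
infixl 7 _*ᵒ_
infix 8 -ᵒ_

-- Opaque copies of the operations of ℚ: the library's unfold to normalised fractions during conversion checking.
opaque
  _+ᵒ_ _*ᵒ_ : ℚ → ℚ → ℚ
  _+ᵒ_ = ℚ._+_
  _*ᵒ_ = ℚ._*_

  -ᵒ_ : ℚ → ℚ
  -ᵒ_ = ℚ.-_

  +ᵒ≡+ : ∀ x y → x +ᵒ y ≡ x ℚ.+ y
  +ᵒ≡+ x y = ≡.refl

  *ᵒ≡* : ∀ x y → x *ᵒ y ≡ x ℚ.* y
  *ᵒ≡* x y = ≡.refl

  isCommutativeRing : IsCommutativeRing _≡_ _+ᵒ_ _*ᵒ_ -ᵒ_ 0ℚ 1ℚ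
  isCommutativeRing = ℚₚ.+-*-isCommutativeRing

rationalRing : CommutativeRing 0ℓ 0ℓ
rationalRing = record { isCommutativeRing = isCommutativeRing }

module Q = CommutativeRing rationalRing

ℚ-ring : Ring 0ℓ 0ℓ
ℚ-ring = Q.ring

-- Finite index types, sums over them and additive maps

data Ix : Set where
  fin  : ℕ → Ix
  bool : Ix
  _⊕_  : Ix → Ix → Ix
  _⊗_  : Ix → Ix → Ix

El : Ix → Set
El (fin n) = Fin n
El bool    = Bool
El (a ⊕ b) = El a ⊎ El b
El (a ⊗ b) = El a × El b

eqb : ∀ c → El c → El c → Bool
eqb (fin n) i j = does (i Fin.≟ j)
eqb bool true  true  = true
eqb bool false false = true
eqb bool true  false = false
eqb bool false true  = false
eqb (a ⊕ b) (inj₁ x) (inj₁ y) = eqb a x y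
eqb (a ⊕ b) (inj₂ x) (inj₂ y) = eqb b x y
eqb (a ⊕ b) (inj₁ x) (inj₂ y) = false
eqb (a ⊕ b) (inj₂ x) (inj₁ y) = false
eqb (a ⊗ b) (x , y) (x′ , y′) = eqb a x x′ ∧ eqb b y y′

eqb-sym : ∀ c x y → eqb c x y ≡ eqb c y x
eqb-sym (fin (suc n)) zero    zero    = ≡.refl
eqb-sym (fin (suc n)) zero    (suc y) = ≡.refl
eqb-sym (fin (suc n)) (suc x) zero    = ≡.refl
eqb-sym (fin (suc n)) (suc x) (suc y) = eqb-sym (fin n) x y
eqb-sym bool true  true  = ≡.refl
eqb-sym bool true  false = ≡.refl
eqb-sym bool false true  = ≡.refl
eqb-sym bool false false = ≡.refl
eqb-sym (a ⊕ b) (inj₁ x) (inj₁ y) = eqb-sym a x y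
eqb-sym (a ⊕ b) (inj₁ x) (inj₂ y) = ≡.refl
eqb-sym (a ⊕ b) (inj₂ x) (inj₁ y) = ≡.refl
eqb-sym (a ⊕ b) (inj₂ x) (inj₂ y) = eqb-sym b x y
eqb-sym (a ⊗ b) (x , y) (x′ , y′) = ≡.cong₂ _∧_ (eqb-sym a x x′) (eqb-sym b y y′)

module Sums (R : Ring 0ℓ 0ℓ) where
  open Ring R hiding (zero)

  -- Recursion on the code makes a sum over `a ⊕ b` split and a sum over `a ⊗ b` iterate by
  -- definition. Block matrices and the grouping of the letters into pairs of a generator and a sign
  -- rely on this.
  sum : ∀ c → (El c → Carrier) → Carrier
  sum (fin zero)    f = 0#
  sum (fin (suc n)) f = f zero + sum (fin n) (f ∘ suc)
  sum bool          f = f true + f false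
  sum (a ⊕ b)       f = sum a (f ∘ inj₁) + sum b (f ∘ inj₂)
  sum (a ⊗ b)       f = sum a (λ x → sum b (λ y → f (x , y)))

  sum-cong : ∀ c {f g : El c → Carrier} → (∀ x → f x ≈ g x) → sum c f ≈ sum c g
  sum-cong (fin zero)    e = refl
  sum-cong (fin (suc n)) e = +-cong (e zero) (sum-cong (fin n) (e ∘ suc))
  sum-cong bool          e = +-cong (e true) (e false)
  sum-cong (a ⊕ b)       e = +-cong (sum-cong a (e ∘ inj₁)) (sum-cong b (e ∘ inj₂))
  sum-cong (a ⊗ b)       e = sum-cong a (λ x → sum-cong b (λ y → e (x , y)))

  δ : ∀ c → El c → El c → Carrier
  δ c x y = if eqb c x y then 1# else 0#

-- Traces, matrix entries, coefficients of series and derivations all occur as instances; what they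
-- share is `sum-hom`.
record Additive (R S : Ring 0ℓ 0ℓ) : Set where
  private
    module R = Ring R
    module S = Ring S
  field
    fun  : R.Carrier → S.Carrier
    cong : ∀ {x y} → x R.≈ y → fun x S.≈ fun y
    zer  : fun R.0# S.≈ S.0#
    add  : ∀ x y → fun (x R.+ y) S.≈ fun x S.+ fun y

module _ {R S : Ring 0ℓ 0ℓ} (h : Additive R S) where
  private
    module R = Ring R
    module S = Ring S
    module ΣR = Sums R
    module ΣS = Sums S
  open Additive h

  sum-hom : ∀ c (f : El c → R.Carrier) → fun (ΣR.sum c f) S.≈ ΣS.sum c (λ x → fun (f x))
  sum-hom (fin zero)    f = zer
  sum-hom (fin (suc n)) f = S.trans (add _ _) (S.+-congˡ (sum-hom (fin n) _))
  sum-hom bool          f = add _ _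
  sum-hom (a ⊕ b)       f = S.trans (add _ _) (S.+-cong (sum-hom a _) (sum-hom b _))
  sum-hom (a ⊗ b)       f = S.trans (sum-hom a _) (ΣS.sum-cong a (λ x → sum-hom b _))

module SumLaws (R : Ring 0ℓ 0ℓ) where
  open Ring R hiding (zero)
  open Sums R public
  open import Algebra.Properties.CommutativeSemigroup +-commutativeSemigroup using (interchange)
  open import Algebra.Properties.AbelianGroup +-abelianGroup using (⁻¹-∙-comm; ε⁻¹≈ε)
  open import Relation.Binary.Reasoning.Setoid setoid

  sum-0 : ∀ c → sum c (λ _ → 0#) ≈ 0#
  sum-0 (fin zero)    = refl
  sum-0 (fin (suc n)) = trans (+-identityˡ _) (sum-0 (fin n))
  sum-0 bool          = +-identityˡ _
  sum-0 (a ⊕ b)       = trans (+-cong (sum-0 a) (sum-0 b)) (+-identityˡ _)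
  sum-0 (a ⊗ b)       = trans (sum-cong a (λ _ → sum-0 b)) (sum-0 a)

  sum-zero : ∀ c {f : El c → Carrier} → (∀ x → f x ≈ 0#) → sum c f ≈ 0#
  sum-zero c e = trans (sum-cong c e) (sum-0 c)

  sum-+ : ∀ c f g → sum c (λ x → f x + g x) ≈ sum c f + sum c g
  sum-+ (fin zero)    f g = sym (+-identityˡ _)
  sum-+ (fin (suc n)) f g = trans (+-congˡ (sum-+ (fin n) _ _)) (interchange _ _ _ _)
  sum-+ bool          f g = interchange _ _ _ _
  sum-+ (a ⊕ b)       f g = trans (+-cong (sum-+ a _ _) (sum-+ b _ _)) (interchange _ _ _ _)
  sum-+ (a ⊗ b)       f g = trans (sum-cong a (λ x → sum-+ b _ _)) (sum-+ a _ _)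

  *ˡ-additive *ʳ-additive : Carrier → Additive R R
  *ˡ-additive k = record { fun = k *_ ; cong = *-congˡ ; zer = zeroʳ k ; add = distribˡ k }
  *ʳ-additive k = record { fun = _* k ; cong = *-congʳ ; zer = zeroˡ k ; add = distribʳ k }

  neg-additive : Additive R R
  neg-additive = record { fun = -_ ; cong = -‿cong ; zer = ε⁻¹≈ε ; add = λ x y → sym (⁻¹-∙-comm x y) }

  sum-*ˡ : ∀ c k f → k * sum c f ≈ sum c (λ x → k * f x)
  sum-*ˡ c k = sum-hom (*ˡ-additive k) c

  sum-*ʳ : ∀ c k f → sum c f * k ≈ sum c (λ x → f x * k)
  sum-*ʳ c k = sum-hom (*ʳ-additive k) c

  sum-neg : ∀ c f → - sum c f ≈ sum c (λ x → - f x)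
  sum-neg = sum-hom neg-additive

  sum-swap : ∀ a b (f : El a → El b → Carrier) →
             sum a (λ x → sum b (f x)) ≈ sum b (λ y → sum a (λ x → f x y))
  sum-swap (fin zero)    b f = sym (sum-0 b)
  sum-swap (fin (suc n)) b f = trans (+-congˡ (sum-swap (fin n) b _)) (sym (sum-+ b _ _))
  sum-swap bool          b f = sym (sum-+ b _ _)
  sum-swap (a ⊕ a′)      b f = trans (+-cong (sum-swap a b _) (sum-swap a′ b _)) (sym (sum-+ b _ _))
  sum-swap (a ⊗ a′)      b f = trans (sum-cong a (λ x → sum-swap a′ b _)) (sum-swap a b _)

  δ-∧ : ∀ p q x → (if p ∧ q then 1# else 0#) * x ≈ (if p then 1# else 0#) * ((if q then 1# else 0#) * x)
  δ-∧ true  q x = sym (*-identityˡ _)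
  δ-∧ false q x = trans (zeroˡ _) (sym (zeroˡ _))

  sum-δˡ : ∀ c y (f : El c → Carrier) → sum c (λ x → δ c y x * f x) ≈ f y
  sum-δˡ (fin (suc n)) zero f =
    trans (+-cong (*-identityˡ _) (sum-zero (fin n) (λ _ → zeroˡ _))) (+-identityʳ _)
  sum-δˡ (fin (suc n)) (suc y) f =
    trans (+-cong (zeroˡ _) (sum-δˡ (fin n) y (f ∘ suc))) (+-identityˡ _)
  sum-δˡ bool true  f = trans (+-cong (*-identityˡ _) (zeroˡ _)) (+-identityʳ _)
  sum-δˡ bool false f = trans (+-cong (zeroˡ _) (*-identityˡ _)) (+-identityˡ _)
  sum-δˡ (a ⊕ b) (inj₁ y) f =
    trans (+-cong (sum-δˡ a y _) (sum-zero b (λ _ → zeroˡ _))) (+-identityʳ _)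
  sum-δˡ (a ⊕ b) (inj₂ y) f =
    trans (+-cong (sum-zero a (λ _ → zeroˡ _)) (sum-δˡ b y _)) (+-identityˡ _)
  sum-δˡ (a ⊗ b) (y , z) f = begin
    sum a (λ x → sum b (λ w → (if eqb a y x ∧ eqb b z w then 1# else 0#) * f (x , w)))
      ≈⟨ sum-cong a (λ x → sum-cong b (λ w → δ-∧ (eqb a y x) (eqb b z w) _)) ⟩
    sum a (λ x → sum b (λ w → δ a y x * (δ b z w * f (x , w))))
      ≈⟨ sum-cong a (λ x → sym (sum-*ˡ b _ _)) ⟩
    sum a (λ x → δ a y x * sum b (λ w → δ b z w * f (x , w)))
      ≈⟨ sum-δˡ a y _ ⟩
    sum b (λ w → δ b z w * f (y , w))
      ≈⟨ sum-δˡ b z _ ⟩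
    f (y , z) ∎

  δ-sym : ∀ c x y → δ c x y ≡ δ c y x
  δ-sym c x y = ≡.cong (if_then 1# else 0#) (eqb-sym c x y)

  δ-central : ∀ c x y k → δ c x y * k ≈ k * δ c x y
  δ-central c x y k with eqb c x y
  ... | true  = trans (*-identityˡ k) (sym (*-identityʳ k))
  ... | false = trans (zeroˡ k) (sym (zeroʳ k))

  sum-δʳ : ∀ c y (f : El c → Carrier) → sum c (λ x → f x * δ c x y) ≈ f y
  sum-δʳ c y f = trans
    (sum-cong c (λ x → trans (sym (δ-central c x y (f x))) (*-congʳ (reflexive (δ-sym c x y)))))
    (sum-δˡ c y f)

-- Matrices over a possibly noncommutative ring, and traces

module Matrices (R : Ring 0ℓ 0ℓ) where
  open Ring R hiding (zero)
  open SumLaws R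
  open import Relation.Binary.Reasoning.Setoid setoid

  Matrix : Ix → Ix → Set
  Matrix I J = El I → El J → Carrier

  infix 4 _≋_
  _≋_ : ∀ {I J} → Matrix I J → Matrix I J → Set
  A ≋ B = ∀ i j → A i j ≈ B i j

  infixl 7 _⊡_
  _⊡_ : ∀ {I J K} → Matrix I J → Matrix J K → Matrix I K
  _⊡_ {J = J} A B i k = sum J (λ j → A i j * B j k)

  ⊡-cong : ∀ {I J K} {A A′ : Matrix I J} {B B′ : Matrix J K} → A ≋ A′ → B ≋ B′ → A ⊡ B ≋ A′ ⊡ B′
  ⊡-cong {J = J} e f i k = sum-cong J (λ j → *-cong (e i j) (f j k))

  ⊡-assoc : ∀ {I J K L} (A : Matrix I J) (B : Matrix J K) (C : Matrix K L) → (A ⊡ B) ⊡ C ≋ A ⊡ (B ⊡ C)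
  ⊡-assoc {J = J} {K} A B C i l = begin
    sum K (λ k → sum J (λ j → A i j * B j k) * C k l)
      ≈⟨ sum-cong K (λ k → sum-*ʳ J _ _) ⟩
    sum K (λ k → sum J (λ j → (A i j * B j k) * C k l))
      ≈⟨ sum-swap K J _ ⟩
    sum J (λ j → sum K (λ k → (A i j * B j k) * C k l))
      ≈⟨ sum-cong J (λ j → sum-cong K (λ k → *-assoc _ _ _)) ⟩
    sum J (λ j → sum K (λ k → A i j * (B j k * C k l)))
      ≈⟨ sum-cong J (λ j → sum-*ˡ K _ _) ⟨
    sum J (λ j → A i j * sum K (λ k → B j k * C k l)) ∎

  ⊡-identityˡ : ∀ {I J} (A : Matrix I J) → δ I ⊡ A ≋ A
  ⊡-identityˡ {I} A i j = sum-δˡ I i (λ x → A x j)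

  ⊡-identityʳ : ∀ {I J} (A : Matrix I J) → A ⊡ δ J ≋ A
  ⊡-identityʳ {J = J} A i j = sum-δʳ J j (λ x → A i x)

  ring : Ix → Ring 0ℓ 0ℓ
  ring I = record
    { Carrier = Matrix I I
    ; _≈_ = _≋_
    ; _+_ = λ A B i j → A i j + B i j
    ; _*_ = _⊡_
    ; -_ = λ A i j → - A i j
    ; 0# = λ i j → 0#
    ; 1# = δ I
    ; isRing = record
      { +-isAbelianGroup = record
        { isGroup = record
          { isMonoid = record
            { isSemigroup = record
              { isMagma = record
                { isEquivalence = record
                  { refl = λ i j → refl
                  ; sym = λ e i j → sym (e i j)
                  ; trans = λ e f i j → trans (e i j) (f i j)
                  }
                ; ∙-cong = λ e f i j → +-cong (e i j) (f i j)
                }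
              ; assoc = λ A B C i j → +-assoc _ _ _
              }
            ; identity = (λ A i j → +-identityˡ _) , (λ A i j → +-identityʳ _)
            }
          ; inverse = (λ A i j → -‿inverseˡ _) , (λ A i j → -‿inverseʳ _)
          ; ⁻¹-cong = λ e i j → -‿cong (e i j)
          }
        ; comm = λ A B i j → +-comm _ _
        }
      ; *-cong = ⊡-cong
      ; *-assoc = ⊡-assoc
      ; *-identity = ⊡-identityˡ , ⊡-identityʳ
      ; distrib = (λ A B C i j → trans (sum-cong I (λ k → distribˡ _ _ _)) (sum-+ I _ _))
                , (λ A B C i j → trans (sum-cong I (λ k → distribʳ _ _ _)) (sum-+ I _ _))
      }
    }

  entry : ∀ {I} → El I → El I → Additive (ring I) R
  entry i j = record { fun = λ Z → Z i j ; cong = λ e → e i j ; zer = refl ; add = λ _ _ → refl }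

-- Composing with a cyclic functional makes the matrix trace cyclic over a noncommutative ring, for
-- rectangular factors too. The functional is the identity for matrices of power series and the
-- coefficient of 1 for matrices over ℚF.
module Trace {R S : Ring 0ℓ 0ℓ} (t : Additive R S)
             (t-cyclic : ∀ x y → Ring._≈_ S (Additive.fun t (Ring._*_ R x y)) (Additive.fun t (Ring._*_ R y x))) where
  private
    module R = Ring R
    module S = Ring S
    module ΣR = SumLaws R
    module ΣS = SumLaws S
  open Additive t
  open Matrices R

  tr : ∀ I → Matrix I I → S.Carrier
  tr I A = ΣS.sum I (λ i → fun (A i i))

  tr-additive : ∀ I → Additive (ring I) S
  tr-additive I = record
    { fun  = tr I
    ; cong = λ e → ΣS.sum-cong I (λ i → cong (e i i))
    ; zer  = ΣS.sum-zero I (λ _ → zer)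
    ; add  = λ A B → S.trans (ΣS.sum-cong I (λ i → add _ _)) (ΣS.sum-+ I _ _)
    }

  tr-cyclic : ∀ {I J} (A : Matrix I J) (B : Matrix J I) → tr I (A ⊡ B) S.≈ tr J (B ⊡ A)
  tr-cyclic {I} {J} A B = begin
    ΣS.sum I (λ i → fun (ΣR.sum J (λ j → A i j R.* B j i)))
      ≈⟨ ΣS.sum-cong I (λ i → sum-hom t J _) ⟩
    ΣS.sum I (λ i → ΣS.sum J (λ j → fun (A i j R.* B j i)))
      ≈⟨ ΣS.sum-swap I J _ ⟩
    ΣS.sum J (λ j → ΣS.sum I (λ i → fun (A i j R.* B j i)))
      ≈⟨ ΣS.sum-cong J (λ j → ΣS.sum-cong I (λ i → t-cyclic _ _)) ⟩
    ΣS.sum J (λ j → ΣS.sum I (λ i → fun (B j i R.* A i j)))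
      ≈⟨ ΣS.sum-cong J (λ j → sum-hom t I _) ⟨
    ΣS.sum J (λ j → fun (ΣR.sum I (λ i → B j i R.* A i j))) ∎
    where open import Relation.Binary.Reasoning.Setoid S.setoid

-- Formal power series

module Series (A : CommutativeRing 0ℓ 0ℓ) where
  open CommutativeRing A hiding (zero)
  open import Algebra.Properties.CommutativeSemigroup +-commutativeSemigroup using (interchange)
  open import Algebra.Properties.CommutativeSemigroup *-commutativeSemigroup using (x∙yz≈y∙xz)
  open import Relation.Binary.Reasoning.Setoid setoid

  Ser : Set
  Ser = ℕ → Carrier

  infix 4 _≐_
  _≐_ : Ser → Ser → Set
  f ≐ g = ∀ n → f n ≈ g n

  tail : Ser → Ser
  tail f n = f (suc n)

  infixl 6 _⊹_
  _⊹_ : Ser → Ser → Ser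
  (f ⊹ g) n = f n + g n

  infixl 7 _⋆_
  -- The Cauchy product by recursion on the index, peeling off the constant term of the left factor,
  -- so that the ring laws follow by structural induction with `tail`.
  _⋆_ : Ser → Ser → Ser
  (f ⋆ g) zero    = f 0 * g 0
  (f ⋆ g) (suc n) = f 0 * g (suc n) + (tail f ⋆ g) n

  con : Carrier → Ser
  con c zero    = c
  con c (suc n) = 0#

  shift : Ser → Ser
  shift f zero    = 0#
  shift f (suc n) = f n

  ⋆-cong≤ : ∀ n {f f′ g g′ : Ser} → (∀ i → i ℕ.≤ n → f i ≈ f′ i) → (∀ i → i ℕ.≤ n → g i ≈ g′ i) →
            (f ⋆ g) n ≈ (f′ ⋆ g′) n
  ⋆-cong≤ zero    e h = *-cong (e 0 z≤n) (h 0 z≤n)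
  ⋆-cong≤ (suc n) e h = +-cong (*-cong (e 0 z≤n) (h (suc n) ℕₚ.≤-refl))
    (⋆-cong≤ n (λ i p → e (suc i) (s≤s p)) (λ i p → h i (ℕₚ.m≤n⇒m≤1+n p)))

  ⋆-cong : ∀ {f f′ g g′} → f ≐ f′ → g ≐ g′ → f ⋆ g ≐ f′ ⋆ g′
  ⋆-cong e h n = ⋆-cong≤ n (λ i _ → e i) (λ i _ → h i)

  ⋆-zeroˡ : ∀ {f} g → (∀ n → f n ≈ 0#) → ∀ n → (f ⋆ g) n ≈ 0#
  ⋆-zeroˡ g e zero    = trans (*-congʳ (e 0)) (zeroˡ _)
  ⋆-zeroˡ g e (suc n) = trans (+-cong (trans (*-congʳ (e 0)) (zeroˡ _)) (⋆-zeroˡ g (e ∘ suc) n)) (+-identityˡ _)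

  ⋆-distribˡ : ∀ f g h → f ⋆ (g ⊹ h) ≐ f ⋆ g ⊹ f ⋆ h
  ⋆-distribˡ f g h zero    = distribˡ _ _ _
  ⋆-distribˡ f g h (suc n) = trans (+-cong (distribˡ _ _ _) (⋆-distribˡ (tail f) g h n)) (interchange _ _ _ _)

  ⋆-sucʳ : ∀ f g n → (f ⋆ g) (suc n) ≈ (f ⋆ tail g) n + f (suc n) * g 0
  ⋆-sucʳ f g zero    = refl
  ⋆-sucʳ f g (suc n) = trans (+-congˡ (⋆-sucʳ (tail f) g n)) (sym (+-assoc _ _ _))

  ⋆-comm : ∀ f g → f ⋆ g ≐ g ⋆ f
  ⋆-comm f g zero    = *-comm _ _
  ⋆-comm f g (suc n) = begin
    f 0 * g (suc n) + (tail f ⋆ g) n  ≈⟨ +-cong (*-comm _ _) (⋆-comm (tail f) g n) ⟩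
    g (suc n) * f 0 + (g ⋆ tail f) n  ≈⟨ +-comm _ _ ⟩
    (g ⋆ tail f) n + g (suc n) * f 0  ≈⟨ ⋆-sucʳ g f n ⟨
    (g ⋆ f) (suc n)                   ∎

  ⋆-distribʳ : ∀ f g h → (g ⊹ h) ⋆ f ≐ g ⋆ f ⊹ h ⋆ f
  ⋆-distribʳ f g h n = trans (⋆-comm (g ⊹ h) f n) (trans (⋆-distribˡ f g h n) (+-cong (⋆-comm f g n) (⋆-comm f h n)))

  ⋆-scaleˡ : ∀ c f g n → ((λ i → c * f i) ⋆ g) n ≈ c * (f ⋆ g) n
  ⋆-scaleˡ c f g zero    = *-assoc _ _ _
  ⋆-scaleˡ c f g (suc n) = trans (+-cong (*-assoc _ _ _) (⋆-scaleˡ c (tail f) g n)) (sym (distribˡ _ _ _))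

  ⋆-assoc : ∀ f g h → (f ⋆ g) ⋆ h ≐ f ⋆ (g ⋆ h)
  ⋆-assoc f g h zero    = *-assoc _ _ _
  ⋆-assoc f g h (suc n) = begin
    (f 0 * g 0) * h (suc n) + (((λ i → f 0 * g (suc i)) ⊹ tail f ⋆ g) ⋆ h) n
      ≈⟨ +-cong (*-assoc _ _ _) (⋆-distribʳ h _ _ n) ⟩
    f 0 * (g 0 * h (suc n)) + (((λ i → f 0 * g (suc i)) ⋆ h) n + ((tail f ⋆ g) ⋆ h) n)
      ≈⟨ +-congˡ (+-cong (⋆-scaleˡ _ _ _ n) (⋆-assoc (tail f) g h n)) ⟩
    f 0 * (g 0 * h (suc n)) + (f 0 * (tail g ⋆ h) n + (tail f ⋆ (g ⋆ h)) n)
      ≈⟨ +-assoc _ _ _ ⟨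
    f 0 * (g 0 * h (suc n)) + f 0 * (tail g ⋆ h) n + (tail f ⋆ (g ⋆ h)) n
      ≈⟨ +-congʳ (distribˡ _ _ _) ⟨
    f 0 * (g ⋆ h) (suc n) + (tail f ⋆ (g ⋆ h)) n ∎

  con-⋆ : ∀ c g n → (con c ⋆ g) n ≈ c * g n
  con-⋆ c g zero    = refl
  con-⋆ c g (suc n) = trans (+-congˡ (⋆-zeroˡ g (λ _ → refl) n)) (+-identityʳ _)

  shift-⋆ : ∀ f g → shift f ⋆ g ≐ shift (f ⋆ g)
  shift-⋆ f g zero    = zeroˡ _
  shift-⋆ f g (suc n) = trans (+-congʳ (zeroˡ _)) (+-identityˡ _)

  ⋆-identityˡ : ∀ f → con 1# ⋆ f ≐ f
  ⋆-identityˡ f n = trans (con-⋆ 1# f n) (*-identityˡ _)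

  ser : CommutativeRing 0ℓ 0ℓ
  ser = record
    { Carrier = Ser
    ; _≈_ = _≐_
    ; _+_ = _⊹_
    ; _*_ = _⋆_
    ; -_ = λ f n → - f n
    ; 0# = λ _ → 0#
    ; 1# = con 1#
    ; isCommutativeRing = record
      { isRing = record
        { +-isAbelianGroup = record
          { isGroup = record
            { isMonoid = record
              { isSemigroup = record
                { isMagma = record
                  { isEquivalence = record
                    { refl = λ n → refl
                    ; sym = λ e n → sym (e n)
                    ; trans = λ e f n → trans (e n) (f n)
                    }
                  ; ∙-cong = λ e f n → +-cong (e n) (f n)
                  }
                ; assoc = λ f g h n → +-assoc _ _ _
                }
              ; identity = (λ f n → +-identityˡ _) , (λ f n → +-identityʳ _)
              }
            ; inverse = (λ f n → -‿inverseˡ _) , (λ f n → -‿inverseʳ _)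
            ; ⁻¹-cong = λ e n → -‿cong (e n)
            }
          ; comm = λ f g n → +-comm _ _
          }
        ; *-cong = ⋆-cong
        ; *-assoc = ⋆-assoc
        ; *-identity = ⋆-identityˡ , (λ f n → trans (⋆-comm f _ n) (⋆-identityˡ f n))
        ; distrib = ⋆-distribˡ , ⋆-distribʳ
        }
      ; *-comm = ⋆-comm
      }
    }

  X : Ser
  X = shift (con 1#)

  X-⋆ : ∀ f → X ⋆ f ≐ shift f
  X-⋆ f zero    = zeroˡ _
  X-⋆ f (suc n) = trans (shift-⋆ (con 1#) f (suc n)) (⋆-identityˡ f n)

  coef-additive : ℕ → Additive (CommutativeRing.ring ser) ring
  coef-additive n = record { fun = λ f → f n ; cong = λ e → e n ; zer = refl ; add = λ f g → refl }

  _≈[_]_ : Ser → ℕ → Ser → Set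
  f ≈[ n ] g = ∀ i → i ℕ.< n → f i ≈ g i

  ⋆-cong-mod : ∀ {n f f′ g g′} → f ≈[ n ] f′ → g ≈[ n ] g′ → (f ⋆ g) ≈[ n ] (f′ ⋆ g′)
  ⋆-cong-mod e h i p = ⋆-cong≤ i (λ j q → e j (ℕₚ.≤-<-trans q p)) (λ j q → h j (ℕₚ.≤-<-trans q p))

  shift-cong-mod : ∀ {n f g} → f ≈[ n ] g → shift f ≈[ suc n ] shift g
  shift-cong-mod e zero    p       = refl
  shift-cong-mod e (suc i) (s≤s p) = e i p

  module Fixpoint {J : Set} (Φ : (J → Ser) → J → Ser)
    (contractive : ∀ n {f g : J → Ser} → (∀ j → f j ≈[ n ] g j) → ∀ j → Φ f j ≈[ suc n ] Φ g j) where

    iterate : ℕ → J → Ser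
    iterate zero    _ _ = 0#
    iterate (suc n) = Φ (iterate n)

    -- Each application of a contractive `Φ` settles one more coefficient, so coefficient k is final
    -- after k + 1 iterations and can be read off there.
    fix : J → Ser
    fix j k = iterate (suc k) j k

    iterate-step : ∀ n j → iterate n j ≈[ n ] iterate (suc n) j
    iterate-step zero    j i ()
    iterate-step (suc n) j = contractive n (iterate-step n) j

    iterate-stable : ∀ m n j i → i ℕ.< n → iterate n j i ≈ iterate (m ℕ.+ n) j i
    iterate-stable zero    n j i p = refl
    iterate-stable (suc m) n j i p = trans (iterate-stable m n j i p)
      (iterate-step (m ℕ.+ n) j i (ℕₚ.<-≤-trans p (ℕₚ.m≤n+m n m)))

    fix-iterate : ∀ n j → fix j ≈[ n ] iterate n j
    fix-iterate n j i p = trans (iterate-stable (n ℕ.∸ suc i) (suc i) j i (ℕₚ.n<1+n i))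
      (reflexive (≡.cong (λ m → iterate m j i) (ℕₚ.m∸n+n≡m p)))

    fix-unfold : ∀ j → fix j ≐ Φ fix j
    fix-unfold j k = sym (contractive k (fix-iterate k) j k (ℕₚ.n<1+n k))

  nat : ℕ → Carrier
  nat zero    = 0#
  nat (suc n) = 1# + nat n

  θ : Ser → Ser
  θ f n = nat n * f n

  θ-leibniz : ∀ f g → θ (f ⋆ g) ≐ θ f ⋆ g ⊹ f ⋆ θ g
  θ-leibniz f g zero    = begin
    0# * (f 0 * g 0)                   ≈⟨ zeroˡ _ ⟩
    0#                                 ≈⟨ +-identityˡ _ ⟨
    0# + 0#                            ≈⟨ +-cong (trans (*-congʳ (zeroˡ _)) (zeroˡ _)) (trans (*-congˡ (zeroˡ _)) (zeroʳ _)) ⟨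
    0# * f 0 * g 0 + f 0 * (0# * g 0)  ∎
  θ-leibniz f g (suc n) = begin
    N * (f 0 * g (suc n) + (tail f ⋆ g) n)
      ≈⟨ distribˡ _ _ _ ⟩
    N * (f 0 * g (suc n)) + N * (tail f ⋆ g) n
      ≈⟨ +-cong (x∙yz≈y∙xz _ _ _) tail-part ⟩
    f 0 * (N * g (suc n)) + ((tail (θ f) ⋆ g) n + (tail f ⋆ θ g) n)
      ≈⟨ sym (+-assoc _ _ _) ⟩
    f 0 * (N * g (suc n)) + (tail (θ f) ⋆ g) n + (tail f ⋆ θ g) n
      ≈⟨ +-congʳ (+-comm _ _) ⟩
    (tail (θ f) ⋆ g) n + f 0 * (N * g (suc n)) + (tail f ⋆ θ g) n
      ≈⟨ +-assoc _ _ _ ⟩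
    (tail (θ f) ⋆ g) n + (f 0 * (N * g (suc n)) + (tail f ⋆ θ g) n)
      ≈⟨ +-congʳ (trans (+-congʳ (trans (*-congʳ (zeroˡ _)) (zeroˡ _))) (+-identityˡ _)) ⟨
    0# * f 0 * g (suc n) + (tail (θ f) ⋆ g) n + (f 0 * (N * g (suc n)) + (tail f ⋆ θ g) n) ∎
    where
    N = 1# + nat n
    -- Shifting changes the weights by one: (i + 1) f_(i+1) = f_(i+1) + i f_(i+1). The extra copy of
    -- `tail f` comes from the summand 1 of `N`.
    θ-tail : tail f ⊹ θ (tail f) ≐ tail (θ f)
    θ-tail i = trans (+-congʳ (sym (*-identityˡ _))) (sym (distribʳ _ _ _))
    tail-part : N * (tail f ⋆ g) n ≈ (tail (θ f) ⋆ g) n + (tail f ⋆ θ g) n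
    tail-part = begin
      N * (tail f ⋆ g) n
        ≈⟨ distribʳ _ _ _ ⟩
      1# * (tail f ⋆ g) n + θ (tail f ⋆ g) n
        ≈⟨ +-cong (*-identityˡ _) (θ-leibniz (tail f) g n) ⟩
      (tail f ⋆ g) n + ((θ (tail f) ⋆ g) n + (tail f ⋆ θ g) n)
        ≈⟨ +-assoc _ _ _ ⟨
      (tail f ⋆ g) n + (θ (tail f) ⋆ g) n + (tail f ⋆ θ g) n
        ≈⟨ +-congʳ (⋆-distribʳ g _ _ n) ⟨
      ((tail f ⊹ θ (tail f)) ⋆ g) n + (tail f ⋆ θ g) n
        ≈⟨ +-congʳ (⋆-cong {g = g} θ-tail (λ _ → refl) n) ⟩
      (tail (θ f) ⋆ g) n + (tail f ⋆ θ g) n ∎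

  θ-additive : Additive (CommutativeRing.ring ser) (CommutativeRing.ring ser)
  θ-additive = record
    { fun = θ ; cong = λ e n → *-congˡ (e n) ; zer = λ n → zeroʳ _ ; add = λ f g n → distribˡ _ _ _ }

  θ-con : ∀ c n → θ (con c) n ≈ 0#
  θ-con c zero    = zeroˡ _
  θ-con c (suc n) = zeroʳ _

  θ-X : θ X ≐ X
  θ-X zero          = zeroˡ _
  θ-X (suc zero)    = trans (*-identityʳ _) (+-identityʳ _)
  θ-X (suc (suc n)) = zeroʳ _

  module Inverse (f : Ser) (f₀ : f 0 ≈ 1#) where
    private
      -- The inverse of f solves v = 1 - X (tail f) v, a system with a single unknown.
      Φ : (Fin 1 → Ser) → Fin 1 → Ser
      Φ v j n = con 1# n + - shift (tail f ⋆ v j) n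

      Φ-contractive : ∀ n {v w : Fin 1 → Ser} → (∀ j → v j ≈[ n ] w j) → ∀ j → Φ v j ≈[ suc n ] Φ w j
      Φ-contractive n e j i p = +-congˡ (-‿cong (shift-cong-mod (⋆-cong-mod {f = tail f} (λ _ _ → refl) (e j)) i p))

    open Fixpoint Φ Φ-contractive

    inv : Ser
    inv = fix zero

    inv-⋆ : f ⋆ inv ≐ con 1#
    inv-⋆ n = begin
      (f ⋆ inv) n                                    ≈⟨ ⋆-cong {g = inv} split (λ _ → refl) n ⟩
      ((con 1# ⊹ shift (tail f)) ⋆ inv) n            ≈⟨ ⋆-distribʳ inv _ _ n ⟩
      (con 1# ⋆ inv) n + (shift (tail f) ⋆ inv) n    ≈⟨ +-cong (⋆-identityˡ inv n) (shift-⋆ (tail f) inv n) ⟩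
      inv n + shift (tail f ⋆ inv) n                 ≈⟨ +-congʳ (fix-unfold zero n) ⟩
      con 1# n + - shift (tail f ⋆ inv) n + shift (tail f ⋆ inv) n ≈⟨ +-assoc _ _ _ ⟩
      con 1# n + (- shift (tail f ⋆ inv) n + shift (tail f ⋆ inv) n) ≈⟨ +-congˡ (-‿inverseˡ _) ⟩
      con 1# n + 0#                                  ≈⟨ +-identityʳ _ ⟩
      con 1# n                                       ∎
      where
      split : f ≐ con 1# ⊹ shift (tail f)
      split zero    = trans f₀ (sym (+-identityʳ _))
      split (suc n) = sym (+-identityˡ _)

-- Polynomials as a domain with decidable zero

record DecDomain (A : CommutativeRing 0ℓ 0ℓ) : Set₁ where
  open CommutativeRing A hiding (zero)
  field
    D       : Carrier → Set
    D-0     : D 0#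
    D-1     : D 1#
    D-+     : ∀ {x y} → D x → D y → D (x + y)
    D-*     : ∀ {x y} → D x → D y → D (x * y)
    D-neg   : ∀ {x} → D x → D (- x)
    zero?   : ∀ {x} → D x → Dec (x ≈ 0#)
    1≉0     : ¬ (1# ≈ 0#)
    domain  : ∀ {x y} → D x → D y → ¬ (x ≈ 0#) → ¬ (y ≈ 0#) → ¬ (x * y ≈ 0#)

module Polynomials {A : CommutativeRing 0ℓ 0ℓ} (dom : DecDomain A) where
  open CommutativeRing A hiding (zero)
  open DecDomain dom
  open Series A
  open import Algebra.Properties.AbelianGroup +-abelianGroup using (ε⁻¹≈ε)

  -- Series admit no zero test, so the coefficients of algebraic relations form a predicate `D`
  -- inside the ring where the relations hold; for series it consists of those with a known bound on
  -- the support. Applying `polynomials` twice gives coefficients in two variables.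
  Poly : Ser → Set
  Poly f = (∀ i → D (f i)) × ∃ λ b → ∀ i → b ℕ.≤ i → f i ≈ 0#

  firstNonzero : ∀ {f : Ser} → (∀ i → D (f i)) → ∀ b →
    (∀ i → i ℕ.< b → f i ≈ 0#) ⊎ (∃ λ k → k ℕ.< b × ¬ (f k ≈ 0#) × ∀ i → i ℕ.< k → f i ≈ 0#)
  firstNonzero Df zero    = inj₁ λ _ ()
  firstNonzero {f} Df (suc b) with firstNonzero Df b
  ... | inj₂ (k , k<b , nz , below) = inj₂ (k , ℕₚ.m<n⇒m<1+n k<b , nz , below)
  ... | inj₁ below with zero? (Df b)
  ...   | no nz = inj₂ (b , ℕₚ.n<1+n b , nz , below)
  ...   | yes z = inj₁ λ i p → helper i (ℕₚ.m<1+n⇒m<n∨m≡n p)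
    where
    helper : ∀ i → i ℕ.< b ⊎ i ≡ b → f i ≈ 0#
    helper i (inj₁ p)      = below i p
    helper i (inj₂ ≡.refl) = z

  order : ∀ {f : Ser} → Poly f → f ≐ (λ _ → 0#) ⊎ (∃ λ k → ¬ (f k ≈ 0#) × ∀ i → i ℕ.< k → f i ≈ 0#)
  order (Df , b , above) with firstNonzero Df b
  ... | inj₂ (k , _ , nz , below) = inj₂ (k , nz , below)
  ... | inj₁ below = inj₁ λ i → helper i (ℕₚ.<-≤-connex i b)
    where
    helper : ∀ i → i ℕ.< b ⊎ b ℕ.≤ i → _ ≈ 0#
    helper i (inj₁ p) = below i p
    helper i (inj₂ p) = above i p

  -- Every other product in the convolution contains a coefficient below one of the two orders. The
  -- lowest terms therefore show that a product of nonzero polynomials is nonzero.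
  ⋆-lowest : ∀ k l f g → (∀ i → i ℕ.< k → f i ≈ 0#) → (∀ i → i ℕ.< l → g i ≈ 0#) →
             (f ⋆ g) (k ℕ.+ l) ≈ f k * g l
  ⋆-lowest zero    zero    f g ef eg = refl
  ⋆-lowest zero    (suc l) f g ef eg = trans (⋆-sucʳ f g l)
    (trans (+-cong (⋆-lowest zero l f (tail g) ef (λ i p → eg (suc i) (s≤s p))) (trans (*-congˡ (eg 0 (s≤s z≤n))) (zeroʳ _)))
      (+-identityʳ _))
  ⋆-lowest (suc k) l f g ef eg =
    trans (+-congʳ (trans (*-congʳ (ef 0 (s≤s z≤n))) (zeroˡ _)))
      (trans (+-identityˡ _) (⋆-lowest k l (tail f) g (λ i p → ef (suc i) (s≤s p)) eg))

  D-⋆ : ∀ {f g} → (∀ i → D (f i)) → (∀ i → D (g i)) → ∀ n → D ((f ⋆ g) n)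
  D-⋆ Df Dg zero    = D-* (Df 0) (Dg 0)
  D-⋆ Df Dg (suc n) = D-+ (D-* (Df 0) (Dg (suc n))) (D-⋆ (Df ∘ suc) Dg n)

  ⋆-vanish : ∀ b c f g → (∀ i → b ℕ.≤ i → f i ≈ 0#) → (∀ i → c ℕ.≤ i → g i ≈ 0#) →
             ∀ n → b ℕ.+ c ℕ.≤ n → (f ⋆ g) n ≈ 0#
  ⋆-vanish zero    c f g ef eg n       p       = ⋆-zeroˡ g (λ i → ef i z≤n) n
  ⋆-vanish (suc b) c f g ef eg (suc n) (s≤s p) = trans
    (+-cong (trans (*-congˡ (eg (suc n) (ℕₚ.≤-trans (ℕₚ.m≤n+m c b) (ℕₚ.m≤n⇒m≤1+n p)))) (zeroʳ _))
            (⋆-vanish b c (tail f) g (λ i q → ef (suc i) (s≤s q)) eg n p))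
    (+-identityˡ _)

  D-con : ∀ {c} → D c → ∀ i → D (con c i)
  D-con Dc zero    = Dc
  D-con Dc (suc i) = D-0

  Poly-con : ∀ {c} → D c → Poly (con c)
  Poly-con Dc = D-con Dc , 1 , λ { (suc i) p → refl }

  Poly-X : Poly X
  Poly-X = (λ { zero → D-0 ; (suc i) → D-con D-1 i }) , 2 , λ { (suc zero) (s≤s ()) ; (suc (suc i)) p → refl }

  polynomials : DecDomain ser
  polynomials = record
    { D      = Poly
    ; D-0    = (λ _ → D-0) , 0 , λ _ _ → refl
    ; D-1    = Poly-con D-1
    ; D-+    = λ { (Df , b , ef) (Dg , c , eg) → (λ i → D-+ (Df i) (Dg i)) , b ℕ.+ c ,
                 λ i p → trans (+-cong (ef i (ℕₚ.≤-trans (ℕₚ.m≤m+n b c) p)) (eg i (ℕₚ.≤-trans (ℕₚ.m≤n+m c b) p)))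
                               (+-identityˡ _) }
    ; D-*    = λ { {f} {g} (Df , b , ef) (Dg , c , eg) → D-⋆ Df Dg , b ℕ.+ c , ⋆-vanish b c f g ef eg }
    ; D-neg  = λ { (Df , b , ef) → (λ i → D-neg (Df i)) , b , λ i p → trans (-‿cong (ef i p)) ε⁻¹≈ε }
    ; zero?  = λ p → decide (order p)
    ; 1≉0    = λ e → 1≉0 (e 0)
    ; domain = λ Pf Pg → nonzero (order Pf) (order Pg) Pf Pg
    }
    where
    decide : ∀ {f} → f ≐ (λ _ → 0#) ⊎ (∃ λ k → ¬ (f k ≈ 0#) × ∀ i → i ℕ.< k → f i ≈ 0#) → Dec (f ≐ (λ _ → 0#))
    decide (inj₁ z)            = yes z
    decide (inj₂ (k , nz , _)) = no λ z → nz (z k)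
    nonzero : ∀ {f g} → f ≐ (λ _ → 0#) ⊎ (∃ λ k → ¬ (f k ≈ 0#) × ∀ i → i ℕ.< k → f i ≈ 0#) →
              g ≐ (λ _ → 0#) ⊎ (∃ λ k → ¬ (g k ≈ 0#) × ∀ i → i ℕ.< k → g i ≈ 0#) →
              Poly f → Poly g → ¬ (f ≐ (λ _ → 0#)) → ¬ (g ≐ (λ _ → 0#)) → ¬ (f ⋆ g ≐ (λ _ → 0#))
    nonzero (inj₁ z) _ _ _ nf _ _ = nf z
    nonzero (inj₂ _) (inj₁ z) _ _ _ ng _ = ng z
    nonzero {f} {g} (inj₂ (k , fk , bf)) (inj₂ (l , gl , bg)) (Df , _) (Dg , _) _ _ e =
      domain (Df k) (Dg l) fk gl (trans (sym (⋆-lowest k l f g bf bg)) (e (k ℕ.+ l)))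

-- Sums over initial segments of the natural numbers

module RangeSums (R : Ring 0ℓ 0ℓ) where
  open Ring R hiding (zero)
  open import Algebra.Properties.CommutativeSemigroup +-commutativeSemigroup using (interchange)

  Σ< : ℕ → (ℕ → Carrier) → Carrier
  Σ< zero    f = 0#
  Σ< (suc n) f = f 0 + Σ< n (f ∘ suc)

  Σ<-cong : ∀ n {f g} → (∀ k → k ℕ.< n → f k ≈ g k) → Σ< n f ≈ Σ< n g
  Σ<-cong zero    e = refl
  Σ<-cong (suc n) e = +-cong (e 0 (s≤s z≤n)) (Σ<-cong n (λ k p → e (suc k) (s≤s p)))

  Σ<-zero : ∀ n {f} → (∀ k → k ℕ.< n → f k ≈ 0#) → Σ< n f ≈ 0#
  Σ<-zero zero    e = refl
  Σ<-zero (suc n) e = trans (+-cong (e 0 (s≤s z≤n)) (Σ<-zero n (λ k p → e (suc k) (s≤s p)))) (+-identityˡ _)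

  Σ<-snoc : ∀ n f → Σ< (suc n) f ≈ Σ< n f + f n
  Σ<-snoc zero    f = +-comm _ _
  Σ<-snoc (suc n) f = trans (+-congˡ (Σ<-snoc n (f ∘ suc))) (sym (+-assoc _ _ _))

  Σ<-+ : ∀ n f g → Σ< n (λ k → f k + g k) ≈ Σ< n f + Σ< n g
  Σ<-+ zero    f g = sym (+-identityˡ _)
  Σ<-+ (suc n) f g = trans (+-congˡ (Σ<-+ n _ _)) (interchange _ _ _ _)

  Σ<-*ˡ : ∀ n c f → c * Σ< n f ≈ Σ< n (λ k → c * f k)
  Σ<-*ˡ zero    c f = zeroʳ c
  Σ<-*ˡ (suc n) c f = trans (distribˡ _ _ _) (+-congˡ (Σ<-*ˡ n c _))

  Σ<-reverse : ∀ n f → Σ< (suc n) f ≈ Σ< (suc n) (λ k → f (n ℕ.∸ k))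
  Σ<-reverse zero    f = refl
  Σ<-reverse (suc n) f = trans (Σ<-snoc (suc n) f) (trans (+-comm _ _) (+-congˡ (Σ<-reverse n f)))

  extend : ∀ {n} → (Fin n → Carrier) → ℕ → Carrier
  extend {zero}  f _       = 0#
  extend {suc n} f zero    = f zero
  extend {suc n} f (suc k) = extend (f ∘ suc) k

  extend-toℕ : ∀ {n} (f : Fin n → Carrier) k → extend f (toℕ k) ≡ f k
  extend-toℕ f zero    = ≡.refl
  extend-toℕ f (suc k) = extend-toℕ (f ∘ suc) k

-- Algebraic elements over a domain

module Algebraicity {S : CommutativeRing 0ℓ 0ℓ} (dom : DecDomain S) where
  open CommutativeRing S hiding (zero)
  open DecDomain dom
  open SumLaws ring
  open RangeSums ring
  open import Algebra.Properties.AbelianGroup +-abelianGroup using (inverseʳ-unique)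
  open import Algebra.Properties.Ring ring using (-‿distribˡ-*; -1*x≈-x)
  open import Algebra.Properties.Semiring.Exp semiring using (_^_; ^-homo-*; ^-congˡ; ^-congʳ)
  open import Algebra.Properties.CommutativeSemiring.Exp commutativeSemiring using (^-distrib-*)
  open import Algebra.Properties.CommutativeSemigroup +-commutativeSemigroup using ()
    renaming (interchange to +-interchange)
  open import Algebra.Properties.CommutativeSemigroup *-commutativeSemigroup using (x∙yz≈y∙xz; interchange)
  open import Algebra.Solver.Ring.NaturalCoefficients.Default commutativeSemiring using (solve; _:=_; _:+_; _:*_)
  open import Relation.Binary.Reasoning.Setoid setoid

  Span : List Carrier → Carrier → Set
  Span []       h = h ≈ 0#
  Span (g ∷ gs) h = ∃ λ c → ∃ λ h′ → D c × Span gs h′ × h ≈ c * g + h′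

  Span-resp : ∀ gs {x y} → x ≈ y → Span gs x → Span gs y
  Span-resp []       e s = trans (sym e) s
  Span-resp (g ∷ gs) e (c , h , Dc , s , p) = c , h , Dc , s , trans (sym e) p

  Span-0 : ∀ gs → Span gs 0#
  Span-0 []       = refl
  Span-0 (g ∷ gs) = 0# , 0# , D-0 , Span-0 gs , sym (trans (+-identityʳ _) (zeroˡ _))

  Span-+ : ∀ gs {x y} → Span gs x → Span gs y → Span gs (x + y)
  Span-+ []       s t = trans (+-cong s t) (+-identityˡ _)
  Span-+ (g ∷ gs) (c , h , Dc , s , p) (c′ , h′ , Dc′ , s′ , p′) =
    c + c′ , h + h′ , D-+ Dc Dc′ , Span-+ gs s s′ ,
    trans (+-cong p p′) (trans (+-interchange _ _ _ _) (+-congʳ (sym (distribʳ _ _ _))))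

  Span-* : ∀ gs {k x} → D k → Span gs x → Span gs (k * x)
  Span-* []       Dk s = trans (*-congˡ s) (zeroʳ _)
  Span-* (g ∷ gs) {k} Dk (c , h , Dc , s , p) = k * c , k * h , D-* Dk Dc , Span-* gs Dk s ,
    trans (*-congˡ p) (trans (distribˡ _ _ _) (+-congʳ (sym (*-assoc _ _ _))))

  Span-∈ : ∀ {gs g c} → g ∈ gs → D c → Span gs (c * g)
  Span-∈ {_ ∷ gs} (here ≡.refl) Dc = _ , 0# , Dc , Span-0 gs , sym (+-identityʳ _)
  Span-∈ (there i)              Dc = 0# , _ , D-0 , Span-∈ i Dc , sym (trans (+-congʳ (zeroˡ _)) (+-identityˡ _))

  sum-punchIn : ∀ {n} p (f : Fin (suc n) → Carrier) → sum (fin (suc n)) f ≈ f p + sum (fin n) (f ∘ punchIn p)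
  sum-punchIn          zero    f = refl
  sum-punchIn {suc n} (suc p) f = begin
    f zero + sum (fin (suc n)) (f ∘ suc)
      ≈⟨ +-congˡ (sum-punchIn p (f ∘ suc)) ⟩
    f zero + (f (suc p) + sum (fin n) (f ∘ suc ∘ punchIn p))
      ≈⟨ solve 3 (λ a b c → a :+ (b :+ c) := b :+ (a :+ c)) refl _ _ _ ⟩
    f (suc p) + (f zero + sum (fin n) (f ∘ suc ∘ punchIn p)) ∎

  allZero? : ∀ {n} (c : Fin n → Carrier) → (∀ k → D (c k)) → (∀ k → c k ≈ 0#) ⊎ (∃ λ k → ¬ (c k ≈ 0#))
  allZero? {zero}  c Dc = inj₁ λ ()
  allZero? {suc n} c Dc with zero? (Dc zero) | allZero? (c ∘ suc) (Dc ∘ suc)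
  ... | no nz | _            = inj₂ (zero , nz)
  ... | yes z | inj₂ (k , e) = inj₂ (suc k , e)
  ... | yes z | inj₁ all     = inj₁ λ { zero → z ; (suc k) → all k }

  D-sum : ∀ n {f : Fin n → Carrier} → (∀ j → D (f j)) → D (sum (fin n) f)
  D-sum zero    Df = D-0
  D-sum (suc n) Df = D-+ (Df zero) (D-sum n (Df ∘ suc))

  D-insertAt : ∀ {n} {f : Fin n → Carrier} {v} → (∀ j → D (f j)) → D v → ∀ p k → D (insertAt f p v k)
  D-insertAt         Df Dv zero    zero    = Dv
  D-insertAt         Df Dv zero    (suc k) = Df k
  D-insertAt {suc n} Df Dv (suc p) zero    = Df zero
  D-insertAt {suc n} Df Dv (suc p) (suc k) = D-insertAt (Df ∘ suc) Dv p k

  -- Turns a relation q among the eliminated elements a h_j - c_j h_p into one among the h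
  -- themselves: h_j receives q_j a, and the pivot h_p collects -Σ q_j c_j.
  sum-insertAt : ∀ {n} p (h : Fin (suc n) → Carrier) a (c q : Fin n → Carrier) →
    sum (fin (suc n)) (λ k → insertAt (λ j → q j * a) p (sum (fin n) (λ j → q j * - c j)) k * h k) ≈
    sum (fin n) (λ j → q j * (a * h (punchIn p j) + - c j * h p))
  sum-insertAt {n} p h a c q = begin
    sum (fin (suc n)) (λ k → q′ k * h k)
      ≈⟨ sum-punchIn p (λ k → q′ k * h k) ⟩
    q′ p * h p + sum (fin n) (λ j → q′ (punchIn p j) * h (punchIn p j))
      ≈⟨ +-cong (*-congʳ (reflexive (insertAt-lookup (λ j → q j * a) p v)))
                (sum-cong (fin n) (λ j → *-congʳ (reflexive (insertAt-punchIn (λ j → q j * a) p v j)))) ⟩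
    v * h p + sum (fin n) (λ j → q j * a * h (punchIn p j))
      ≈⟨ +-congʳ (sum-*ʳ (fin n) (h p) (λ j → q j * - c j)) ⟩
    sum (fin n) (λ j → q j * - c j * h p) + sum (fin n) (λ j → q j * a * h (punchIn p j))
      ≈⟨ sum-+ (fin n) _ _ ⟨
    sum (fin n) (λ j → q j * - c j * h p + q j * a * h (punchIn p j))
      ≈⟨ sum-cong (fin n) (λ j → solve 5 (λ q n x a y → q :* n :* x :+ q :* a :* y := q :* (a :* y :+ n :* x))
                                        refl (q j) (- c j) (h p) a (h (punchIn p j))) ⟩
    sum (fin n) (λ j → q j * (a * h (punchIn p j) + - c j * h p)) ∎
    where
    v : Carrier
    v = sum (fin n) (λ j → q j * - c j)
    q′ : Fin (suc n) → Carrier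
    q′ = insertAt (λ j → q j * a) p v

  Span-pivot : ∀ gs {g a b x y x′ y′} → D a → D b → Span gs x′ → Span gs y′ → x ≈ b * g + x′ → y ≈ a * g + y′ →
               Span gs (a * x + - b * y)
  Span-pivot gs {g} {a} {b} {x} {y} {x′} {y′} Da Db s t ex ey = Span-resp gs (sym eq)
    (Span-+ gs (Span-* gs Da s) (Span-* gs (D-neg Db) t))
    where
    eq : a * x + - b * y ≈ a * x′ + - b * y′
    eq = begin
      a * x + - b * y
        ≈⟨ +-cong (*-congˡ ex) (*-congˡ ey) ⟩
      a * (b * g + x′) + - b * (a * g + y′)
        ≈⟨ solve 6 (λ a b n g x y → a :* (b :* g :+ x) :+ n :* (a :* g :+ y) :=
                                    (b :+ n) :* (a :* g) :+ (a :* x :+ n :* y)) refl a b (- b) g x′ y′ ⟩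
      (b + - b) * (a * g) + (a * x′ + - b * y′)
        ≈⟨ +-congʳ (trans (*-congʳ (-‿inverseʳ b)) (zeroˡ _)) ⟩
      0# + (a * x′ + - b * y′)
        ≈⟨ +-identityˡ _ ⟩
      a * x′ + - b * y′ ∎

  Dependent : ∀ n → (Fin n → Carrier) → Set
  Dependent n h = ∃ λ (q : Fin n → Carrier) →
    (∀ k → D (q k)) × (∃ λ k → ¬ (q k ≈ 0#)) × sum (fin n) (λ k → q k * h k) ≈ 0#

  dependent-tail : ∀ {n h} → Dependent n (h ∘ suc) → Dependent (suc n) h
  dependent-tail {n} {h} (q , Dq , (k , nz) , r) =
    q′ , Dq′ , (suc k , nz) , trans (+-cong (zeroˡ _) r) (+-identityˡ _)
    where
    q′ : Fin (suc n) → Carrier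
    q′ zero    = 0#
    q′ (suc k) = q k
    Dq′ : ∀ k → D (q′ k)
    Dq′ zero    = D-0
    Dq′ (suc k) = Dq k

  dependent-pivot : ∀ {n h} p (c : Fin (suc n) → Carrier) → (∀ k → D (c k)) → ¬ (c p ≈ 0#) →
    Dependent n (λ j → c p * h (punchIn p j) + - c (punchIn p j) * h p) → Dependent (suc n) h
  dependent-pivot {n} {h} p c Dc nzp (q , Dq , (j , nz) , r) =
    insertAt (λ j → q j * c p) p _ ,
    D-insertAt (λ j → D-* (Dq j) (Dc p)) (D-sum n (λ j → D-* (Dq j) (D-neg (Dc (punchIn p j))))) p ,
    -- Away from the pivot the new coefficients are `q j * c p`, so a nonzero `q j` stays nonzero in
    -- a domain.
    (punchIn p j , λ z → domain (Dq j) (Dc p) nz nzp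
      (trans (reflexive (≡.sym (insertAt-punchIn (λ j → q j * c p) p _ j))) z)) ,
    trans (sum-insertAt p h (c p) (λ j → c (punchIn p j)) q) r

  -- Gaussian elimination without division: a pivot removes one generator and one element.
  dependence : ∀ gs (h : Fin (suc (length gs)) → Carrier) → (∀ k → Span gs (h k)) → Dependent (suc (length gs)) h
  dependence [] h s = (λ _ → 1#) , (λ _ → D-1) , (zero , 1≉0) ,
    trans (+-identityʳ _) (trans (*-identityˡ _) (s zero))
  dependence (g ∷ gs) h s = go (allZero? c Dc)
    where
    c h′ : Fin (suc (suc (length gs))) → Carrier
    c k  = proj₁ (s k)
    h′ k = proj₁ (proj₂ (s k))
    Dc : ∀ k → D (c k)
    Dc k = proj₁ (proj₂ (proj₂ (s k)))
    span : ∀ k → Span gs (h′ k)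
    span k = proj₁ (proj₂ (proj₂ (proj₂ (s k))))
    split : ∀ k → h k ≈ c k * g + h′ k
    split k = proj₂ (proj₂ (proj₂ (proj₂ (s k))))
    go : (∀ k → c k ≈ 0#) ⊎ (∃ λ k → ¬ (c k ≈ 0#)) → Dependent (suc (suc (length gs))) h
    go (inj₁ all) = dependent-tail {h = h} (dependence gs (h ∘ suc) (λ k → Span-resp gs
      (sym (trans (split (suc k)) (trans (+-congʳ (trans (*-congʳ (all (suc k))) (zeroˡ _))) (+-identityˡ _))))
      (span (suc k))))
    go (inj₂ (p , nz)) = dependent-pivot {h = h} p c Dc nz (dependence gs _ (λ j →
      Span-pivot gs (Dc p) (Dc (punchIn p j)) (span (punchIn p j)) (span p) (split (punchIn p j)) (split p)))

  Algebraic : Carrier → Set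
  Algebraic x = ∃ λ n → ∃ λ (q : ℕ → Carrier) →
    (∀ k → D (q k)) × (∃ λ k → k ℕ.< n × ¬ (q k ≈ 0#)) × Σ< n (λ k → q k * x ^ k) ≈ 0#

  D-^ : ∀ {x} n → D x → D (x ^ n)
  D-^ zero    Dx = D-1
  D-^ (suc n) Dx = D-* Dx (D-^ n Dx)

  ^-nonzero : ∀ {x} n → D x → ¬ (x ≈ 0#) → ¬ (x ^ n ≈ 0#)
  ^-nonzero zero    Dx nz = 1≉0
  ^-nonzero (suc n) Dx nz = domain Dx (D-^ n Dx) nz (^-nonzero n Dx nz)

  module Filtration {m : ℕ} (F : Fin m → Carrier) where

    mon : List (Fin m) → Carrier
    mon []      = 1#
    mon (j ∷ w) = F j * mon w

    mon-++ : ∀ u v → mon (u ++ v) ≈ mon u * mon v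
    mon-++ []      v = sym (*-identityˡ _)
    mon-++ (j ∷ u) v = trans (*-congˡ (mon-++ u v)) (sym (*-assoc _ _ _))

    -- Polynomials in the F_j of degree at most r with coefficients in `D`. Monomials are unsorted
    -- words, since `Span` tolerates repeated generators.
    data V (r : ℕ) : Carrier → Set where
      mono : ∀ {c} w → D c → length w ℕ.≤ r → V r (c * mon w)
      V-0  : V r 0#
      V-+  : ∀ {x y} → V r x → V r y → V r (x + y)
      resp : ∀ {x y} → x ≈ y → V r x → V r y

    V-≤ : ∀ {r r′ x} → r ℕ.≤ r′ → V r x → V r′ x
    V-≤ p (mono w Dc q) = mono w Dc (ℕₚ.≤-trans q p)
    V-≤ p V-0           = V-0
    V-≤ p (V-+ s t)     = V-+ (V-≤ p s) (V-≤ p t)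
    V-≤ p (resp e s)    = resp e (V-≤ p s)

    V-con : ∀ {r c} → D c → V r c
    V-con Dc = resp (*-identityʳ _) (mono [] Dc z≤n)

    V-var : ∀ {r} j → V (suc r) (F j)
    V-var j = resp (trans (*-identityˡ _) (*-identityʳ _)) (mono (j ∷ []) D-1 (s≤s z≤n))

    V-* : ∀ {r r′ x y} → V r x → V r′ y → V (r ℕ.+ r′) (x * y)
    V-* (mono {c} u Dc p) (mono {d} v Dd q) = resp
      (trans (*-congˡ (mon-++ u v)) (interchange c d (mon u) (mon v)))
      (mono (u ++ v) (D-* Dc Dd) (ℕₚ.≤-trans (ℕₚ.≤-reflexive (Listₚ.length-++ u)) (ℕₚ.+-mono-≤ p q)))
    V-* s@(mono _ _ _) V-0        = resp (sym (zeroʳ _)) V-0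
    V-* s@(mono _ _ _) (V-+ t t′) = resp (sym (distribˡ _ _ _)) (V-+ (V-* s t) (V-* s t′))
    V-* s@(mono _ _ _) (resp e t) = resp (*-congˡ e) (V-* s t)
    V-* V-0        t = resp (sym (zeroˡ _)) V-0
    V-* (V-+ s s′) t = resp (sym (distribʳ _ _ _)) (V-+ (V-* s t) (V-* s′ t))
    V-* (resp e s) t = resp (*-congʳ e) (V-* s t)

    V-scale : ∀ {r c x} → D c → V r x → V r (c * x)
    V-scale Dc s = V-* (V-con {0} Dc) s

    V-neg : ∀ {r x} → V r x → V r (- x)
    V-neg s = resp (-1*x≈-x _) (V-scale (D-neg D-1) s)

    V-^ : ∀ {r x} n → V r x → V (n ℕ.* r) (x ^ n)
    V-^ zero    s = V-con D-1
    V-^ (suc n) s = V-* s (V-^ n s)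

    V-Σ< : ∀ {r} n {f} → (∀ k → k ℕ.< n → V r (f k)) → V r (Σ< n f)
    V-Σ< zero    s = V-0
    V-Σ< (suc n) s = V-+ (s 0 (s≤s z≤n)) (V-Σ< n (λ k p → s (suc k) (s≤s p)))

    words : ℕ → List (List (Fin m))
    words zero    = [] ∷ []
    words (suc r) = [] ∷ List.cartesianProductWith _∷_ (List.allFin m) (words r)

    words-complete : ∀ r w → length w ℕ.≤ r → w ∈ words r
    words-complete zero    []      p       = here ≡.refl
    words-complete (suc r) []      p       = here ≡.refl
    words-complete (suc r) (j ∷ w) (s≤s p) =
      there (∈-cartesianProductWith⁺ _∷_ (∈-allFin j) (words-complete r w p))

    V⇒Span : ∀ {r x} → V r x → Span (List.map mon (words r)) x
    V⇒Span {r} (mono w Dc p) = Span-∈ (∈-map⁺ mon (words-complete r w p)) Dc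
    V⇒Span {r} V-0           = Span-0 (List.map mon (words r))
    V⇒Span {r} (V-+ s t)     = Span-+ (List.map mon (words r)) (V⇒Span s) (V⇒Span t)
    V⇒Span {r} (resp e s)    = Span-resp (List.map mon (words r)) e (V⇒Span s)

    -- Gathers all occurrences of `j`; the remaining word avoids `j`, which lets `pigeonhole`
    -- recurse on a shorter list of letters.
    extract : ∀ j w → ∃ λ k → ∃ λ w′ → mon w ≈ F j ^ k * mon w′ × length w ≡ k ℕ.+ length w′ ×
              (∀ js → All (_∈ j ∷ js) w → All (_∈ js) w′)
    extract j [] = 0 , [] , sym (*-identityˡ _) , ≡.refl , λ _ _ → []
    extract j (i ∷ w) with extract j w | i Fin.≟ j
    ... | k , w′ , e , l , a | yes ≡.refl = suc k , w′ , trans (*-congˡ e) (sym (*-assoc _ _ _)) , ≡.cong suc l ,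
          λ { js (_ ∷ p) → a js p }
    ... | k , w′ , e , l , a | no i≢j = k , i ∷ w′ , trans (*-congˡ e) (x∙yz≈y∙xz _ _ _) ,
          ≡.trans (≡.cong suc l) (≡.sym (ℕₚ.+-suc k _)) ,
          λ { js (here i≡j ∷ p) → contradiction i≡j i≢j ; js (there i∈js ∷ p) → i∈js ∷ a js p }

    mon-replicate : ∀ k j → mon (replicate k j) ≈ F j ^ k
    mon-replicate zero    j = refl
    mon-replicate (suc k) j = *-congˡ (mon-replicate k j)

    -- Treats one letter of `js` at a time: k ≤ b occurrences are charged to the length bound and
    -- removed, while more than b occurrences give the power at once.
    pigeonhole : ∀ b js w → All (_∈ js) w → length w ℕ.≤ length js ℕ.* b ⊎
      (∃ λ j → ∃ λ w′ → mon w ≈ F j ^ suc b * mon w′ × length w ≡ suc b ℕ.+ length w′)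
    pigeonhole b [] []            a        = inj₁ z≤n
    pigeonhole b [] (i ∷ w)       (() ∷ _)
    pigeonhole b (j ∷ js) w a with extract j w
    ... | k , w′ , e , l , a′ with k ℕ.≤? b
    ...   | no k≰b = inj₂ (j , replicate r j ++ w′ , eq , len)
      where
      r = k ℕ.∸ suc b
      k≡ : suc b ℕ.+ r ≡ k
      k≡ = ℕₚ.m+[n∸m]≡n (ℕₚ.≰⇒> k≰b)
      eq : mon w ≈ F j ^ suc b * mon (replicate r j ++ w′)
      eq = begin
        mon w                                    ≈⟨ e ⟩
        F j ^ k * mon w′                         ≈⟨ *-congʳ (^-congʳ (F j) (≡.sym k≡)) ⟩
        F j ^ (suc b ℕ.+ r) * mon w′             ≈⟨ *-congʳ (^-homo-* (F j) (suc b) r) ⟩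
        F j ^ suc b * F j ^ r * mon w′           ≈⟨ *-assoc _ _ _ ⟩
        F j ^ suc b * (F j ^ r * mon w′)         ≈⟨ *-congˡ (*-congʳ (mon-replicate r j)) ⟨
        F j ^ suc b * (mon (replicate r j) * mon w′) ≈⟨ *-congˡ (mon-++ (replicate r j) w′) ⟨
        F j ^ suc b * mon (replicate r j ++ w′)  ∎
      len : length w ≡ suc b ℕ.+ length (replicate r j ++ w′)
      len = ≡.trans l (≡.trans (≡.cong (ℕ._+ length w′) (≡.sym k≡)) (≡.trans (ℕₚ.+-assoc (suc b) r (length w′))
        (≡.cong (suc b ℕ.+_) (≡.sym (≡.trans (Listₚ.length-++ (replicate r j))
          (≡.cong (ℕ._+ length w′) (Listₚ.length-replicate r)))))))
    ...   | yes k≤b with pigeonhole b js w′ (a′ js a)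
    ...     | inj₁ p = inj₁ (ℕₚ.≤-trans (ℕₚ.≤-reflexive l) (ℕₚ.+-mono-≤ k≤b p))
    ...     | inj₂ (i , w″ , e′ , l′) = inj₂ (i , replicate k j ++ w″ , eq , len)
      where
      eq : mon w ≈ F i ^ suc b * mon (replicate k j ++ w″)
      eq = begin
        mon w                                ≈⟨ trans e (*-congˡ e′) ⟩
        F j ^ k * (F i ^ suc b * mon w″)     ≈⟨ x∙yz≈y∙xz _ _ _ ⟩
        F i ^ suc b * (F j ^ k * mon w″)     ≈⟨ *-congˡ (*-congʳ (mon-replicate k j)) ⟨
        F i ^ suc b * (mon (replicate k j) * mon w″) ≈⟨ *-congˡ (mon-++ (replicate k j) w″) ⟨
        F i ^ suc b * mon (replicate k j ++ w″) ∎
      len : length w ≡ suc b ℕ.+ length (replicate k j ++ w″)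
      len = ≡.trans l (≡.trans (≡.cong (k ℕ.+_) l′) (≡.trans (swap k (suc b) (length w″))
        (≡.cong (suc b ℕ.+_) (≡.sym (≡.trans (Listₚ.length-++ (replicate k j))
          (≡.cong (ℕ._+ length w″) (Listₚ.length-replicate k)))))))
        where
        swap : ∀ x y z → x ℕ.+ (y ℕ.+ z) ≡ y ℕ.+ (x ℕ.+ z)
        swap x y z = ≡.trans (≡.sym (ℕₚ.+-assoc x y z)) (≡.trans (≡.cong (ℕ._+ z) (ℕₚ.+-comm x y)) (ℕₚ.+-assoc y x z))

    module Reduction {E : Carrier} {b : ℕ} (DE : D E) (E≉0 : ¬ (E ≈ 0#))
                     (reducible : ∀ j → V b (E * F j ^ suc b)) where

      T : ℕ
      T = length (List.allFin m) ℕ.* b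

      -- Beyond length T = m b some generator occurs b + 1 times, and `reducible` trades E times
      -- that power for an element of degree b. One factor E thus buys a decrease of the degree by
      -- one.
      lower : ∀ {r x} → T ℕ.≤ r → V (suc r) x → V r (E * x)
      lower p V-0        = resp (sym (zeroʳ _)) V-0
      lower p (V-+ s t)  = resp (sym (distribˡ _ _ _)) (V-+ (lower p s) (lower p t))
      lower p (resp e s) = resp (*-congˡ e) (lower p s)
      lower {r} p (mono {c} w Dc q) with pigeonhole b (List.allFin m) w (All.universal ∈-allFin w)
      ... | inj₁ l = resp (*-assoc _ _ _) (mono w (D-* DE Dc) (ℕₚ.≤-trans l p))
      ... | inj₂ (j , w′ , e , l) = V-≤ bound (resp eq (V-* (mono w′ Dc ℕₚ.≤-refl) (reducible j)))
        where
        eq : c * mon w′ * (E * F j ^ suc b) ≈ E * (c * mon w)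
        eq = trans (solve 4 (λ c w E f → c :* w :* (E :* f) := E :* (c :* (f :* w))) refl c (mon w′) E (F j ^ suc b))
                   (*-congˡ (*-congˡ (sym e)))
        bound : length w′ ℕ.+ b ℕ.≤ r
        bound = ℕₚ.≤-pred (ℕₚ.≤-trans
          (ℕₚ.≤-reflexive (≡.trans (≡.cong suc (ℕₚ.+-comm (length w′) b)) (≡.sym l))) q)

      lower-^ : ∀ k {x} → V (k ℕ.+ T) x → V T (E ^ k * x)
      lower-^ zero    s = resp (sym (*-identityˡ _)) s
      lower-^ (suc k) s = resp (solve 3 (λ a e x → a :* (e :* x) := e :* a :* x) refl _ _ _)
        (lower-^ k (lower (ℕₚ.m≤n+m T k) s))

      algebraic : ∀ {e x} → V e x → Algebraic x
      algebraic {e} {x} s = suc N , q , Dq , (toℕ k , Finₚ.toℕ<n k , nz) , relation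
        where
        gs = List.map mon (words T)
        N = length gs
        -- For k ≤ N the power x^k has degree at most k e ≤ L, so the common factor E^L brings N + 1
        -- powers of x into `V T`, which has only N generators.
        L = N ℕ.* e
        span : ∀ (k : Fin (suc N)) → Span gs (E ^ L * x ^ toℕ k)
        span k = V⇒Span (lower-^ L (V-≤ (ℕₚ.≤-trans (ℕₚ.*-monoˡ-≤ e (ℕₚ.≤-pred (Finₚ.toℕ<n k))) (ℕₚ.m≤m+n L T)) (V-^ (toℕ k) s)))
        dep = dependence gs (λ k → E ^ L * x ^ toℕ k) span
        k = proj₁ (proj₁ (proj₂ (proj₂ dep)))
        q₀ : Fin (suc N) → Carrier
        q₀ k = proj₁ dep k * E ^ L
        q : ℕ → Carrier
        q = extend q₀
        D-extend : ∀ {n} {f : Fin n → Carrier} → (∀ k → D (f k)) → ∀ k → D (extend f k)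
        D-extend {zero}  Df k       = D-0
        D-extend {suc n} Df zero    = Df zero
        D-extend {suc n} Df (suc k) = D-extend (Df ∘ suc) k
        Dq : ∀ k → D (q k)
        Dq = D-extend (λ k → D-* (proj₁ (proj₂ dep) k) (D-^ L DE))
        nz : ¬ (q (toℕ k) ≈ 0#)
        nz z = domain (proj₁ (proj₂ dep) k) (D-^ L DE) (proj₂ (proj₁ (proj₂ (proj₂ dep)))) (^-nonzero L DE E≉0)
          (trans (reflexive (≡.sym (extend-toℕ q₀ k))) z)
        Σ<-extend : ∀ {n} (f : Fin n → Carrier) (g : ℕ → Carrier) →
                    Σ< n (λ k → extend f k * g k) ≈ sum (fin n) (λ k → f k * g (toℕ k))
        Σ<-extend {zero}  f g = refl
        Σ<-extend {suc n} f g = +-congˡ (Σ<-extend (f ∘ suc) (g ∘ suc))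
        relation : Σ< (suc N) (λ k → q k * x ^ k) ≈ 0#
        relation = begin
          Σ< (suc N) (λ k → q k * x ^ k)              ≈⟨ Σ<-extend q₀ (x ^_) ⟩
          sum (fin (suc N)) (λ k → q₀ k * x ^ toℕ k)  ≈⟨ sum-cong (fin (suc N)) (λ k → *-assoc (proj₁ dep k) (E ^ L) (x ^ toℕ k)) ⟩
          sum (fin (suc N)) (λ k → proj₁ dep k * (E ^ L * x ^ toℕ k)) ≈⟨ proj₂ (proj₂ (proj₂ dep)) ⟩
          0#                                          ∎

  algebraic-resp : ∀ {x y} → x ≈ y → Algebraic x → Algebraic y
  algebraic-resp e (n , q , Dq , nz , r) = n , q , Dq , nz ,
    trans (Σ<-cong n (λ k _ → *-congˡ (^-congˡ k (sym e)))) r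

  algebraic-D : ∀ {c} → D c → Algebraic c
  algebraic-D {c} Dc = 2 , q , Dq , (1 , s≤s (s≤s z≤n) , 1≉0) , rel
    where
    q : ℕ → Carrier
    q zero          = - c
    q (suc zero)    = 1#
    q (suc (suc _)) = 0#
    Dq : ∀ k → D (q k)
    Dq zero          = D-neg Dc
    Dq (suc zero)    = D-1
    Dq (suc (suc _)) = D-0
    rel : - c * 1# + (1# * (c * 1#) + 0#) ≈ 0#
    rel = trans (+-cong (*-identityʳ _) (trans (+-identityʳ _) (trans (*-identityˡ _) (*-identityʳ _)))) (-‿inverseˡ c)

  -- Multiplying the relation by y^n turns x^k into y^(n-k), so the reversed list of coefficients
  -- annihilates y.
  algebraic-inverse : ∀ {x y} → x * y ≈ 1# → Algebraic x → Algebraic y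
  algebraic-inverse {x} {y} xy (suc n , q , Dq , (k , s≤s k≤n , nz) , r) =
    suc n , (λ k → q (n ℕ.∸ k)) , (λ k → Dq (n ℕ.∸ k)) ,
    (n ℕ.∸ k , s≤s (ℕₚ.m∸n≤m n k) , λ z → nz (trans (reflexive (≡.cong q (≡.sym (ℕₚ.m∸[m∸n]≡n k≤n)))) z)) ,
    (begin
      Σ< (suc n) (λ k → q (n ℕ.∸ k) * y ^ k)
        ≈⟨ Σ<-cong (suc n) (λ k p → *-congˡ {q (n ℕ.∸ k)} (sym (^-congʳ y (ℕₚ.m∸[m∸n]≡n (ℕₚ.≤-pred p))))) ⟩
      Σ< (suc n) (λ k → q (n ℕ.∸ k) * y ^ (n ℕ.∸ (n ℕ.∸ k)))
        ≈⟨ Σ<-reverse n (λ k → q k * y ^ (n ℕ.∸ k)) ⟨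
      Σ< (suc n) (λ k → q k * y ^ (n ℕ.∸ k))
        ≈⟨ Σ<-cong (suc n) (λ k p → trans (*-congˡ {q k} (power k (ℕₚ.≤-pred p))) (x∙yz≈y∙xz _ _ _)) ⟩
      Σ< (suc n) (λ k → y ^ n * (q k * x ^ k))
        ≈⟨ Σ<-*ˡ (suc n) (y ^ n) (λ k → q k * x ^ k) ⟨
      y ^ n * Σ< (suc n) (λ k → q k * x ^ k)
        ≈⟨ trans (*-congˡ r) (zeroʳ _) ⟩
      0# ∎)
    where
    1^ : ∀ k → 1# ^ k ≈ 1#
    1^ zero    = refl
    1^ (suc k) = trans (*-identityˡ _) (1^ k)
    power : ∀ k → k ℕ.≤ n → y ^ (n ℕ.∸ k) ≈ y ^ n * x ^ k
    power k p = sym (begin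
      y ^ n * x ^ k                      ≈⟨ *-congʳ (^-congʳ y (≡.sym (ℕₚ.m∸n+n≡m p))) ⟩
      y ^ (n ℕ.∸ k ℕ.+ k) * x ^ k        ≈⟨ *-congʳ (^-homo-* y (n ℕ.∸ k) k) ⟩
      y ^ (n ℕ.∸ k) * y ^ k * x ^ k      ≈⟨ *-assoc _ _ _ ⟩
      y ^ (n ℕ.∸ k) * (y ^ k * x ^ k)    ≈⟨ *-congˡ (^-distrib-* y x k) ⟨
      y ^ (n ℕ.∸ k) * (y * x) ^ k        ≈⟨ *-congˡ (trans (^-congˡ k (trans (*-comm y x) xy)) (1^ k)) ⟩
      y ^ (n ℕ.∸ k) * 1#                 ≈⟨ *-identityʳ _ ⟩
      y ^ (n ℕ.∸ k)                      ∎)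

  -- Discarding vanishing top coefficients by the zero test puts the relation into the form that
  -- `Reduction` asks for.
  leading : ∀ {x} → Algebraic x → ∃ λ b → ∃ λ E → ∃ λ (c : ℕ → Carrier) →
    D E × ¬ (E ≈ 0#) × (∀ k → D (c k)) × E * x ^ suc b ≈ Σ< (suc b) (λ k → c k * x ^ k)
  leading {x} (n , q , Dq , (k , k<n , nz) , r) = go n k<n r
    where
    go : ∀ n → k ℕ.< n → Σ< n (λ k → q k * x ^ k) ≈ 0# → _
    go (suc n) k<n r with zero? (Dq n)
    go (suc n) k<n r | yes z = go n (strict (ℕₚ.m<1+n⇒m<n∨m≡n k<n))
        (trans (sym (trans (Σ<-snoc n _) (trans (+-congˡ (trans (*-congʳ z) (zeroˡ _))) (+-identityʳ _)))) r)
      where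
      strict : k ℕ.< n ⊎ k ≡ n → k ℕ.< n
      strict (inj₁ p)      = p
      strict (inj₂ ≡.refl) = contradiction z nz
    -- The relation would read q₀ = 0 with q₀ nonzero, so the leading exponent is at least 1.
    go (suc zero)    k<n r | no nz′ = contradiction (trans (sym (trans (+-identityʳ _) (*-identityʳ _))) r) nz′
    go (suc (suc b)) k<n r | no nz′ = b , q (suc b) , (λ k → - q k) , Dq (suc b) , nz′ , (λ k → D-neg (Dq k)) ,
      (begin
        q (suc b) * x ^ suc b
          ≈⟨ inverseʳ-unique _ _ (trans (sym (Σ<-snoc (suc b) (λ k → q k * x ^ k))) r) ⟩
        - Σ< (suc b) (λ k → q k * x ^ k)
          ≈⟨ -1*x≈-x _ ⟨
        - 1# * Σ< (suc b) (λ k → q k * x ^ k)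
          ≈⟨ Σ<-*ˡ (suc b) (- 1#) (λ k → q k * x ^ k) ⟩
        Σ< (suc b) (λ k → - 1# * (q k * x ^ k))
          ≈⟨ Σ<-cong (suc b) (λ k _ → trans (-1*x≈-x _) (-‿distribˡ-* (q k) (x ^ k))) ⟩
        Σ< (suc b) (λ k → - q k * x ^ k) ∎)

  module Pair {x y : Carrier} (Ax : Algebraic x) (Ay : Algebraic y) where
    private
      F : Fin 2 → Carrier
      F zero    = x
      F (suc _) = y

      open Filtration F

      V-leading : ∀ {b E} {c : ℕ → Carrier} j → (∀ k → D (c k)) → E * F j ^ suc b ≈ Σ< (suc b) (λ k → c k * F j ^ k) → V b (E * F j ^ suc b)
      V-leading {b} j Dc e = resp (sym e) (V-Σ< (suc b) (λ k p →
        V-scale (Dc k) (V-≤ (ℕₚ.≤-trans (ℕₚ.≤-reflexive (ℕₚ.*-identityʳ k)) (ℕₚ.≤-pred p)) (V-^ k (V-var {0} j)))))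

      -- `Reduction` wants one exponent for all generators. Multiplying by further powers brings the
      -- relations for x and y to the common exponent b₂ + b₁ + 1.
      raise : ∀ {b E} b′ j → V b (E * F j ^ suc b) → V (b′ ℕ.+ b) (E * F j ^ suc (b′ ℕ.+ b))
      raise {b} {E} b′ j s = V-≤ (ℕₚ.≤-reflexive (≡.cong (ℕ._+ b) (ℕₚ.*-identityʳ b′)))
        (resp eq (V-* (V-^ b′ (V-var {0} j)) s))
        where
        eq : F j ^ b′ * (E * F j ^ suc b) ≈ E * F j ^ suc (b′ ℕ.+ b)
        eq = trans (x∙yz≈y∙xz _ _ _) (*-congˡ (trans (sym (^-homo-* (F j) b′ (suc b))) (^-congʳ (F j) (ℕₚ.+-suc b′ b))))

      b₁ = proj₁ (leading Ax)
      E₁ = proj₁ (proj₂ (leading Ax))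
      b₂ = proj₁ (leading Ay)
      E₂ = proj₁ (proj₂ (leading Ay))

      reducible : ∀ j → V (b₂ ℕ.+ b₁) (E₂ * E₁ * F j ^ suc (b₂ ℕ.+ b₁))
      reducible zero with leading Ax | leading Ay
      ... | b₁ , E₁ , c₁ , D₁ , nz₁ , Dc₁ , e₁ | b₂ , E₂ , c₂ , D₂ , nz₂ , Dc₂ , e₂ =
        resp (sym (*-assoc _ _ _)) (V-scale D₂ (raise b₂ zero (V-leading {c = c₁} zero Dc₁ e₁)))
      reducible (suc zero) with leading Ax | leading Ay
      ... | b₁ , E₁ , c₁ , D₁ , nz₁ , Dc₁ , e₁ | b₂ , E₂ , c₂ , D₂ , nz₂ , Dc₂ , e₂ =
        resp (trans (sym (*-assoc _ _ _)) (*-congʳ (*-comm _ _)))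
          (≡.subst (λ b → V b (E₁ * (E₂ * y ^ suc b))) (ℕₚ.+-comm b₁ b₂)
            (V-scale D₁ (raise b₁ (suc zero) (V-leading {c = c₂} (suc zero) Dc₂ e₂))))

      D-E : D (E₂ * E₁)
      D-E = D-* (proj₁ (proj₂ (proj₂ (proj₂ (leading Ay))))) (proj₁ (proj₂ (proj₂ (proj₂ (leading Ax)))))

      E-nonzero : ¬ (E₂ * E₁ ≈ 0#)
      E-nonzero = domain (proj₁ (proj₂ (proj₂ (proj₂ (leading Ay))))) (proj₁ (proj₂ (proj₂ (proj₂ (leading Ax)))))
        (proj₁ (proj₂ (proj₂ (proj₂ (proj₂ (leading Ay)))))) (proj₁ (proj₂ (proj₂ (proj₂ (proj₂ (leading Ax))))))

      open Reduction D-E E-nonzero reducible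

    algebraic-+ : Algebraic (x + y)
    algebraic-+ = algebraic {1} (V-+ (V-var zero) (V-var (suc zero)))

    algebraic-* : Algebraic (x * y)
    algebraic-* = algebraic (V-* (V-var {0} zero) (V-var {0} (suc zero)))

  open Pair public

  algebraic-neg : ∀ {x} → Algebraic x → Algebraic (- x)
  algebraic-neg Ax = algebraic-resp (-1*x≈-x _) (algebraic-* (algebraic-D (D-neg D-1)) Ax)

-- Polynomial systems and their deformation

elements : ∀ c → List (El c)
elements (fin n) = List.allFin n
elements bool    = true ∷ false ∷ []
elements (a ⊕ b) = List.map inj₁ (elements a) ++ List.map inj₂ (elements b)
elements (a ⊗ b) = List.cartesianProduct (elements a) (elements b)

elements-complete : ∀ c x → x ∈ elements c
elements-complete (fin n) i        = ∈-allFin i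
elements-complete bool    true     = here ≡.refl
elements-complete bool    false    = there (here ≡.refl)
elements-complete (a ⊕ b) (inj₁ x) = ∈-++⁺ˡ (∈-map⁺ inj₁ (elements-complete a x))
elements-complete (a ⊕ b) (inj₂ y) = ∈-++⁺ʳ _ (∈-map⁺ inj₂ (elements-complete b y))
elements-complete (a ⊗ b) (x , y)  = ∈-cartesianProduct⁺ (elements-complete a x) (elements-complete b y)

addUp : ∀ c → (El c → ℕ) → ℕ
addUp (fin zero)    f = 0
addUp (fin (suc n)) f = f zero ℕ.+ addUp (fin n) (f ∘ suc)
addUp bool          f = f true ℕ.+ f false
addUp (a ⊕ b)       f = addUp a (f ∘ inj₁) ℕ.+ addUp b (f ∘ inj₂)
addUp (a ⊗ b)       f = addUp a (λ x → addUp b (λ y → f (x , y)))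

≤-addUp : ∀ c f x → f x ℕ.≤ addUp c f
≤-addUp (fin (suc n)) f zero     = ℕₚ.m≤m+n _ _
≤-addUp (fin (suc n)) f (suc x)  = ℕₚ.≤-trans (≤-addUp (fin n) (f ∘ suc) x) (ℕₚ.m≤n+m _ _)
≤-addUp bool          f true     = ℕₚ.m≤m+n _ _
≤-addUp bool          f false    = ℕₚ.m≤n+m _ _
≤-addUp (a ⊕ b)       f (inj₁ x) = ℕₚ.≤-trans (≤-addUp a (f ∘ inj₁) x) (ℕₚ.m≤m+n _ _)
≤-addUp (a ⊕ b)       f (inj₂ y) = ℕₚ.≤-trans (≤-addUp b (f ∘ inj₂) y) (ℕₚ.m≤n+m _ _)
≤-addUp (a ⊗ b)       f (x , y)  = ℕₚ.≤-trans (≤-addUp b (λ y → f (x , y)) y)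
                                     (≤-addUp a (λ x → addUp b (λ y → f (x , y))) x)

-- Right-hand sides are syntax because the same polynomial is evaluated in the series ring and, for
-- the deformation, over one more variable, and because its degree must be read off.
data Expr (K J : Set) : Set where
  var      : J → Expr K J
  const    : K → Expr K J
  X        : Expr K J
  _∔_ _∙_  : Expr K J → Expr K J → Expr K J

-- An upper bound for the degree in the unknowns: summands are added up where a maximum would be
-- sharper, and the series variable counts as a scalar.
degree : ∀ {K J} → Expr K J → ℕ
degree (var j)   = 1
degree (const c) = 0
degree X         = 0
degree (e ∔ e′)  = degree e ℕ.+ degree e′
degree (e ∙ e′)  = degree e ℕ.+ degree e′

module Specialisation {A : CommutativeRing 0ℓ 0ℓ} (dom : DecDomain A) where
  private
    module A = CommutativeRing A
    module S₁ = Series A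
    module S₂ = Series S₁.ser
    module R₁ = CommutativeRing S₁.ser
    module R₂ = CommutativeRing S₂.ser
    module P₁ = Polynomials dom
    module P₂ = Polynomials P₁.polynomials
    module Alg₁ = Algebraicity P₁.polynomials
    module Alg₂ = Algebraicity P₂.polynomials
    module Σ₁ = RangeSums R₁.ring
    module Σ₂ = RangeSums R₂.ring
    open import Algebra.Properties.Semiring.Exp R₁.semiring using () renaming (_^_ to _^₁_)
    open import Algebra.Properties.Semiring.Exp R₂.semiring using () renaming (_^_ to _^₂_)

  -- The coefficients of an element of A[[ε]][[s]] are indexed by the exponent of s first; π sets ε = 0.
  π : S₂.Ser → S₁.Ser
  π f n = f n 0

  ε : S₂.Ser
  ε = S₂.con S₁.X

  π-* : ∀ f g → π (f S₂.⋆ g) S₁.≐ π f S₁.⋆ π g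
  π-* f g zero    = A.refl
  π-* f g (suc n) = A.+-congˡ (π-* (S₂.tail f) g n)

  π-1 : π R₂.1# S₁.≐ R₁.1#
  π-1 zero    = A.refl
  π-1 (suc n) = A.refl

  π-^ : ∀ f n → π (f ^₂ n) S₁.≐ π f ^₁ n
  π-^ f zero    = π-1
  π-^ f (suc n) = R₁.trans (π-* f (f ^₂ n)) (R₁.*-congˡ {π f} (π-^ f n))

  π-Σ< : ∀ n f → π (Σ₂.Σ< n f) S₁.≐ Σ₁.Σ< n (π ∘ f)
  π-Σ< zero    f i = A.refl
  π-Σ< (suc n) f i = A.+-congˡ (π-Σ< n (f ∘ suc) i)

  -- Drops the coefficients of ε⁰ and lowers the exponents of ε, which is division by ε whenever
  -- `π f` vanishes.
  σ : S₂.Ser → S₂.Ser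
  σ f n j = f n (suc j)

  ε-⋆ : ∀ f n → (ε S₂.⋆ f) n R₁.≈ S₁.shift (f n)
  ε-⋆ f n = R₁.trans (S₂.con-⋆ S₁.X f n) (S₁.X-⋆ (f n))

  ε-σ : ∀ f → π f S₁.≐ (λ _ → A.0#) → f R₂.≈ ε S₂.⋆ σ f
  ε-σ f z n = R₁.trans (split n) (R₁.sym (ε-⋆ (σ f) n))
    where
    split : ∀ n → f n R₁.≈ S₁.shift (σ f n)
    split n zero    = z n
    split n (suc j) = A.refl

  σ-Poly : ∀ {f} → P₂.Poly f → P₂.Poly (σ f)
  σ-Poly {f} (Df , b , e) = inner , b , λ i p j → e i p (suc j)
    where
    inner : ∀ i → P₁.Poly (σ f i)
    inner i with Df i
    ... | Dfi , c , e′ = (λ j → Dfi (suc j)) , c , λ j p → e′ (suc j) (ℕₚ.m≤n⇒m≤1+n p)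

  π-Poly : ∀ {f} → P₂.Poly f → P₁.Poly (π f)
  π-Poly (Df , b , e) = (λ i → proj₁ (Df i) 0) , b , λ i p → e i p 0

  search : ∀ n (q : ℕ → S₁.Ser) → (∀ k → P₁.Poly (q k)) →
    (∀ k → k ℕ.< n → q k R₁.≈ R₁.0#) ⊎ (∃ λ k → k ℕ.< n × ¬ (q k R₁.≈ R₁.0#))
  search zero    q Pq = inj₁ λ _ ()
  search (suc n) q Pq with DecDomain.zero? P₁.polynomials (Pq 0) | search n (q ∘ suc) (Pq ∘ suc)
  ... | no nz | _                 = inj₂ (0 , s≤s z≤n , nz)
  ... | yes z | inj₂ (k , p , nz) = inj₂ (suc k , s≤s p , nz)
  ... | yes z | inj₁ all          = inj₁ λ { zero _ → z ; (suc k) (s≤s p) → all k p }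

  -- Divide the relation by ε until it survives setting ε = 0.
  π-algebraic-from : ∀ x n j (q : ℕ → S₂.Ser) → (∀ k → P₂.Poly (q k)) →
    (∃ λ k → k ℕ.< n × ∃ λ i → ¬ (q k i j A.≈ A.0#)) →
    Σ₂.Σ< n (λ k → q k S₂.⋆ (x ^₂ k)) R₂.≈ R₂.0# → Alg₁.Algebraic (π x)
  π-algebraic-from x n j q Pq (k , k<n , i , nz) r with search n (π ∘ q) (π-Poly ∘ Pq)
  ... | inj₂ found = n , π ∘ q , π-Poly ∘ Pq , found ,
        R₁.trans (Σ₁.Σ<-cong n (λ k _ → R₁.sym (R₁.trans (π-* (q k) (x ^₂ k)) (R₁.*-congˡ {π (q k)} (π-^ x k)))))
          (R₁.trans (R₁.sym (π-Σ< n _)) (λ i → r i 0))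
  -- The exponent j of ε in a known nonzero coefficient bounds the number of divisions: at j = 0
  -- that coefficient is visible at ε = 0, and each division lowers j by one.
  π-algebraic-from x n zero    q Pq (k , k<n , i , nz) r | inj₁ all = contradiction (all k k<n i) nz
  π-algebraic-from x n (suc j) q Pq (k , k<n , i , nz) r | inj₁ all =
    π-algebraic-from x n j (σ ∘ q) (σ-Poly ∘ Pq) (k , k<n , i , nz)
      -- Multiplication by ε only shifts coefficients, so it is cancelled by reading off the
      -- coefficient of ε^(j+1) in place of ε^j.
      (λ i j → A.trans (A.sym (ε-⋆ (Σ₂.Σ< n (λ k → σ (q k) S₂.⋆ (x ^₂ k))) i (suc j))) (divided i (suc j)))
    where
    divided : ε S₂.⋆ Σ₂.Σ< n (λ k → σ (q k) S₂.⋆ (x ^₂ k)) R₂.≈ R₂.0#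
    divided = R₂.trans (Σ₂.Σ<-*ˡ n ε (λ k → σ (q k) S₂.⋆ (x ^₂ k)))
      (R₂.trans (Σ₂.Σ<-cong n (λ k p → R₂.trans (R₂.sym (R₂.*-assoc ε (σ (q k)) (x ^₂ k)))
        (R₂.*-congʳ {x ^₂ k} (R₂.sym (ε-σ (q k) (all k p)))))) r)

  π-algebraic : ∀ {x} → Alg₂.Algebraic x → Alg₁.Algebraic (π x)
  π-algebraic {x} (n , q , Pq , (k , k<n , nz) , r) with P₂.order (Pq k)
  ... | inj₁ z = contradiction z nz
  ... | inj₂ (i , nzᵢ , _) with P₁.order (proj₁ (Pq k) i)
  ...   | inj₁ z = contradiction z nzᵢ
  ...   | inj₂ (j , nzⱼ , _) = π-algebraic-from x n j q Pq (k , k<n , i , nzⱼ) r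

-- Adding the term s ε f^(B+1), of degree higher than all others, to each equation of f = c + s p(f) makes
-- the solution reducible in the sense of Algebraicity.Reduction; the original system is recovered at ε = 0.
module System {A : CommutativeRing 0ℓ 0ℓ} (dom : DecDomain A) (D-all : ∀ x → DecDomain.D dom x) where
  private
    module A = CommutativeRing A
    module S₁ = Series A
    module S₂ = Series S₁.ser
    module R₁ = CommutativeRing S₁.ser
    module R₂ = CommutativeRing S₂.ser
    module P₁ = Polynomials dom
    module P₂ = Polynomials P₁.polynomials
    module Alg₁ = Algebraicity P₁.polynomials
    module Alg₂ = Algebraicity P₂.polynomials
    open Specialisation dom
    open import Algebra.Properties.Semiring.Exp R₂.semiring using (_^_)

  eval : ∀ {J : Set} → (J → S₁.Ser) → Expr A.Carrier J → S₁.Ser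
  eval f (var j)   = f j
  eval f (const c) = S₁.con c
  eval f X         = S₁.X
  eval f (e ∔ e′)  = eval f e S₁.⊹ eval f e′
  eval f (e ∙ e′)  = eval f e S₁.⋆ eval f e′

  module _ (c : Ix) (init : El c → A.Carrier) (rhs : El c → Expr A.Carrier (El c)) where
    private
      J : Set
      J = El c

      eval₂ : (J → S₂.Ser) → Expr A.Carrier J → S₂.Ser
      eval₂ f (var j)   = f j
      eval₂ f (const c) = S₂.con (S₁.con c)
      eval₂ f X         = S₂.X
      eval₂ f (e ∔ e′)  = eval₂ f e S₂.⊹ eval₂ f e′
      eval₂ f (e ∙ e′)  = eval₂ f e S₂.⋆ eval₂ f e′

      B : ℕ
      -- At least the degree of every right-hand side, and at least 1 so that the unknowns
      -- themselves lie in `V B`.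
      B = suc (addUp c (degree ∘ rhs))

      deformed : (J → S₂.Ser) → J → S₂.Ser
      deformed f j = eval₂ f (rhs j) S₂.⊹ ε S₂.⋆ (f j ^ suc B)

      Φ : (J → S₂.Ser) → J → S₂.Ser
      Φ f j = S₂.con (S₁.con (init j)) S₂.⊹ S₂.shift (deformed f j)

      eval₂-mod : ∀ n {f g : J → S₂.Ser} → (∀ j → f j S₂.≈[ n ] g j) → ∀ e → eval₂ f e S₂.≈[ n ] eval₂ g e
      eval₂-mod n h (var j)   = h j
      eval₂-mod n h (const c) = λ _ _ → R₁.refl
      eval₂-mod n h X         = λ _ _ → R₁.refl
      eval₂-mod n h (e ∔ e′)  = λ i p → R₁.+-cong (eval₂-mod n h e i p) (eval₂-mod n h e′ i p)
      eval₂-mod n h (e ∙ e′)  = S₂.⋆-cong-mod (eval₂-mod n h e) (eval₂-mod n h e′)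

      ^-mod : ∀ n {f g} → f S₂.≈[ n ] g → ∀ k → (f ^ k) S₂.≈[ n ] (g ^ k)
      ^-mod n h zero    = λ _ _ → R₁.refl
      ^-mod n h (suc k) = S₂.⋆-cong-mod h (^-mod n h k)

      contractive : ∀ n {f g : J → S₂.Ser} → (∀ j → f j S₂.≈[ n ] g j) → ∀ j → Φ f j S₂.≈[ suc n ] Φ g j
      contractive n {f} {g} h j i p = R₁.+-congˡ {S₂.con (S₁.con (init j)) i} (S₂.shift-cong-mod {n} {deformed f j} {deformed g j}
        (λ i p → R₁.+-cong (eval₂-mod n h (rhs j) i p)
          (S₂.⋆-cong-mod {f = ε} (λ _ _ → R₁.refl) (^-mod n (h j) (suc B)) i p)) i p)

      open S₂.Fixpoint Φ contractive renaming (fix to F)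

      E : S₂.Ser
      E = S₂.X S₂.⋆ ε

      variables : Fin (length (elements c)) → S₂.Ser
      variables k = F (lookup (elements c) k)

      open Alg₂.Filtration variables

      position : J → Fin (length (elements c))
      position j = index (elements-complete c j)

      position-lookup : ∀ j → F j ≡ variables (position j)
      position-lookup j = ≡.cong F (lookup-index (elements-complete c j))

      V-F : ∀ {r} j → V (suc r) (F j)
      V-F {r} j = ≡.subst (V (suc r)) (≡.sym (position-lookup j)) (V-var (position j))

      V-const : ∀ {r} x → V r (S₂.con (S₁.con x))
      V-const x = V-con (P₂.Poly-con (P₁.Poly-con (D-all x)))

      V-eval : ∀ e → V (degree e) (eval₂ F e)
      V-eval (var j)   = V-F j
      V-eval (const x) = V-const x
      V-eval X         = V-con P₂.Poly-X
      V-eval (e ∔ e′)  = V-+ (V-≤ (ℕₚ.m≤m+n _ _) (V-eval e)) (V-≤ (ℕₚ.m≤n+m _ _) (V-eval e′))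
      V-eval (e ∙ e′)  = V-* (V-eval e) (V-eval e′)

      open import Relation.Binary.Reasoning.Setoid R₂.setoid

      F-equation : ∀ j → F j R₂.≈ (S₂.con (S₁.con (init j)) S₂.⊹ S₂.X S₂.⋆ eval₂ F (rhs j)) S₂.⊹ E S₂.⋆ (F j ^ suc B)
      F-equation j = begin
        F j
          ≈⟨ fix-unfold j ⟩
        C R₂.+ S₂.shift (deformed F j)
          ≈⟨ R₂.+-congˡ {C} (R₂.sym (S₂.X-⋆ (deformed F j))) ⟩
        C R₂.+ S₂.X R₂.* (P R₂.+ ε R₂.* G)
          ≈⟨ R₂.+-congˡ {C} (R₂.distribˡ S₂.X P (ε R₂.* G)) ⟩
        C R₂.+ (S₂.X R₂.* P R₂.+ S₂.X R₂.* (ε R₂.* G))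
          ≈⟨ R₂.sym (R₂.+-assoc C (S₂.X R₂.* P) (S₂.X R₂.* (ε R₂.* G))) ⟩
        C R₂.+ S₂.X R₂.* P R₂.+ S₂.X R₂.* (ε R₂.* G)
          ≈⟨ R₂.+-congˡ {C R₂.+ S₂.X R₂.* P} (R₂.sym (R₂.*-assoc S₂.X ε G)) ⟩
        C R₂.+ S₂.X R₂.* P R₂.+ E R₂.* G ∎
        where
        C P G : S₂.Ser
        C = S₂.con (S₁.con (init j))
        P = eval₂ F (rhs j)
        G = F j ^ suc B

      top-term : ∀ {x y z} → x R₂.≈ y R₂.+ z → x R₂.+ R₂.- y R₂.≈ z
      top-term {x} {y} {z} e = begin
        x R₂.+ R₂.- y               ≈⟨ R₂.+-congʳ {R₂.- y} e ⟩
        y R₂.+ z R₂.+ R₂.- y        ≈⟨ R₂.+-congʳ {R₂.- y} (R₂.+-comm y z) ⟩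
        z R₂.+ y R₂.+ R₂.- y        ≈⟨ R₂.+-assoc z y (R₂.- y) ⟩
        z R₂.+ (y R₂.+ R₂.- y)      ≈⟨ R₂.+-congˡ {z} (R₂.-‿inverseʳ y) ⟩
        z R₂.+ R₂.0#                ≈⟨ R₂.+-identityʳ z ⟩
        z                           ∎

      -- The deformed equation is solved for its top term: s ε f^(B+1) = f - c - s p(f), whose
      -- right-hand side has degree at most B.
      reducible : ∀ k → V B (E S₂.⋆ (variables k ^ suc B))
      reducible k = resp (top-term (F-equation j))
        (V-+ (V-F j) (V-neg (V-+ (V-const (init j))
          (V-scale P₂.Poly-X (V-≤ (ℕₚ.m≤n⇒m≤1+n (≤-addUp c (degree ∘ rhs) j)) (V-eval (rhs j)))))))
        where j = lookup (elements c) k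

      Poly-ε : P₂.Poly ε
      Poly-ε = P₂.Poly-con P₁.Poly-X

      E-Poly : P₂.Poly E
      E-Poly = DecDomain.D-* P₂.polynomials P₂.Poly-X Poly-ε

      E-nonzero : ¬ (E R₂.≈ R₂.0#)
      -- The coefficient of s ε in `E` is 1.
      E-nonzero z = DecDomain.1≉0 dom (A.trans (A.sym (S₂.X-⋆ ε 1 1)) (z 1 1))

      open Reduction E-Poly E-nonzero reducible

      F-algebraic : ∀ j → Alg₂.Algebraic (F j)
      F-algebraic j = algebraic {1} (V-F j)

      π-eval : ∀ e → π (eval₂ F e) S₁.≐ eval (π ∘ F) e
      π-eval (var j)   n       = A.refl
      π-eval (const x) zero    = A.refl
      π-eval (const x) (suc n) = A.refl
      π-eval X         zero          = A.refl
      π-eval X         (suc zero)    = A.refl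
      π-eval X         (suc (suc n)) = A.refl
      π-eval (e ∔ e′)  n       = A.+-cong (π-eval e n) (π-eval e′ n)
      π-eval (e ∙ e′)  n       = A.trans (π-* (eval₂ F e) (eval₂ F e′) n) (S₁.⋆-cong (π-eval e) (π-eval e′) n)

      π-equation : ∀ j → π (F j) S₁.≐ S₁.con (init j) S₁.⊹ S₁.shift (eval (π ∘ F) (rhs j))
      π-equation j zero    = fix-unfold j 0 0
      π-equation j (suc n) = A.trans (fix-unfold j (suc n) 0) (A.+-congˡ
        (A.trans (A.+-cong (π-eval (rhs j) n) (ε-⋆ (F j ^ suc B) n 0)) (A.+-identityʳ _)))

    solution : ∃ λ (f : El c → S₁.Ser) → (∀ j → Alg₁.Algebraic (f j)) ×
               (∀ j → f j S₁.≐ S₁.con (init j) S₁.⊹ S₁.shift (eval f (rhs j)))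
    solution = (λ j → π (F j)) , (λ j → π-algebraic (F-algebraic j)) , π-equation

-- Derivations, inverses and perturbations in rings

-- What is used of the ring of power series: the derivation θ, the subring of algebraic series,
-- and the ideal of series without constant term.
record Setting (S : CommutativeRing 0ℓ 0ℓ) : Set₁ where
  open CommutativeRing S hiding (zero)
  field
    θ-additive : Additive ring ring
  open Additive θ-additive public using () renaming (fun to θ; cong to θ-cong; zer to θ-0; add to θ-+)
  field
    θ-leibniz   : ∀ x y → θ (x * y) ≈ θ x * y + x * θ y
    Alg         : Carrier → Set
    Alg-resp    : ∀ {x y} → x ≈ y → Alg x → Alg y
    Alg-0       : Alg 0#
    Alg-1       : Alg 1#
    Alg-+       : ∀ {x y} → Alg x → Alg y → Alg (x + y)
    Alg-*       : ∀ {x y} → Alg x → Alg y → Alg (x * y)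
    Alg-neg     : ∀ {x} → Alg x → Alg (- x)
    Alg-inverse : ∀ {x y} → x * y ≈ 1# → Alg x → Alg y
    Small       : Carrier → Set
    unit        : ∀ {x} → Small x → ∀ y → ∃ λ v → (1# + x * y) * v ≈ 1#

module RingFacts (R : Ring 0ℓ 0ℓ) where
  open Ring R hiding (zero)
  open import Relation.Binary.Reasoning.Setoid setoid
  open import Algebra.Properties.Ring R using (-‿distribˡ-*; -‿distribʳ-*)
  open import Algebra.Properties.AbelianGroup +-abelianGroup using (inverseʳ-unique; identityʳ-unique)

  cancelʳ : ∀ x y → x + y + - y ≈ x
  cancelʳ x y = trans (+-assoc x y (- y)) (trans (+-congˡ (-‿inverseʳ y)) (+-identityʳ x))

  move : ∀ {x y z} → x ≈ y + z → x + - z ≈ y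
  move {x} {y} {z} e = trans (+-congʳ e) (cancelʳ y z)

  unmove : ∀ {x y z} → x + - z ≈ y → x ≈ y + z
  unmove {x} {y} {z} e = begin
    x                ≈⟨ +-identityʳ x ⟨
    x + 0#           ≈⟨ +-congˡ (-‿inverseˡ z) ⟨
    x + (- z + z)    ≈⟨ +-assoc x (- z) z ⟨
    x + - z + z      ≈⟨ +-congʳ e ⟩
    y + z            ∎

  *-distribˡ-sub : ∀ x y z → x * (y + - z) ≈ x * y + - (x * z)
  *-distribˡ-sub x y z = trans (distribˡ x y (- z)) (+-congˡ (sym (-‿distribʳ-* x z)))

  *-distribʳ-sub : ∀ x y z → (y + - z) * x ≈ y * x + - (z * x)
  *-distribʳ-sub x y z = trans (distribʳ x y (- z)) (+-congˡ (sym (-‿distribˡ-* z x)))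

  inverse-unique : ∀ {x y z} → x * y ≈ 1# → y * z ≈ 1# → x ≈ z
  inverse-unique {x} {y} {z} xy yz = begin
    x            ≈⟨ *-identityʳ x ⟨
    x * 1#       ≈⟨ *-congˡ yz ⟨
    x * (y * z)  ≈⟨ *-assoc x y z ⟨
    x * y * z    ≈⟨ *-congʳ xy ⟩
    1# * z       ≈⟨ *-identityˡ z ⟩
    z            ∎

  derivation-1 : (θ : Additive R R) → (∀ x y → Additive.fun θ (x * y) ≈ Additive.fun θ x * y + x * Additive.fun θ y) →
                 Additive.fun θ 1# ≈ 0#
  derivation-1 θ leibniz = identityʳ-unique (fun 1#) (fun 1#) (begin
    fun 1# + fun 1#            ≈⟨ +-cong (*-identityʳ _) (*-identityˡ _) ⟨
    fun 1# * 1# + 1# * fun 1#  ≈⟨ leibniz 1# 1# ⟨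
    fun (1# * 1#)              ≈⟨ cong (*-identityˡ 1#) ⟩
    fun 1#                     ∎)
    where open Additive θ

  -- Differentiating y z = 1 without commutativity gives y z′ = -y′ z; multiply by y on the right.
  inverse-derivative : ∀ {y z y′ z′} → z * y ≈ 1# → y′ * z + y * z′ ≈ 0# → y * (z′ * y) ≈ - y′
  inverse-derivative {y} {z} {y′} {z′} zy e = begin
    y * (z′ * y)      ≈⟨ *-assoc y z′ y ⟨
    y * z′ * y        ≈⟨ *-congʳ (inverseʳ-unique (y′ * z) (y * z′) e) ⟩
    - (y′ * z) * y    ≈⟨ -‿distribˡ-* (y′ * z) y ⟨
    - (y′ * z * y)    ≈⟨ -‿cong (trans (*-assoc y′ z y) (trans (*-congˡ zy) (*-identityʳ y′))) ⟩
    - y′              ∎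

  -- Sherman–Morrison: perturb z by r, where r′ is a multiple of r by the appropriate scalar.
  perturbʳ : ∀ {z y r r′} → z * y ≈ 1# → r ≈ r′ + r * (y * r′) → (z + r) * (y + - (y * (r′ * y))) ≈ 1#
  perturbʳ {z} {y} {r} {r′} zy e = trans (*-distribˡ-sub (z + r) y (y * (r′ * y))) (move (begin
    (z + r) * y                                       ≈⟨ distribʳ y z r ⟩
    z * y + r * y                                     ≈⟨ +-cong zy (*-congʳ e) ⟩
    1# + (r′ + r * (y * r′)) * y                      ≈⟨ +-congˡ (distribʳ y r′ (r * (y * r′))) ⟩
    1# + (r′ * y + r * (y * r′) * y)                  ≈⟨ +-congˡ (+-cong zy-r (trans (*-assoc r _ y) (*-congˡ (*-assoc y r′ y)))) ⟩
    1# + (z * (y * (r′ * y)) + r * (y * (r′ * y)))    ≈⟨ +-congˡ (distribʳ (y * (r′ * y)) z r) ⟨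
    1# + (z + r) * (y * (r′ * y))                     ∎))
    where
    zy-r : r′ * y ≈ z * (y * (r′ * y))
    zy-r = sym (trans (sym (*-assoc z y (r′ * y))) (trans (*-congʳ zy) (*-identityˡ _)))

  perturbˡ : ∀ {z y r r′} → y * z ≈ 1# → r ≈ r′ + r′ * (y * r) → (y + - (y * (r′ * y))) * (z + r) ≈ 1#
  perturbˡ {z} {y} {r} {r′} yz e = trans (*-distribʳ-sub (z + r) y (y * (r′ * y))) (move (begin
    y * (z + r)                                       ≈⟨ distribˡ y z r ⟩
    y * z + y * r                                     ≈⟨ +-cong yz (*-congˡ e) ⟩
    1# + y * (r′ + r′ * (y * r))                      ≈⟨ +-congˡ (distribˡ y r′ (r′ * (y * r))) ⟩
    1# + (y * r′ + y * (r′ * (y * r)))                ≈⟨ +-congˡ (+-cong r′-yz (trans (*-congˡ (sym (*-assoc r′ y r))) (sym (*-assoc y _ r)))) ⟩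
    1# + (y * (r′ * y) * z + y * (r′ * y) * r)        ≈⟨ +-congˡ (distribˡ (y * (r′ * y)) z r) ⟨
    1# + y * (r′ * y) * (z + r)                       ∎))
    where
    r′-yz : y * r′ ≈ y * (r′ * y) * z
    r′-yz = sym (trans (*-assoc y _ z) (*-congˡ (trans (*-assoc r′ y z) (trans (*-congˡ yz) (*-identityʳ _)))))

-- Logarithmic derivatives of determinants

module LogDeterminant {S : CommutativeRing 0ℓ 0ℓ} (setting : Setting S) where
  open CommutativeRing S hiding (zero)
  open Setting setting
  open SumLaws ring
  open Matrices ring using (Matrix; _≋_; _⊡_; entry) renaming (ring to matrixRing)
  open RingFacts ring using (cancelʳ; derivation-1)
  open import Algebra.Properties.Ring ring using (-‿distribʳ-*)
  open import Algebra.Properties.AbelianGroup +-abelianGroup using (inverseʳ-unique; ⁻¹-∙-comm; ⁻¹-involutive)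
  open import Algebra.Solver.Ring.NaturalCoefficients.Default commutativeSemiring using (solve; _:=_; _:+_; _:*_)
  open import Relation.Binary.Reasoning.Setoid setoid

  θ-1 : θ 1# ≈ 0#
  θ-1 = derivation-1 θ-additive θ-leibniz

  -- The logarithmic derivatives of algebraic units. The inverse v is carried along because the ring
  -- is not a field; sums and negatives of g correspond to products and inverses of u.
  LogAlg : Carrier → Set
  LogAlg g = ∃ λ u → ∃ λ v → u * v ≈ 1# × Alg u × θ u ≈ g * u

  LogAlg-resp : ∀ {g h} → g ≈ h → LogAlg g → LogAlg h
  LogAlg-resp e (u , v , uv , Au , d) = u , v , uv , Au , trans d (*-congʳ e)

  LogAlg-0 : LogAlg 0#
  LogAlg-0 = 1# , 1# , *-identityˡ 1# , Alg-1 , trans θ-1 (sym (zeroˡ 1#))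

  LogAlg-+ : ∀ {g h} → LogAlg g → LogAlg h → LogAlg (g + h)
  LogAlg-+ {g} {h} (u , v , uv , Au , d) (u′ , v′ , uv′ , Au′ , d′) = u * u′ , v * v′ ,
    trans (solve 4 (λ a b c d → (a :* b) :* (c :* d) := (a :* c) :* (b :* d)) refl u u′ v v′)
      (trans (*-cong uv uv′) (*-identityˡ 1#)) ,
    Alg-* Au Au′ ,
    (begin
      θ (u * u′)                   ≈⟨ θ-leibniz u u′ ⟩
      θ u * u′ + u * θ u′          ≈⟨ +-cong (*-congʳ d) (*-congˡ d′) ⟩
      g * u * u′ + u * (h * u′)    ≈⟨ solve 4 (λ g h u w → g :* u :* w :+ u :* (h :* w) := (g :+ h) :* (u :* w)) refl g h u u′ ⟩
      (g + h) * (u * u′)           ∎)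

  LogAlg-neg : ∀ {g} → LogAlg g → LogAlg (- g)
  LogAlg-neg {g} (u , v , uv , Au , d) = v , u , trans (*-comm v u) uv , Alg-inverse uv Au , θv
    where
    uθv : u * θ v ≈ - g
    uθv = begin
      u * θ v      ≈⟨ inverseʳ-unique (θ u * v) (u * θ v) (trans (sym (θ-leibniz u v)) (trans (θ-cong uv) θ-1)) ⟩
      - (θ u * v)  ≈⟨ -‿cong (trans (*-congʳ d) (trans (*-assoc g u v) (trans (*-congˡ uv) (*-identityʳ g)))) ⟩
      - g          ∎
    θv : θ v ≈ - g * v
    θv = begin
      θ v              ≈⟨ *-identityˡ _ ⟨
      1# * θ v         ≈⟨ *-congʳ (trans (*-comm v u) uv) ⟨
      v * u * θ v      ≈⟨ *-assoc v u (θ v) ⟩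
      v * (u * θ v)    ≈⟨ *-congˡ uθv ⟩
      v * - g          ≈⟨ *-comm v (- g) ⟩
      - g * v          ∎

  LogAlg-sum : ∀ n {g : Fin n → Carrier} → (∀ i → LogAlg (g i)) → LogAlg (sum (fin n) g)
  LogAlg-sum zero    a = LogAlg-0
  LogAlg-sum (suc n) a = LogAlg-+ (a zero) (LogAlg-sum n (a ∘ suc))

  Alg-sum : ∀ c {f : El c → Carrier} → (∀ x → Alg (f x)) → Alg (sum c f)
  Alg-sum (fin zero)    a = Alg-0
  Alg-sum (fin (suc n)) a = Alg-+ (a zero) (Alg-sum (fin n) (a ∘ suc))
  Alg-sum bool          a = Alg-+ (a _) (a _)
  Alg-sum (c ⊕ d)       a = Alg-+ (Alg-sum c (a ∘ inj₁)) (Alg-sum d (a ∘ inj₂))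
  Alg-sum (c ⊗ d)       a = Alg-sum c (λ x → Alg-sum d (λ y → a (x , y)))

  identity-additive : Additive ring ring
  identity-additive = record { fun = λ x → x ; cong = λ e → e ; zer = refl ; add = λ _ _ → refl }

  open Trace identity-additive *-comm public

  Θ : ∀ {I J} → Matrix I J → Matrix I J
  Θ Z i j = θ (Z i j)

  Θ-leibniz : ∀ {I J K} (Y : Matrix I J) (Z : Matrix J K) i k → Θ (Y ⊡ Z) i k ≈ (Θ Y ⊡ Z) i k + (Y ⊡ Θ Z) i k
  Θ-leibniz {J = J} Y Z i k = trans (sum-hom θ-additive J _) (trans (sum-cong J (λ j → θ-leibniz _ _)) (sum-+ J _ _))

  Θ-additive : ∀ I → Additive (matrixRing I) (matrixRing I)
  Θ-additive I = record
    { fun = Θ ; cong = λ e i j → θ-cong (e i j) ; zer = λ i j → θ-0 ; add = λ A B i j → θ-+ _ _ }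

  Θ-1 : ∀ I (i j : El I) → θ (δ I i j) ≈ 0#
  Θ-1 I i j with eqb I i j
  ... | true  = θ-1
  ... | false = θ-0

  Alg-δ : ∀ {I} i j → Alg (δ I i j)
  Alg-δ {I} i j with eqb I i j
  ... | true  = Alg-1
  ... | false = Alg-0

  -- By Jacobi's formula tr (Z⁻¹ ΘZ) is θ log det Z; it stands in for the determinant itself.
  record LogDet (I : Ix) (Z : Matrix I I) : Set where
    field
      inv       : Matrix I I
      inverseʳ  : Z ⊡ inv ≋ δ I
      inverseˡ  : inv ⊡ Z ≋ δ I
      algebraic : ∀ i j → Alg (inv i j)
      logAlg    : LogAlg (tr I (inv ⊡ Θ Z))

  module _ (I : Ix) where
    private
      module M = Ring (matrixRing I)
      module MF = RingFacts (matrixRing I)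
      module Tr = Additive (tr-additive I)
      module ΘA = Additive (Θ-additive I)

    logDet-1 : LogDet I (δ I)
    logDet-1 = record
      { inv = δ I
      ; inverseʳ = M.*-identityˡ _
      ; inverseˡ = M.*-identityˡ _
      ; algebraic = λ i j → Alg-δ i j
      ; logAlg = LogAlg-resp (sym (trans (Tr.cong (M.trans (M.*-identityˡ _) (Θ-1 I))) Tr.zer)) LogAlg-0
      }

    logDet-resp : ∀ {Z Z′} → Z ≋ Z′ → LogDet I Z → LogDet I Z′
    logDet-resp e d = record
      { inv = inv
      ; inverseʳ = M.trans (M.*-congʳ (M.sym e)) inverseʳ
      ; inverseˡ = M.trans (M.*-congˡ (M.sym e)) inverseˡ
      ; algebraic = algebraic
      ; logAlg = LogAlg-resp (Tr.cong (M.*-congˡ (ΘA.cong e))) logAlg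
      }
      where open LogDet d

    module _ (i j : El I) where

      single : Carrier → Matrix I I
      single z a b = δ I a i * (z * δ I j b)

      single-⊡ : ∀ z (Y : Matrix I I) a b → (single z ⊡ Y) a b ≈ δ I a i * (z * Y j b)
      single-⊡ z Y a b = begin
        sum I (λ x → δ I a i * (z * δ I j x) * Y x b)
          ≈⟨ sum-cong I (λ x → trans (*-assoc _ _ _) (*-congˡ (*-assoc _ _ _))) ⟩
        sum I (λ x → δ I a i * (z * (δ I j x * Y x b)))
          ≈⟨ sum-*ˡ I _ _ ⟨
        δ I a i * sum I (λ x → z * (δ I j x * Y x b))
          ≈⟨ *-congˡ (sym (sum-*ˡ I _ _)) ⟩
        δ I a i * (z * sum I (λ x → δ I j x * Y x b))
          ≈⟨ *-congˡ (*-congˡ (sum-δˡ I j (λ x → Y x b))) ⟩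
        δ I a i * (z * Y j b) ∎

      ⊡-single : ∀ z (Y : Matrix I I) a b → (Y ⊡ single z) a b ≈ Y a i * (z * δ I j b)
      ⊡-single z Y a b = begin
        sum I (λ x → Y a x * (δ I x i * (z * δ I j b)))  ≈⟨ sum-cong I (λ x → sym (*-assoc _ _ _)) ⟩
        sum I (λ x → Y a x * δ I x i * (z * δ I j b))    ≈⟨ sum-*ʳ I _ _ ⟨
        sum I (λ x → Y a x * δ I x i) * (z * δ I j b)    ≈⟨ *-congʳ (sum-δʳ I i (Y a)) ⟩
        Y a i * (z * δ I j b)                            ∎

      single-⊡-single : ∀ z w (Y : Matrix I I) → single z ⊡ (Y ⊡ single w) ≋ single (z * (Y j i * w))
      single-⊡-single z w Y a b = trans (single-⊡ z (Y ⊡ single w) a b) (*-congˡ (trans (*-congˡ (⊡-single w Y j b))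
        (solve 4 (λ z y w d → z :* (y :* (w :* d)) := z :* (y :* w) :* d) refl z (Y j i) w (δ I j b))))

      tr-single : ∀ z (Y : Matrix I I) → tr I (single z ⊡ Y) ≈ z * Y j i
      tr-single z Y = begin
        sum I (λ a → (single z ⊡ Y) a a)      ≈⟨ sum-cong I (λ a → single-⊡ z Y a a) ⟩
        sum I (λ a → δ I a i * (z * Y j a))   ≈⟨ sum-cong I (λ a → *-comm _ _) ⟩
        sum I (λ a → z * Y j a * δ I a i)     ≈⟨ sum-δʳ I i (λ a → z * Y j a) ⟩
        z * Y j i                             ∎

      single-cong : ∀ {z w} → z ≈ w → single z ≋ single w
      single-cong e a b = *-congˡ (*-congʳ e)

      single-+ : ∀ z w a b → single (z + w) a b ≈ single z a b + single w a b
      single-+ z w a b = trans (*-congˡ (distribʳ _ z w)) (distribˡ _ _ _)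

      Θ-single : ∀ z → Θ (single z) ≋ single (θ z)
      Θ-single z a b = begin
        θ (δ I a i * (z * δ I j b))
          ≈⟨ θ-leibniz _ _ ⟩
        θ (δ I a i) * (z * δ I j b) + δ I a i * θ (z * δ I j b)
          ≈⟨ +-cong (trans (*-congʳ (Θ-1 I a i)) (zeroˡ _)) (*-congˡ (θ-leibniz _ _)) ⟩
        0# + δ I a i * (θ z * δ I j b + z * θ (δ I j b))
          ≈⟨ trans (+-identityˡ _) (*-congˡ (+-congˡ (trans (*-congˡ (Θ-1 I j b)) (zeroʳ _)))) ⟩
        δ I a i * (θ z * δ I j b + 0#)
          ≈⟨ *-congˡ (+-identityʳ _) ⟩
        δ I a i * (θ z * δ I j b) ∎

      -- det (Z + z Eᵢⱼ) = det Z · (1 + z (Z⁻¹)ⱼᵢ)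
      logDet-single : ∀ {Z z} → Small z → Alg z → LogDet I Z → LogDet I (λ a b → Z a b + single z a b)
      logDet-single {Z} {z} small Az d = record
        { inv = Y′
        ; inverseʳ = MF.perturbʳ inverseʳ rʳ
        ; inverseˡ = MF.perturbˡ inverseˡ rˡ
        ; algebraic = λ a b → Alg-+ (algebraic a b) (Alg-neg (Alg-sum I (λ x → Alg-* (algebraic a x)
            (Alg-sum I (λ w → Alg-* (Alg-* (Alg-δ x i) (Alg-* (Alg-* Av Az) (Alg-δ j w))) (algebraic w b))))))
        ; logAlg = LogAlg-resp (sym trace) (LogAlg-+ logAlg (η , v , ηv , Aη ,
            (begin
              θ η              ≈⟨ *-identityʳ _ ⟨
              θ η * 1#         ≈⟨ *-congˡ (trans (*-comm v η) ηv) ⟨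
              θ η * (v * η)    ≈⟨ *-assoc _ _ _ ⟨
              θ η * v * η      ∎)))
        }
        where
        open LogDet d renaming (inv to Y)
        y η v : Carrier
        y = Y j i
        -- The factor by which the determinant changes. The Sherman-Morrison scalar is `v * z`, that
        -- is z / (1 + z y), and `z-split` is its defining equation.
        η = 1# + z * y
        v = proj₁ (unit small y)
        ηv : η * v ≈ 1#
        ηv = proj₂ (unit small y)
        Aη : Alg η
        Aη = Alg-+ Alg-1 (Alg-* Az (algebraic j i))
        Av : Alg v
        Av = Alg-inverse ηv Aη
        Y′ : Matrix I I
        Y′ = Y M.+ M.- (Y ⊡ (single (v * z) ⊡ Y))
        z-split : z ≈ v * z + z * (y * (v * z))
        z-split = begin
          z                            ≈⟨ *-identityʳ z ⟨
          z * 1#                       ≈⟨ *-congˡ ηv ⟨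
          z * ((1# + z * y) * v)       ≈⟨ *-congˡ (trans (distribʳ v 1# (z * y)) (+-congʳ (*-identityˡ v))) ⟩
          z * (v + z * y * v)          ≈⟨ solve 3 (λ z y v → z :* (v :+ z :* y :* v) := v :* z :+ z :* (y :* (v :* z))) refl z y v ⟩
          v * z + z * (y * (v * z))    ∎
        rʳ : single z ≋ single (v * z) M.+ single z ⊡ (Y ⊡ single (v * z))
        rʳ a b = trans (single-cong z-split a b) (trans (single-+ (v * z) _ a b)
          (+-congˡ (sym (single-⊡-single z (v * z) Y a b))))
        rˡ : single z ≋ single (v * z) M.+ single (v * z) ⊡ (Y ⊡ single z)
        rˡ a b = trans (single-cong z-split a b) (trans (single-+ (v * z) _ a b)
          (+-congˡ (trans (single-cong (solve 3 (λ z y v → z :* (y :* (v :* z)) := v :* z :* (y :* z)) refl z y v) a b)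
            (sym (single-⊡-single (v * z) z Y a b)))))
        θY : Y ⊡ (Θ Z ⊡ Y) ≋ M.- Θ Y
        θY = MF.inverse-derivative inverseʳ
          (λ a b → trans (sym (Θ-leibniz Y Z a b)) (trans (θ-cong (inverseˡ a b)) (Θ-1 I a b)))
        Q : Matrix I I
        Q = Y ⊡ (single (v * z) ⊡ Y)
        term₁ : tr I (Y ⊡ Θ (single z)) ≈ θ z * y
        term₁ = trans (tr-cyclic Y (Θ (single z))) (trans (Tr.cong (M.*-congʳ {Y} (Θ-single z))) (tr-single (θ z) Y))
        term₂ : tr I (Q ⊡ Θ Z) ≈ - (v * z * θ y)
        term₂ = begin
          tr I (Q ⊡ Θ Z)                            ≈⟨ Tr.cong (M.*-assoc Y (single (v * z) ⊡ Y) (Θ Z)) ⟩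
          tr I (Y ⊡ (single (v * z) ⊡ Y ⊡ Θ Z))     ≈⟨ tr-cyclic Y _ ⟩
          tr I (single (v * z) ⊡ Y ⊡ Θ Z ⊡ Y)       ≈⟨ Tr.cong (M.trans (M.*-assoc (single (v * z) ⊡ Y) (Θ Z) Y)
                                                                  (M.*-assoc (single (v * z)) Y (Θ Z ⊡ Y))) ⟩
          tr I (single (v * z) ⊡ (Y ⊡ (Θ Z ⊡ Y)))   ≈⟨ Tr.cong (M.*-congˡ {single (v * z)} θY) ⟩
          tr I (single (v * z) ⊡ (M.- Θ Y))         ≈⟨ tr-single (v * z) (M.- Θ Y) ⟩
          v * z * - θ y                             ≈⟨ -‿distribʳ-* _ _ ⟨
          - (v * z * θ y)                           ∎
        term₃ : tr I (Q ⊡ Θ (single z)) ≈ θ z * (y * (v * z * y))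
        term₃ = begin
          tr I (Q ⊡ Θ (single z))  ≈⟨ tr-cyclic Q (Θ (single z)) ⟩
          tr I (Θ (single z) ⊡ Q)  ≈⟨ Tr.cong (M.*-congʳ {Q} (Θ-single z)) ⟩
          tr I (single (θ z) ⊡ Q)  ≈⟨ tr-single (θ z) Q ⟩
          θ z * Q j i              ≈⟨ *-congˡ (trans (sym (M.*-assoc Y (single (v * z)) Y j i)) (sum-cong I (λ x → *-congʳ (⊡-single (v * z) Y j x)))) ⟩
          θ z * sum I (λ x → y * (v * z * δ I j x) * Y x i)
            ≈⟨ *-congˡ (sum-cong I (λ x → solve 4 (λ y w d t → y :* (w :* d) :* t := y :* w :* (d :* t)) refl y (v * z) (δ I j x) (Y x i))) ⟩
          θ z * sum I (λ x → y * (v * z) * (δ I j x * Y x i))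
            ≈⟨ *-congˡ (trans (sym (sum-*ˡ I _ _)) (*-congˡ (sum-δˡ I j (λ x → Y x i)))) ⟩
          θ z * (y * (v * z) * y)  ≈⟨ *-congˡ (*-assoc y (v * z) y) ⟩
          θ z * (y * (v * z * y))  ∎
        θη : θ η ≈ θ z * y + z * θ y
        θη = trans (θ-+ 1# (z * y)) (trans (+-congʳ θ-1) (trans (+-identityˡ _) (θ-leibniz z y)))
        trace : tr I (Y′ ⊡ Θ (Z M.+ single z)) ≈ tr I (Y ⊡ Θ Z) + θ η * v
        trace = begin
          tr I (Y′ ⊡ Θ (Z M.+ single z))
            ≈⟨ Tr.cong (M.*-congˡ {Y′} (ΘA.add Z (single z))) ⟩
          tr I (Y′ ⊡ (Θ Z M.+ Θ (single z)))
            ≈⟨ Tr.cong (MF.*-distribʳ-sub (Θ Z M.+ Θ (single z)) Y Q) ⟩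
          tr I (Y ⊡ (Θ Z M.+ Θ (single z)) M.+ M.- (Q ⊡ (Θ Z M.+ Θ (single z))))
            ≈⟨ Tr.cong (M.+-cong (M.distribˡ Y (Θ Z) (Θ (single z))) (M.-‿cong (M.distribˡ Q (Θ Z) (Θ (single z))))) ⟩
          tr I (Y ⊡ Θ Z M.+ Y ⊡ Θ (single z) M.+ M.- (Q ⊡ Θ Z M.+ Q ⊡ Θ (single z)))
            ≈⟨ trans (Tr.add (Y ⊡ Θ Z M.+ Y ⊡ Θ (single z)) (M.- (Q ⊡ Θ Z M.+ Q ⊡ Θ (single z))))
                   (+-cong (Tr.add (Y ⊡ Θ Z) (Y ⊡ Θ (single z)))
                           (trans (sym (sum-neg I _)) (-‿cong (Tr.add (Q ⊡ Θ Z) (Q ⊡ Θ (single z)))))) ⟩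
          tr I (Y ⊡ Θ Z) + tr I (Y ⊡ Θ (single z)) + - (tr I (Q ⊡ Θ Z) + tr I (Q ⊡ Θ (single z)))
            ≈⟨ +-cong (+-congˡ term₁) (-‿cong (+-cong term₂ term₃)) ⟩
          tr I (Y ⊡ Θ Z) + θ z * y + - (- (v * z * θ y) + θ z * (y * (v * z * y)))
            ≈⟨ +-congˡ (trans (sym (⁻¹-∙-comm _ _)) (+-congʳ (⁻¹-involutive _))) ⟩
          tr I (Y ⊡ Θ Z) + θ z * y + (v * z * θ y + - (θ z * (y * (v * z * y))))
            ≈⟨ +-assoc _ _ _ ⟩
          tr I (Y ⊡ Θ Z) + (θ z * y + (v * z * θ y + - (θ z * (y * (v * z * y)))))
            ≈⟨ +-congˡ (trans (sym (+-assoc _ _ _)) (+-congʳ scalar)) ⟩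
          tr I (Y ⊡ Θ Z) + (θ η * v + θ z * (y * (v * z * y)) + - (θ z * (y * (v * z * y))))
            ≈⟨ +-congˡ (cancelʳ _ _) ⟩
          tr I (Y ⊡ Θ Z) + θ η * v ∎
          where
          -- Expanding θz y by 1 = (1 + z y) v produces the term that cancels `term₃`; what is left
          -- is θη / η.
          scalar : θ z * y + v * z * θ y ≈ θ η * v + θ z * (y * (v * z * y))
          scalar = begin
            θ z * y + v * z * θ y
              ≈⟨ +-congʳ (*-congʳ (trans (sym (*-identityʳ _)) (*-congˡ (sym ηv)))) ⟩
            θ z * ((1# + z * y) * v) * y + v * z * θ y
              ≈⟨ +-congʳ (*-congʳ (*-congˡ (trans (distribʳ v 1# (z * y)) (+-congʳ (*-identityˡ v))))) ⟩
            θ z * (v + z * y * v) * y + v * z * θ y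
              ≈⟨ solve 5 (λ t s z y v → t :* (v :+ z :* y :* v) :* y :+ v :* z :* s :=
                                        (t :* y :+ z :* s) :* v :+ t :* (y :* (v :* z :* y))) refl (θ z) (θ y) z y v ⟩
            (θ z * y + z * θ y) * v + θ z * (y * (v * z * y))
              ≈⟨ +-congʳ (*-congʳ θη) ⟨
            θ η * v + θ z * (y * (v * z * y)) ∎

    private module ΣM = Sums (matrixRing I)

    logDet-sum : ∀ c {P : El c → Matrix I I} → (∀ x {Z} → LogDet I Z → LogDet I (Z M.+ P x)) →
                 ∀ {Z} → LogDet I Z → LogDet I (Z M.+ ΣM.sum c P)
    logDet-sum (fin zero)    f d = logDet-resp (M.sym (M.+-identityʳ _)) d
    logDet-sum (fin (suc n)) f d = logDet-resp (M.+-assoc _ _ _) (logDet-sum (fin n) (f ∘ suc) (f zero d))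
    logDet-sum bool          f d = logDet-resp (M.+-assoc _ _ _) (f false (f true d))
    logDet-sum (a ⊕ b)       f d = logDet-resp (M.+-assoc _ _ _) (logDet-sum b (f ∘ inj₂) (logDet-sum a (f ∘ inj₁) d))
    logDet-sum (a ⊗ b)       f d = logDet-sum a (λ x → logDet-sum b (λ y → f (x , y))) d

    -- Starting from the identity, the entries of Z - 1 are added one at a time. Smallness of an
    -- entry keeps the factor 1 + z y invertible, whatever inverse has been reached so far.
    logDet : ∀ Z → (∀ i j → Alg (Z i j)) → (∀ i j → Small (Z i j + - δ I i j)) → LogDet I Z
    logDet Z AZ small = logDet-resp total (logDet-sum (I ⊗ I)
        {λ { (i , j) → single i j (Z i j + - δ I i j) }}
        (λ { (i , j) → logDet-single i j (small i j) (Alg-+ (AZ i j) (Alg-neg (Alg-δ i j))) }) logDet-1)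
      where
      W : Matrix I I
      W i j = Z i j + - δ I i j
      total : δ I M.+ ΣM.sum (I ⊗ I) (λ { (i , j) → single i j (W i j) }) ≋ Z
      total a b = begin
        δ I a b + ΣM.sum (I ⊗ I) (λ { (i , j) → single i j (W i j) }) a b
          ≈⟨ +-congˡ (sum-hom (entry a b) (I ⊗ I) _) ⟩
        δ I a b + sum I (λ i → sum I (λ j → δ I a i * (W i j * δ I j b)))
          ≈⟨ +-congˡ (sum-cong I (λ i → trans (sym (sum-*ˡ I _ _)) (*-congˡ (sum-δʳ I b (W i))))) ⟩
        δ I a b + sum I (λ i → δ I a i * W i b)
          ≈⟨ +-congˡ (sum-δˡ I a (λ i → W i b)) ⟩
        δ I a b + (Z a b + - δ I a b)
          ≈⟨ trans (sym (+-assoc _ _ _)) (trans (+-congʳ (+-comm _ _)) (cancelʳ _ _)) ⟩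
        Z a b ∎

-- The Bethe formula in a ring with trace and derivation

module Bethe {R B : Ring 0ℓ 0ℓ} (tr-additive : Additive R B)
  (tr-cyclic : ∀ x y → Ring._≈_ B (Additive.fun tr-additive (Ring._*_ R x y)) (Additive.fun tr-additive (Ring._*_ R y x)))
  (θ-additive : Additive R R)
  (θ-leibniz : ∀ x y → Ring._≈_ R (Additive.fun θ-additive (Ring._*_ R x y))
    (Ring._+_ R (Ring._*_ R (Additive.fun θ-additive x) y) (Ring._*_ R x (Additive.fun θ-additive y)))) where
  open Ring R hiding (zero)
  open RingFacts R
  open Additive tr-additive using () renaming (fun to tr; cong to tr-cong; zer to tr-0; add to tr-+)
  open Additive θ-additive using () renaming (fun to θ; cong to θ-cong; zer to θ-0; add to θ-+)
  private
    module B = Ring B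
    module BF = RingFacts B
    module ΣR = SumLaws R
    module ΣB = SumLaws B
    module ≈B where
      open import Relation.Binary.Reasoning.Setoid B.setoid public
  open import Relation.Binary.Reasoning.Setoid setoid

  θ-1 : θ 1# ≈ 0#
  θ-1 = derivation-1 θ-additive θ-leibniz

  -- The resolvent identity G - G′ = G′ (K′ - K) G, arranged for substitution.
  resolventˡ : ∀ {G K G′ K′ W} → K * G ≈ 1# → G′ * K′ ≈ 1# → K′ ≈ K + W → G ≈ G′ + G′ * (W * G)
  resolventˡ {G} {K} {G′} {K′} {W} KG GK′ e = begin
    G                              ≈⟨ *-identityˡ G ⟨
    1# * G                         ≈⟨ *-congʳ GK′ ⟨
    G′ * K′ * G                    ≈⟨ *-assoc G′ K′ G ⟩
    G′ * (K′ * G)                  ≈⟨ *-congˡ (trans (*-congʳ e) (distribʳ G K W)) ⟩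
    G′ * (K * G + W * G)           ≈⟨ distribˡ G′ (K * G) (W * G) ⟩
    G′ * (K * G) + G′ * (W * G)    ≈⟨ +-congʳ (trans (*-congˡ KG) (*-identityʳ G′)) ⟩
    G′ + G′ * (W * G)              ∎

  resolventʳ : ∀ {G K G′ K′ W} → G * K ≈ 1# → K′ * G′ ≈ 1# → K′ ≈ K + W → G ≈ G′ + G * (W * G′)
  resolventʳ {G} {K} {G′} {K′} {W} GK KG′ e = begin
    G                              ≈⟨ *-identityʳ G ⟨
    G * 1#                         ≈⟨ *-congˡ KG′ ⟨
    G * (K′ * G′)                  ≈⟨ *-congˡ (trans (*-congʳ e) (distribʳ G′ K W)) ⟩
    G * (K * G′ + W * G′)          ≈⟨ distribˡ G (K * G′) (W * G′) ⟩
    G * (K * G′) + G * (W * G′)    ≈⟨ +-congʳ (trans (sym (*-assoc G K G′)) (trans (*-congʳ GK) (*-identityˡ G′))) ⟩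
    G′ + G * (W * G′)              ∎

  -- A generator x with its inverse y: `a` and `ā` are t N_x and t N_y. The subtree of words
  -- beginning with x lacks the excursions through y, so `K₊` is K with `W₋` added back; `K₋` is its
  -- mirror image.
  record Edge (G K : Carrier) : Set where
    field
      a ā G₊ G₋ K₊ K₋ : Carrier
      θa  : θ a ≈ a
      θā  : θ ā ≈ ā
      K₊≈ : K₊ ≈ K + ā * (G₋ * a)
      K₋≈ : K₋ ≈ K + a * (G₊ * ā)
      KG₊ : K₊ * G₊ ≈ 1#
      GK₊ : G₊ * K₊ ≈ 1#
      GK₋ : G₋ * K₋ ≈ 1#

    W₊ W₋ : Carrier
    W₊ = a * (G₊ * ā)
    W₋ = ā * (G₋ * a)

  module _ {G K : Carrier} (KG : K * G ≈ 1#) (GK : G * K ≈ 1#) where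

    module _ (edge : Edge G K) where
      open Edge edge

      Q : Carrier
      Q = ā * (G * a)

      Q-step : Q ≈ W₋ + W₋ * (G₊ * Q)
      Q-step = begin
        ā * (G * a)                                ≈⟨ *-congˡ (*-congʳ (resolventˡ KG GK₋ K₋≈)) ⟩
        ā * ((G₋ + G₋ * (W₊ * G)) * a)             ≈⟨ *-congˡ (distribʳ a _ _) ⟩
        ā * (G₋ * a + G₋ * (W₊ * G) * a)           ≈⟨ distribˡ ā _ _ ⟩
        W₋ + ā * (G₋ * (W₊ * G) * a)               ≈⟨ +-congˡ rearrange ⟩
        W₋ + W₋ * (G₊ * Q)                         ∎
        where
        rearrange : ā * (G₋ * (a * (G₊ * ā) * G) * a) ≈ ā * (G₋ * a) * (G₊ * (ā * (G * a)))
        rearrange = begin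
          ā * (G₋ * (a * (G₊ * ā) * G) * a)        ≈⟨ *-congˡ (*-assoc _ _ _) ⟩
          ā * (G₋ * (a * (G₊ * ā) * G * a))        ≈⟨ *-congˡ (*-congˡ (trans (*-assoc _ _ _) (trans (*-assoc _ _ _) (*-congˡ (*-assoc _ _ _))))) ⟩
          ā * (G₋ * (a * (G₊ * (ā * (G * a)))))    ≈⟨ *-congˡ (*-assoc _ _ _) ⟨
          ā * (G₋ * a * (G₊ * (ā * (G * a))))      ≈⟨ *-assoc _ _ _ ⟨
          ā * (G₋ * a) * (G₊ * (ā * (G * a)))      ∎

      G≈ : G ≈ G₊ + G * (W₋ * G₊)
      G≈ = resolventʳ GK KG₊ K₊≈

      Q≈ : Q ≈ W₋ + W₋ * (G * W₋)
      -- W₋ G Q is expanded twice, by `G≈` and by `Q-step`. Both expansions contain W₋ G W₋ G₊ Q,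
      -- and comparing the rest gives W₋ G₊ Q = W₋ G W₋.
      Q≈ = trans Q-step (+-congˡ (trans (sym (move (begin
        W₋ * (G * Q)                                        ≈⟨ *-congˡ (*-congʳ G≈) ⟩
        W₋ * ((G₊ + G * (W₋ * G₊)) * Q)                     ≈⟨ trans (*-congˡ (distribʳ Q _ _)) (distribˡ W₋ _ _) ⟩
        W₋ * (G₊ * Q) + W₋ * (G * (W₋ * G₊) * Q)            ≈⟨ +-congˡ (*-congˡ (trans (*-assoc _ _ _) (*-congˡ (*-assoc _ _ _)))) ⟩
        W₋ * (G₊ * Q) + W₋ * (G * (W₋ * (G₊ * Q)))          ∎))) (move (begin
        W₋ * (G * Q)                                        ≈⟨ *-congˡ (*-congˡ Q-step) ⟩
        W₋ * (G * (W₋ + W₋ * (G₊ * Q)))                     ≈⟨ trans (*-congˡ (distribˡ G _ _)) (distribˡ W₋ _ _) ⟩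
        W₋ * (G * W₋) + W₋ * (G * (W₋ * (G₊ * Q)))          ∎))))

      QG₊ : Q * G₊ ≈ W₋ * G
      QG₊ = begin
        Q * G₊                               ≈⟨ *-congʳ Q≈ ⟩
        (W₋ + W₋ * (G * W₋)) * G₊            ≈⟨ distribʳ G₊ _ _ ⟩
        W₋ * G₊ + W₋ * (G * W₋) * G₊         ≈⟨ +-congˡ (trans (*-assoc _ _ _) (*-congˡ (*-assoc _ _ _))) ⟩
        W₋ * G₊ + W₋ * (G * (W₋ * G₊))       ≈⟨ distribˡ W₋ _ _ ⟨
        W₋ * (G₊ + G * (W₋ * G₊))            ≈⟨ *-congˡ G≈ ⟨
        W₋ * G                               ∎

      -- A cyclic rotation makes the left side tr (Q G₊), and `QG₊` exchanges Q G₊ for W₋ G. The two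
      -- directions of the edge thus contribute equally.
      tr-GW : tr (G * W₊) B.≈ tr (G * W₋)
      tr-GW = ≈B.begin
        tr (G * (a * (G₊ * ā)))    ≈B.≈⟨ tr-cong (trans (sym (*-assoc _ _ _)) (sym (*-assoc _ _ _))) ⟩
        tr (G * a * G₊ * ā)        ≈B.≈⟨ tr-cyclic _ _ ⟩
        tr (ā * (G * a * G₊))      ≈B.≈⟨ tr-cong (sym (*-assoc _ _ _)) ⟩
        tr (Q * G₊)                ≈B.≈⟨ tr-cong QG₊ ⟩
        tr (W₋ * G)                ≈B.≈⟨ tr-cyclic _ _ ⟩
        tr (G * W₋)                ≈B.∎

      θG₊ : G₊ * (θ K₊ * G₊) ≈ - θ G₊
      θG₊ = inverse-derivative KG₊ (trans (sym (θ-leibniz G₊ K₊)) (trans (θ-cong GK₊) θ-1))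

      -- the part of tr (G θW₊) that comes from differentiating G₊
      inner : tr (Q * θ G₊) B.+ tr (G * θ K₊) B.≈ tr (G₊ * θ K₊)
      inner = ≈B.begin
        tr (Q * θ G₊) B.+ tr (G * θ K₊)
          ≈B.≈⟨ B.+-congˡ (tr-cong (*-congʳ (resolventˡ KG GK₊ K₊≈))) ⟩
        tr (Q * θ G₊) B.+ tr ((G₊ + G₊ * (W₋ * G)) * θ K₊)
          ≈B.≈⟨ B.+-congˡ (B.trans (tr-cong (distribʳ (θ K₊) _ _)) (tr-+ _ _)) ⟩
        tr (Q * θ G₊) B.+ (tr (G₊ * θ K₊) B.+ tr (G₊ * (W₋ * G) * θ K₊))
          ≈B.≈⟨ B.+-congˡ (B.+-congˡ (tr-cong (*-congʳ (*-congˡ QG₊)))) ⟨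
        tr (Q * θ G₊) B.+ (tr (G₊ * θ K₊) B.+ tr (G₊ * (Q * G₊) * θ K₊))
          ≈B.≈⟨ B.+-congˡ (B.+-congˡ cyc) ⟩
        tr (Q * θ G₊) B.+ (tr (G₊ * θ K₊) B.+ tr (Q * - θ G₊))
          ≈B.≈⟨ B.trans (B.+-congˡ (B.+-comm _ _)) (B.sym (B.+-assoc _ _ _)) ⟩
        tr (Q * θ G₊) B.+ tr (Q * - θ G₊) B.+ tr (G₊ * θ K₊)
          ≈B.≈⟨ B.+-congʳ (B.trans (B.sym (tr-+ _ _)) (B.trans (tr-cong vanish) tr-0)) ⟩
        B.0# B.+ tr (G₊ * θ K₊)
          ≈B.≈⟨ B.+-identityˡ _ ⟩
        tr (G₊ * θ K₊) ≈B.∎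
        where
        vanish : Q * θ G₊ + Q * - θ G₊ ≈ 0#
        vanish = trans (sym (distribˡ Q _ _)) (trans (*-congˡ (-‿inverseʳ _)) (zeroʳ Q))
        cyc : tr (G₊ * (Q * G₊) * θ K₊) B.≈ tr (Q * - θ G₊)
        cyc = ≈B.begin
          tr (G₊ * (Q * G₊) * θ K₊)      ≈B.≈⟨ tr-cong (*-assoc _ _ _) ⟩
          tr (G₊ * (Q * G₊ * θ K₊))      ≈B.≈⟨ tr-cyclic _ _ ⟩
          tr (Q * G₊ * θ K₊ * G₊)        ≈B.≈⟨ tr-cong (trans (*-assoc _ _ _) (*-assoc _ _ _)) ⟩
          tr (Q * (G₊ * (θ K₊ * G₊)))    ≈B.≈⟨ tr-cong (*-congˡ θG₊) ⟩
          tr (Q * - θ G₊)                ≈B.∎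

      θW₊ : θ W₊ ≈ W₊ + W₊ + a * (θ G₊ * ā)
      θW₊ = begin
        θ (a * (G₊ * ā))                          ≈⟨ θ-leibniz _ _ ⟩
        θ a * (G₊ * ā) + a * θ (G₊ * ā)           ≈⟨ +-cong (*-congʳ θa) (*-congˡ (θ-leibniz _ _)) ⟩
        W₊ + a * (θ G₊ * ā + G₊ * θ ā)            ≈⟨ +-congˡ (*-congˡ (trans (+-congˡ (*-congˡ θā)) (+-comm _ _))) ⟩
        W₊ + a * (G₊ * ā + θ G₊ * ā)              ≈⟨ +-congˡ (distribˡ a _ _) ⟩
        W₊ + (W₊ + a * (θ G₊ * ā))                ≈⟨ +-assoc _ _ _ ⟨
        W₊ + W₊ + a * (θ G₊ * ā)                  ∎

      -- θ doubles W₊ because of its two steps `a` and `ā`, each of weight one, and `tr-GW` trades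
      -- one copy for W₋. The derivative of W₋ is absorbed in θK₊ = θK + θW₋, and that of G₊ is
      -- evaluated by `inner`.
      tr-GθW : tr (G * θ (W₊ + W₋)) B.+ tr (G * θ K) B.≈ tr (G * (W₊ + W₋)) B.+ tr (G₊ * θ K₊)
      tr-GθW = ≈B.begin
        tr (G * θ (W₊ + W₋)) B.+ tr (G * θ K)
          ≈B.≈⟨ B.+-congʳ (B.trans (tr-cong (trans (*-congˡ (θ-+ W₊ W₋)) (distribˡ G _ _))) (tr-+ _ _)) ⟩
        tr (G * θ W₊) B.+ tr (G * θ W₋) B.+ tr (G * θ K)
          ≈B.≈⟨ B.trans (B.+-assoc _ _ _) (B.+-congˡ (B.+-comm _ _)) ⟩
        tr (G * θ W₊) B.+ (tr (G * θ K) B.+ tr (G * θ W₋))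
          ≈B.≈⟨ B.+-cong (B.trans (tr-cong (trans (*-congˡ θW₊) (distribˡ G _ _))) (tr-+ _ _))
                 (B.trans (B.sym (tr-+ _ _)) (tr-cong (trans (sym (distribˡ G _ _)) (*-congˡ (trans (sym (θ-+ K W₋)) (θ-cong (sym K₊≈))))))) ⟩
        tr (G * (W₊ + W₊)) B.+ tr (G * (a * (θ G₊ * ā))) B.+ tr (G * θ K₊)
          ≈B.≈⟨ B.trans (B.+-congʳ (B.+-congˡ cyc)) (B.+-assoc _ _ _) ⟩
        tr (G * (W₊ + W₊)) B.+ (tr (Q * θ G₊) B.+ tr (G * θ K₊))
          ≈B.≈⟨ B.+-cong (B.trans (tr-cong (distribˡ G _ _)) (B.trans (tr-+ _ _) (B.+-congˡ tr-GW))) inner ⟩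
        tr (G * W₊) B.+ tr (G * W₋) B.+ tr (G₊ * θ K₊)
          ≈B.≈⟨ B.+-congʳ (B.trans (tr-cong (distribˡ G _ _)) (tr-+ _ _)) ⟨
        tr (G * (W₊ + W₋)) B.+ tr (G₊ * θ K₊) ≈B.∎
        where
        cyc : tr (G * (a * (θ G₊ * ā))) B.≈ tr (Q * θ G₊)
        cyc = B.trans (tr-cong (trans (sym (*-assoc _ _ _)) (sym (*-assoc _ _ _))))
          (B.trans (tr-cyclic _ _) (tr-cong (sym (*-assoc _ _ _))))

    -- Derivative of the Bethe free energy of the tree: log det K is corrected by one term log det K − log det K₊ per edge.
    bethe : ∀ n (edge : Fin n → Edge G K) {C} →
      C ≈ K + ΣR.sum (fin n) (λ i → Edge.W₊ (edge i) + Edge.W₋ (edge i)) → C ≈ θ C + 1# →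
      tr G B.+ B.- tr 1# B.≈ B.- tr (G * θ K) B.+
        ΣB.sum (fin n) (λ i → tr (G * θ K) B.+ B.- tr (Edge.G₊ (edge i) * θ (Edge.K₊ (edge i))))
    bethe n edge {C} C≈ θC = BF.move (≈B.begin
      tr G
        ≈B.≈⟨ BF.cancelʳ (tr G) (ψ B.+ b) ⟨
      tr G B.+ (ψ B.+ b) B.+ B.- (ψ B.+ b)
        ≈B.≈⟨ B.+-congʳ (B.trans (B.+-comm _ _) total) ⟩
      tr 1# B.+ s B.+ B.- (ψ B.+ b)
        ≈B.≈⟨ B.trans (B.+-assoc _ _ _) (B.+-comm _ _) ⟩
      s B.+ B.- (ψ B.+ b) B.+ tr 1#
        ≈B.≈⟨ B.+-congʳ (B.trans (B.+-congˡ (B.sym (⁻¹-∙-comm ψ b))) (B.trans (B.sym (B.+-assoc _ _ _))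
               (B.trans (B.+-congʳ (B.+-comm _ _)) (B.trans (B.+-assoc _ _ _) (B.+-congˡ difference))))) ⟩
      B.- ψ B.+ ΣB.sum (fin n) (λ i → ψ B.+ B.- ψ₊ i) B.+ tr 1# ≈B.∎)
      where
      open import Algebra.Properties.AbelianGroup B.+-abelianGroup using (⁻¹-∙-comm)
      W : Fin n → Carrier
      W i = Edge.W₊ (edge i) + Edge.W₋ (edge i)
      ψ s b : B.Carrier
      ψ = tr (G * θ K)
      s = ΣB.sum (fin n) (λ i → tr (G * W i))
      b = ΣB.sum (fin n) (λ i → tr (G * θ (W i)))
      ψ₊ : Fin n → B.Carrier
      ψ₊ i = tr (Edge.G₊ (edge i) * θ (Edge.K₊ (edge i)))

      trG-additive : Additive R B
      trG-additive = record
        { fun = λ x → tr (G * x) ; cong = λ e → tr-cong (*-congˡ e)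
        ; zer = B.trans (tr-cong (zeroʳ G)) tr-0
        ; add = λ x y → B.trans (tr-cong (distribˡ G x y)) (tr-+ _ _) }
      trGθ-additive : Additive R B
      trGθ-additive = record
        { fun = λ x → tr (G * θ x) ; cong = λ e → tr-cong (*-congˡ (θ-cong e))
        ; zer = B.trans (tr-cong (trans (*-congˡ θ-0) (zeroʳ G))) tr-0
        ; add = λ x y → B.trans (tr-cong (trans (*-congˡ (θ-+ x y)) (distribˡ G _ _))) (tr-+ _ _) }

      -- Two evaluations of tr (G C), one with C = θC + 1 and one with C = K + ΣW.
      total : ψ B.+ b B.+ tr G B.≈ tr 1# B.+ s
      total = ≈B.begin
        ψ B.+ b B.+ tr G
          ≈B.≈⟨ B.+-congʳ (B.+-congˡ (sum-hom trGθ-additive (fin n) W)) ⟨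
        ψ B.+ tr (G * θ (ΣR.sum (fin n) W)) B.+ tr G
          ≈B.≈⟨ B.+-congʳ (B.sym (Additive.add trGθ-additive K _)) ⟩
        tr (G * θ (K + ΣR.sum (fin n) W)) B.+ tr G
          ≈B.≈⟨ B.+-cong (tr-cong (*-congˡ (θ-cong (sym C≈)))) (tr-cong (sym (*-identityʳ G))) ⟩
        tr (G * θ C) B.+ tr (G * 1#)
          ≈B.≈⟨ Additive.add trG-additive _ _ ⟨
        tr (G * (θ C + 1#))
          ≈B.≈⟨ tr-cong (*-congˡ (trans (sym θC) C≈)) ⟩
        tr (G * (K + ΣR.sum (fin n) W))
          ≈B.≈⟨ Additive.add trG-additive _ _ ⟩
        tr (G * K) B.+ tr (G * ΣR.sum (fin n) W)
          ≈B.≈⟨ B.+-cong (tr-cong GK) (sum-hom trG-additive (fin n) W) ⟩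
        tr 1# B.+ s ≈B.∎

      difference : s B.+ B.- b B.≈ ΣB.sum (fin n) (λ i → ψ B.+ B.- ψ₊ i)
      difference = B.trans (B.+-congˡ (ΣB.sum-neg (fin n) _)) (B.trans (B.sym (ΣB.sum-+ (fin n) _ _))
        (ΣB.sum-cong (fin n) (λ i → BF.move (≈B.begin
          tr (G * W i)
            ≈B.≈⟨ BF.cancelʳ _ (ψ₊ i) ⟨
          tr (G * W i) B.+ ψ₊ i B.+ B.- ψ₊ i
            ≈B.≈⟨ B.+-congʳ (tr-GθW (edge i)) ⟨
          tr (G * θ (W i)) B.+ ψ B.+ B.- ψ₊ i
            ≈B.≈⟨ B.trans (B.+-assoc _ _ _) (B.+-comm _ _) ⟩
          ψ B.+ B.- ψ₊ i B.+ tr (G * θ (W i)) ≈B.∎))))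

-- Walks on the Cayley tree

letter : ℕ → Ix
letter n = fin n ⊗ bool

flip : ∀ {n} → Letter n → Letter n
flip (i , b) = i , not b

flip-involutive : ∀ {n} (x : Letter n) → flip (flip x) ≡ x
flip-involutive (i , b) = ≡.cong (i ,_) (Boolₚ.not-involutive b)

cancels-flip : ∀ {n} (y l : Letter n) → cancels (flip y) l ≡ eqb (letter n) l y
cancels-flip {n} (i , b) (j , c) = ≡.trans (≡.cong (does (i Fin.≟ j) ∧_) (bools b c)) (eqb-sym (letter n) (i , b) (j , c))
  where
  bools : ∀ b c → not b xor c ≡ eqb bool b c
  bools true  true  = ≡.refl
  bools true  false = ≡.refl
  bools false true  = ≡.refl
  bools false false = ≡.refl

-- In the Cayley tree, g is the Green function of 1 − X (N₀ + Σ_y N_y y) at the root, and G x the one at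
-- the vertex x of the subtree of words beginning with x.
module Tree {S : CommutativeRing 0ℓ 0ℓ} (setting : Setting S) (I : Ix) (n : ℕ)
  (X : CommutativeRing.Carrier S)
  (θX : CommutativeRing._≈_ S (Setting.θ setting X) X)
  (Alg-X : Setting.Alg setting X)
  (small : ∀ {y z} → CommutativeRing._≈_ S z (CommutativeRing._*_ S X y) → Setting.Small setting z)
  (N₀ : El I → El I → CommutativeRing.Carrier S)
  (N : Letter n → El I → El I → CommutativeRing.Carrier S) where

  open CommutativeRing S hiding (zero)
  open Setting setting
  open SumLaws ring
  open Matrices ring using (Matrix; _≋_; _⊡_; ⊡-assoc; entry) renaming (ring to matrixRing)
  open LogDeterminant setting
  private
    module M = Ring (matrixRing I)
    module MF = RingFacts (matrixRing I)
    module ΣM = SumLaws (matrixRing I)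
    L = letter n
  open import Algebra.Properties.AbelianGroup M.+-abelianGroup using () renaming (⁻¹-∙-comm to M-neg-+; ⁻¹-involutive to M-neg-neg)
  open import Algebra.Properties.Ring ring using (-‿distribʳ-*)
  open import Relation.Binary.Reasoning.Setoid M.setoid

  scale : Matrix I I → Matrix I I
  scale Z i j = X * Z i j

  scale-additive : Additive (matrixRing I) (matrixRing I)
  scale-additive = record
    { fun = scale ; cong = λ e i j → *-congˡ (e i j) ; zer = λ i j → zeroʳ X ; add = λ Y Z i j → distribˡ X _ _ }

  open Additive scale-additive using () renaming (cong to scale-cong; add to scale-+)

  scale-⊡ : ∀ Y Z → scale Y ⊡ Z ≋ scale (Y ⊡ Z)
  scale-⊡ Y Z i j = trans (sum-cong I (λ k → *-assoc X (Y i k) (Z k j))) (sym (sum-*ˡ I X _))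

  scale-neg : ∀ Z → scale (M.- Z) ≋ M.- scale Z
  scale-neg Z i j = sym (-‿distribʳ-* X (Z i j))

  a : Letter n → Matrix I I
  a y = scale (N y)

  module _ (G : Letter n → Matrix I I) where

    -- X · W y is the generating function of the excursions from the root through y
    W : Letter n → Matrix I I
    W y = N y ⊡ (G y ⊡ a (flip y))

    H : Matrix I I
    H = N₀ M.+ ΣM.sum L W

    module _ (g : Matrix I I)
      (g-equation : g ≋ M.1# M.+ scale (H ⊡ g))
      (G-equation : ∀ x → G x ≋ M.1# M.+ scale ((H M.+ M.- W (flip x)) ⊡ G x)) where

      -- First-passage decomposition: a walk from x w to the root leaves the branch at x w by
      -- cancelling x. `G (flip x)` collects what happens before, since its equation excludes the
      -- excursions W_x, and `a x` is the cancelling step.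
      U : Word n → Matrix I I
      U []      = g
      U (x ∷ w) = (G (flip x) ⊡ a x) ⊡ U w

      atRoot : Word n → Matrix I I
      atRoot []      = M.1#
      atRoot (_ ∷ _) = M.0#

      W-U : ∀ y Z → N y ⊡ ((G (flip (flip y)) ⊡ a (flip y)) ⊡ Z) ≋ W y ⊡ Z
      W-U y Z = M.trans (M.*-congˡ {N y} (λ i j → reflexive (≡.cong (λ x → ((G x ⊡ a (flip y)) ⊡ Z) i j) (flip-involutive y))))
        (M.sym (⊡-assoc (N y) (G y ⊡ a (flip y)) Z))

      -- Prepending y⁻¹ to l w lengthens the word and contributes W_y unless y = l, when it cancels.
      -- The exception is written with δ so that `sum-δˡ` evaluates the sum over y.
      push-flip : ∀ y l w → N y ⊡ U (push (flip y) (l ∷ w)) ≋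
        W y ⊡ U (l ∷ w) M.+ ΣM.δ L l y ⊡ (N y ⊡ U w M.+ M.- (W y ⊡ U (l ∷ w)))
      push-flip y l w rewrite cancels-flip y l with eqb L l y
      ... | true  = M.sym (begin
        P M.+ M.1# ⊡ (N y ⊡ U w M.+ M.- P)  ≈⟨ M.+-congˡ (M.*-identityˡ (N y ⊡ U w M.+ M.- P)) ⟩
        P M.+ (N y ⊡ U w M.+ M.- P)         ≈⟨ M.+-comm P (N y ⊡ U w M.+ M.- P) ⟩
        N y ⊡ U w M.+ M.- P M.+ P           ≈⟨ MF.unmove {N y ⊡ U w} {N y ⊡ U w M.+ M.- P} {P} M.refl ⟨
        N y ⊡ U w                           ∎)
        where
        P : Matrix I I
        P = W y ⊡ U (l ∷ w)
      ... | false = M.trans (W-U y (U (l ∷ w))) (M.sym (M.trans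
        (M.+-congˡ {W y ⊡ U (l ∷ w)} (M.zeroˡ (N y ⊡ U w M.+ M.- (W y ⊡ U (l ∷ w))))) (M.+-identityʳ (W y ⊡ U (l ∷ w)))))

      -- U w is the coefficient of w in the inverse of 1 − X (N₀ + Σ_y N_y y)
      U-equation : ∀ w → U w ≋ atRoot w M.+ scale (N₀ ⊡ U w M.+ ΣM.sum L (λ y → N y ⊡ U (push (flip y) w)))
      U-equation [] = M.trans g-equation (M.+-congˡ {M.1#} (scale-cong (begin
        H ⊡ g
          ≈⟨ M.distribʳ g N₀ (ΣM.sum L W) ⟩
        N₀ ⊡ g M.+ ΣM.sum L W ⊡ g
          ≈⟨ M.+-congˡ {N₀ ⊡ g} (ΣM.sum-*ʳ L g W) ⟩
        N₀ ⊡ g M.+ ΣM.sum L (λ y → W y ⊡ g)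
          ≈⟨ M.+-congˡ {N₀ ⊡ g} (ΣM.sum-cong L (λ y → W-U y g)) ⟨
        N₀ ⊡ g M.+ ΣM.sum L (λ y → N y ⊡ U (flip y ∷ [])) ∎)))
      U-equation (l ∷ w) = begin
        (G (flip l) ⊡ a l) ⊡ U w
          ≈⟨ ⊡-assoc (G (flip l)) (a l) (U w) ⟩
        G (flip l) ⊡ Z
          ≈⟨ M.*-congʳ {Z} (G-equation (flip l)) ⟩
        (M.1# M.+ scale ((H M.+ M.- W (flip (flip l))) ⊡ G (flip l))) ⊡ Z
          ≈⟨ M.*-congʳ {Z} (M.+-congˡ {M.1#} (scale-cong (M.*-congʳ {G (flip l)} (M.+-congˡ {H} (M.-‿cong
               (λ i j → reflexive (≡.cong (λ x → W x i j) (flip-involutive l)))))))) ⟩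
        (M.1# M.+ scale ((H M.+ M.- W l) ⊡ G (flip l))) ⊡ Z
          ≈⟨ M.distribʳ Z M.1# (scale ((H M.+ M.- W l) ⊡ G (flip l))) ⟩
        M.1# ⊡ Z M.+ scale ((H M.+ M.- W l) ⊡ G (flip l)) ⊡ Z
          ≈⟨ M.+-cong (M.*-identityˡ Z) (scale-⊡ ((H M.+ M.- W l) ⊡ G (flip l)) Z) ⟩
        Z M.+ scale ((H M.+ M.- W l) ⊡ G (flip l) ⊡ Z)
          ≈⟨ M.+-cong (scale-⊡ (N l) (U w)) (scale-cong (M.trans (⊡-assoc (H M.+ M.- W l) (G (flip l)) Z)
               (M.*-congˡ {H M.+ M.- W l} (M.sym (⊡-assoc (G (flip l)) (a l) (U w)))))) ⟩
        scale (N l ⊡ U w) M.+ scale ((H M.+ M.- W l) ⊡ U (l ∷ w))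
          ≈⟨ scale-+ (N l ⊡ U w) ((H M.+ M.- W l) ⊡ U (l ∷ w)) ⟨
        scale (N l ⊡ U w M.+ (H M.+ M.- W l) ⊡ U (l ∷ w))
          ≈⟨ scale-cong steps ⟨
        scale (N₀ ⊡ U (l ∷ w) M.+ ΣM.sum L (λ y → N y ⊡ U (push (flip y) (l ∷ w))))
          ≈⟨ M.+-identityˡ _ ⟨
        M.0# M.+ scale (N₀ ⊡ U (l ∷ w) M.+ ΣM.sum L (λ y → N y ⊡ U (push (flip y) (l ∷ w)))) ∎
        where
        Z P : Matrix I I
        Z = a l ⊡ U w
        P = U (l ∷ w)
        steps : N₀ ⊡ P M.+ ΣM.sum L (λ y → N y ⊡ U (push (flip y) (l ∷ w))) ≋ N l ⊡ U w M.+ (H M.+ M.- W l) ⊡ P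
        steps = begin
          N₀ ⊡ P M.+ ΣM.sum L (λ y → N y ⊡ U (push (flip y) (l ∷ w)))
            ≈⟨ M.+-congˡ {N₀ ⊡ P} (ΣM.sum-cong L (λ y → push-flip y l w)) ⟩
          N₀ ⊡ P M.+ ΣM.sum L (λ y → W y ⊡ P M.+ ΣM.δ L l y ⊡ (N y ⊡ U w M.+ M.- (W y ⊡ P)))
            ≈⟨ M.+-congˡ {N₀ ⊡ P} (M.trans (ΣM.sum-+ L (λ y → W y ⊡ P) (λ y → ΣM.δ L l y ⊡ (N y ⊡ U w M.+ M.- (W y ⊡ P))))
                 (M.+-cong (M.sym (ΣM.sum-*ʳ L P W)) (ΣM.sum-δˡ L l (λ y → N y ⊡ U w M.+ M.- (W y ⊡ P))))) ⟩
          N₀ ⊡ P M.+ (ΣM.sum L W ⊡ P M.+ (N l ⊡ U w M.+ M.- (W l ⊡ P)))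
            ≈⟨ M.+-assoc (N₀ ⊡ P) (ΣM.sum L W ⊡ P) (N l ⊡ U w M.+ M.- (W l ⊡ P)) ⟨
          N₀ ⊡ P M.+ ΣM.sum L W ⊡ P M.+ (N l ⊡ U w M.+ M.- (W l ⊡ P))
            ≈⟨ M.+-congʳ {N l ⊡ U w M.+ M.- (W l ⊡ P)} (M.distribʳ P N₀ (ΣM.sum L W)) ⟨
          H ⊡ P M.+ (N l ⊡ U w M.+ M.- (W l ⊡ P))
            ≈⟨ M.+-assoc (H ⊡ P) (N l ⊡ U w) (M.- (W l ⊡ P)) ⟨
          H ⊡ P M.+ N l ⊡ U w M.+ M.- (W l ⊡ P)
            ≈⟨ M.+-congʳ {M.- (W l ⊡ P)} (M.+-comm (H ⊡ P) (N l ⊡ U w)) ⟩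
          N l ⊡ U w M.+ H ⊡ P M.+ M.- (W l ⊡ P)
            ≈⟨ M.+-assoc (N l ⊡ U w) (H ⊡ P) (M.- (W l ⊡ P)) ⟩
          N l ⊡ U w M.+ (H ⊡ P M.+ M.- (W l ⊡ P))
            ≈⟨ M.+-congˡ {N l ⊡ U w} (MF.*-distribʳ-sub P H (W l)) ⟨
          N l ⊡ U w M.+ (H M.+ M.- W l) ⊡ P ∎

      module _ (Alg-N₀ : ∀ i j → Alg (N₀ i j)) (Alg-N : ∀ y i j → Alg (N y i j))
               (Alg-G : ∀ y i j → Alg (G y i j))
               (θ-N₀ : ∀ i j → θ (N₀ i j) ≈ 0#) (θ-N : ∀ y i j → θ (N y i j) ≈ 0#) where

        resolvent : Matrix I I → Matrix I I
        resolvent P = M.1# M.+ M.- scale P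

        resolvent-inverse : ∀ {P Y} → Y ≋ M.1# M.+ scale (P ⊡ Y) → resolvent P ⊡ Y ≋ M.1#
        resolvent-inverse {P} {Y} e = begin
          (M.1# M.+ M.- scale P) ⊡ Y
            ≈⟨ MF.*-distribʳ-sub Y M.1# (scale P) ⟩
          M.1# ⊡ Y M.+ M.- (scale P ⊡ Y)
            ≈⟨ M.+-cong (M.*-identityˡ Y) (M.-‿cong (scale-⊡ P Y)) ⟩
          Y M.+ M.- scale (P ⊡ Y)
            ≈⟨ MF.move {Y} {M.1#} {scale (P ⊡ Y)} e ⟩
          M.1# ∎

        Alg-⊡ : ∀ {Y Z : Matrix I I} → (∀ i j → Alg (Y i j)) → (∀ i j → Alg (Z i j)) → ∀ i j → Alg ((Y ⊡ Z) i j)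
        Alg-⊡ AY AZ i j = Alg-sum I (λ k → Alg-* (AY i k) (AZ k j))

        Alg-W : ∀ y i j → Alg (W y i j)
        Alg-W y = Alg-⊡ (Alg-N y) (Alg-⊡ (Alg-G y) (λ i j → Alg-* Alg-X (Alg-N (flip y) i j)))

        Alg-H : ∀ i j → Alg (H i j)
        Alg-H i j = Alg-+ (Alg-N₀ i j) (Alg-resp (sym (sum-hom (entry i j) L W)) (Alg-sum L (λ y → Alg-W y i j)))

        resolvent-logDet : ∀ P → (∀ i j → Alg (P i j)) → LogDet I (resolvent P)
        resolvent-logDet P AP = logDet I (resolvent P)
          (λ i j → Alg-+ (Alg-δ i j) (Alg-neg (Alg-* Alg-X (AP i j))))
          (λ i j → small (trans (+-congʳ (+-comm _ _)) (trans (RingFacts.cancelʳ ring (- (X * P i j)) (δ I i j)) (-‿distribʳ-* X (P i j)))))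

        module _ {P Y : Matrix I I} (AP : ∀ i j → Alg (P i j)) (e : Y ≋ M.1# M.+ scale (P ⊡ Y)) where
          private
            d = resolvent-logDet P AP
            open LogDet d using (inv; inverseˡ; logAlg)

          -- The equation for `Y` makes it a right inverse of the resolvent. `LogDet` supplies a
          -- two-sided inverse, the two agree, and `Y` inherits the other side.
          inv≋ : inv ≋ Y
          inv≋ = MF.inverse-unique {inv} {resolvent P} {Y} inverseˡ (resolvent-inverse e)

          resolvent-inverseˡ : Y ⊡ resolvent P ≋ M.1#
          resolvent-inverseˡ = M.trans (M.*-congʳ {resolvent P} (M.sym inv≋)) inverseˡ

          resolvent-logAlg : LogAlg (tr I (Y ⊡ Θ (resolvent P)))
          resolvent-logAlg = LogAlg-resp (Additive.cong (tr-additive I) (M.*-congʳ {Θ (resolvent P)} inv≋)) logAlg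

        K : Matrix I I
        K = resolvent H

        H₋ : Letter n → Matrix I I
        H₋ x = H M.+ M.- W (flip x)

        Alg-H₋ : ∀ x i j → Alg (H₋ x i j)
        Alg-H₋ x i j = Alg-+ (Alg-H i j) (Alg-neg (Alg-W (flip x) i j))

        a-W : ∀ y → a y ⊡ (G y ⊡ a (flip y)) ≋ scale (W y)
        a-W y = scale-⊡ (N y) (G y ⊡ a (flip y))

        K₋≈ : ∀ x → resolvent (H₋ x) ≋ K M.+ scale (W (flip x))
        K₋≈ x = begin
          M.1# M.+ M.- scale (H M.+ M.- W (flip x))
            ≈⟨ M.+-congˡ {M.1#} (M.-‿cong (M.trans (scale-+ H (M.- W (flip x))) (M.+-congˡ {scale H} (scale-neg (W (flip x)))))) ⟩
          M.1# M.+ M.- (scale H M.+ M.- scale (W (flip x)))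
            ≈⟨ M.+-congˡ {M.1#} (M.sym (M-neg-+ (scale H) (M.- scale (W (flip x))))) ⟩
          M.1# M.+ (M.- scale H M.+ M.- (M.- scale (W (flip x))))
            ≈⟨ M.sym (M.+-assoc M.1# (M.- scale H) (M.- (M.- scale (W (flip x))))) ⟩
          K M.+ M.- (M.- scale (W (flip x)))
            ≈⟨ M.+-congˡ {K} (M-neg-neg (scale (W (flip x)))) ⟩
          K M.+ scale (W (flip x)) ∎

        Θ-scale : ∀ {Z} → (∀ i j → θ (Z i j) ≈ 0#) → Θ (scale Z) ≋ scale Z
        Θ-scale {Z} e i j = trans (θ-leibniz X (Z i j)) (trans (+-cong (*-congʳ θX) (trans (*-congˡ (e i j)) (zeroʳ X))) (+-identityʳ _))

        open Bethe (tr-additive I) tr-cyclic (Θ-additive I) Θ-leibniz using (Edge; bethe)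

        edge : Fin n → Edge g K
        edge i = record
          { a = a (i , true) ; ā = a (i , false)
          ; G₊ = G (i , true) ; G₋ = G (i , false)
          ; K₊ = resolvent (H₋ (i , true)) ; K₋ = resolvent (H₋ (i , false))
          ; θa = Θ-scale (θ-N (i , true)) ; θā = Θ-scale (θ-N (i , false))
          ; K₊≈ = M.trans (K₋≈ (i , true)) (M.+-congˡ {K} (M.sym (a-W (i , false))))
          ; K₋≈ = M.trans (K₋≈ (i , false)) (M.+-congˡ {K} (M.sym (a-W (i , true))))
          ; KG₊ = resolvent-inverse (G-equation (i , true))
          ; GK₊ = resolvent-inverseˡ (Alg-H₋ (i , true)) (G-equation (i , true))
          ; GK₋ = resolvent-inverseˡ (Alg-H₋ (i , false)) (G-equation (i , false))
          }

        root-logAlg : LogAlg (tr I g + - tr I M.1#)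
        root-logAlg = LogAlg-resp
          (sym (bethe {g} {K} (resolvent-inverse g-equation) (resolvent-inverseˡ Alg-H g-equation) n edge {resolvent N₀} C≈ θC))
          (LogAlg-+ (LogAlg-neg ψ) (LogAlg-sum n (λ i → LogAlg-+ ψ (LogAlg-neg (resolvent-logAlg (Alg-H₋ (i , true)) (G-equation (i , true)))))))
          where
          ψ : LogAlg (tr I (g ⊡ Θ K))
          ψ = resolvent-logAlg Alg-H g-equation
          C≈ : resolvent N₀ ≋ K M.+ ΣM.sum (fin n) (λ i → a (i , true) ⊡ (G (i , true) ⊡ a (i , false)) M.+ a (i , false) ⊡ (G (i , false) ⊡ a (i , true)))
          C≈ = begin
            M.1# M.+ M.- scale N₀
              ≈⟨ MF.cancelʳ (M.1# M.+ M.- scale N₀) (M.- scale (ΣM.sum L W)) ⟨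
            M.1# M.+ M.- scale N₀ M.+ M.- scale (ΣM.sum L W) M.+ M.- (M.- scale (ΣM.sum L W))
              ≈⟨ M.+-cong (M.trans (M.+-assoc M.1# (M.- scale N₀) (M.- scale (ΣM.sum L W))) (M.+-congˡ {M.1#}
                   (M.trans (M-neg-+ (scale N₀) (scale (ΣM.sum L W))) (M.-‿cong (M.sym (scale-+ N₀ (ΣM.sum L W)))))))
                   (M-neg-neg (scale (ΣM.sum L W))) ⟩
            K M.+ scale (ΣM.sum L W)
              ≈⟨ M.+-congˡ {K} (sum-hom scale-additive L W) ⟩
            K M.+ ΣM.sum L (λ y → scale (W y))
              ≈⟨ M.+-congˡ {K} (ΣM.sum-cong (fin n) (λ i → M.+-cong (M.sym (a-W (i , true))) (M.sym (a-W (i , false))))) ⟩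
            K M.+ ΣM.sum (fin n) (λ i → a (i , true) ⊡ (G (i , true) ⊡ a (i , false)) M.+ a (i , false) ⊡ (G (i , false) ⊡ a (i , true))) ∎
          -- `resolvent N₀` is affine in X, so θ merely removes its constant term 1.
          θC : resolvent N₀ ≋ Θ (resolvent N₀) M.+ M.1#
          θC = begin
            M.1# M.+ M.- scale N₀
              ≈⟨ M.+-comm M.1# (M.- scale N₀) ⟩
            M.- scale N₀ M.+ M.1#
              ≈⟨ M.+-congʳ {M.1#} (M.sym (M.trans (Additive.add (Θ-additive I) M.1# (M.- scale N₀))
                   (M.trans (M.+-congʳ {Θ (M.- scale N₀)} (Θ-1 I)) (M.trans (M.+-identityˡ (Θ (M.- scale N₀)))
                     (M.trans (λ i j → θ-neg (X * N₀ i j)) (M.-‿cong (Θ-scale θ-N₀))))))) ⟩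
            Θ (resolvent N₀) M.+ M.1# ∎
            where
            open import Algebra.Properties.AbelianGroup +-abelianGroup using (inverseʳ-unique)
            θ-neg : ∀ x → θ (- x) ≈ - θ x
            θ-neg x = inverseʳ-unique (θ x) (θ (- x)) (trans (sym (θ-+ x (- x))) (trans (θ-cong (-‿inverseʳ x)) θ-0))

-- Matrices supported on words of length at most 1

module NearestNeighbour {A : CommutativeRing 0ℓ 0ℓ} (dom : DecDomain A) (D-all : ∀ x → DecDomain.D dom x) where
  private
    module A = CommutativeRing A
    module S = Series A
    module R = CommutativeRing S.ser
    module P = Polynomials dom
    module Alg = Algebraicity P.polynomials
    module ΣA = SumLaws A.ring
    module ΣS = SumLaws R.ring
    open System dom D-all

  setting : Setting S.ser
  setting = record
    { θ-additive  = S.θ-additive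
    ; θ-leibniz   = S.θ-leibniz
    ; Alg         = Alg.Algebraic
    ; Alg-resp    = Alg.algebraic-resp
    ; Alg-0       = Alg.algebraic-D (DecDomain.D-0 P.polynomials)
    ; Alg-1       = Alg.algebraic-D (DecDomain.D-1 P.polynomials)
    ; Alg-+       = Alg.algebraic-+
    ; Alg-*       = Alg.algebraic-*
    ; Alg-neg     = Alg.algebraic-neg
    ; Alg-inverse = Alg.algebraic-inverse
    ; Small       = λ f → f 0 A.≈ A.0#
    ; unit        = λ {f} f₀ g → let open S.Inverse (R.1# R.+ f R.* g)
                                       (A.trans (A.+-congˡ (A.trans (A.*-congʳ f₀) (A.zeroˡ _))) (A.+-identityʳ _))
                                 in inv , inv-⋆
    }

  open LogDeterminant setting public using (LogAlg)
  open LogDeterminant setting using (tr; LogAlg-resp)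

  module _ (I : Ix) (n : ℕ) (N₀ : El I → El I → A.Carrier) (N : Letter n → El I → El I → A.Carrier) where
    private
      L : Ix
      L = letter n

      -- One unknown per matrix entry: `inj₁` for the Green function at the root, `inj₂ x` for that
      -- of the subtree at x.
      code : Ix
      code = (fin 1 ⊕ L) ⊗ (I ⊗ I)

      Ex : Set
      Ex = Expr A.Carrier (El code)

      Σᴱ : ∀ c → (El c → Ex) → Ex
      Σᴱ (fin zero)    f = const A.0#
      Σᴱ (fin (suc m)) f = f zero ∔ Σᴱ (fin m) (f ∘ suc)
      Σᴱ bool          f = f true ∔ f false
      Σᴱ (a ⊕ b)       f = Σᴱ a (f ∘ inj₁) ∔ Σᴱ b (f ∘ inj₂)
      Σᴱ (a ⊗ b)       f = Σᴱ a (λ x → Σᴱ b (λ y → f (x , y)))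

      Wᴱ : Letter n → El I → El I → Ex
      Wᴱ y i k = Σᴱ I (λ a → const (N y i a) ∙ Σᴱ I (λ b → var (inj₂ y , a , b) ∙ (X ∙ const (N (flip y) b k))))

      -- The subtree at x lacks the excursions through x⁻¹; the root lacks none.
      correction : El (fin 1 ⊕ L) → El I → El I → Ex
      correction (inj₁ _) i k = const A.0#
      correction (inj₂ x) i k = const (A.- A.1#) ∙ Wᴱ (flip x) i k

      Hᴱ : El (fin 1 ⊕ L) → El I → El I → Ex
      Hᴱ o i k = (const (N₀ i k) ∔ Σᴱ L (λ y → Wᴱ y i k)) ∔ correction o i k

      rhs : El code → Ex
      rhs (o , i , j) = Σᴱ I (λ k → Hᴱ o i k ∙ var (o , k , j))

      system = solution code (λ { (o , i , j) → ΣA.δ I i j }) rhs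

      f : El code → S.Ser
      f = proj₁ system

      eval-Σ : ∀ c (e : El c → Ex) → eval f (Σᴱ c e) R.≈ ΣS.sum c (λ x → eval f (e x))
      eval-Σ (fin zero)    e zero    = A.refl
      eval-Σ (fin zero)    e (suc k) = A.refl
      eval-Σ (fin (suc m)) e = R.+-congˡ {eval f (e zero)} (eval-Σ (fin m) (e ∘ suc))
      eval-Σ bool          e = R.refl
      eval-Σ (a ⊕ b)       e = R.+-cong (eval-Σ a (e ∘ inj₁)) (eval-Σ b (e ∘ inj₂))
      eval-Σ (a ⊗ b)       e = R.trans (eval-Σ a _) (ΣS.sum-cong a (λ x → eval-Σ b _))

      small-X : ∀ {y z} → z R.≈ S.X R.* y → z 0 A.≈ A.0#
      small-X e = A.trans (e 0) (A.zeroˡ _)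

      n₀ : El I → El I → S.Ser
      n₀ i j = S.con (N₀ i j)
      nₗ : Letter n → El I → El I → S.Ser
      nₗ y i j = S.con (N y i j)

      module T = Tree setting I n S.X S.θ-X (Alg.algebraic-D P.Poly-X) small-X n₀ nₗ
      open Matrices R.ring using (Matrix; _≋_; _⊡_; entry) renaming (ring to matrixRing)
      module M = Ring (matrixRing I)

      G : Letter n → Matrix I I
      G y i j = f (inj₂ y , i , j)

      g : Matrix I I
      g i j = f (inj₁ zero , i , j)

      W : Letter n → Matrix I I
      W = T.W G

      H : Matrix I I
      H = T.H G

      eval-W : ∀ y i k → eval f (Wᴱ y i k) R.≈ W y i k
      eval-W y i k = R.trans (eval-Σ I _) (ΣS.sum-cong I (λ a → R.*-congˡ {S.con (N y i a)} (eval-Σ I _)))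

      eval-H : ∀ i k → eval f (const (N₀ i k) ∔ Σᴱ L (λ y → Wᴱ y i k)) R.≈ H i k
      eval-H i k = R.+-congˡ {S.con (N₀ i k)} (R.trans (eval-Σ L (λ y → Wᴱ y i k)) (R.trans (ΣS.sum-cong L (λ y → eval-W y i k))
        (R.sym (sum-hom (entry i k) L W))))

      con-0 : S.con A.0# R.≈ R.0#
      con-0 zero    = A.refl
      con-0 (suc k) = A.refl

      con-neg : S.con (A.- A.1#) R.≈ R.- R.1#
      con-neg zero    = A.refl
      con-neg (suc k) = A.sym ε⁻¹≈ε
        where open import Algebra.Properties.AbelianGroup A.+-abelianGroup using (ε⁻¹≈ε)

      con-δ : ∀ i j → S.con (ΣA.δ I i j) R.≈ ΣS.δ I i j
      con-δ i j with eqb I i j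
      ... | true  = R.refl
      ... | false = con-0

      equation : ∀ o (P : Matrix I I) → (∀ i k → eval f (Hᴱ o i k) R.≈ P i k) →
        (λ i j → f (o , i , j)) ≋ M.1# M.+ T.scale (P ⊡ (λ i j → f (o , i , j)))
      equation o P e i j = R.trans (proj₂ (proj₂ system) (o , i , j)) (R.+-cong (con-δ i j)
        (R.trans (R.sym (S.X-⋆ _)) (R.*-congˡ {S.X} (R.trans (eval-Σ I _) (ΣS.sum-cong I (λ k → R.*-congʳ {f (o , k , j)} (e i k)))))))

      g-equation : g ≋ M.1# M.+ T.scale (H ⊡ g)
      g-equation = equation (inj₁ zero) H (λ i k →
        R.trans (R.+-cong (eval-H i k) con-0) (R.+-identityʳ (H i k)))

      G-equation : ∀ x → G x ≋ M.1# M.+ T.scale ((H M.+ M.- W (flip x)) ⊡ G x)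
      G-equation x = equation (inj₂ x) (H M.+ M.- W (flip x)) (λ i k →
        R.+-cong (eval-H i k) (R.trans (R.*-cong con-neg (eval-W (flip x) i k)) (-1*x≈-x (W (flip x) i k))))
        where open import Algebra.Properties.Ring R.ring using (-1*x≈-x)

      logAlg : LogAlg (tr I g R.+ R.- tr I M.1#)
      logAlg = T.root-logAlg G g g-equation G-equation
        (λ i j → Alg.algebraic-D (P.Poly-con (D-all _))) (λ y i j → Alg.algebraic-D (P.Poly-con (D-all _)))
        (λ y i j → proj₁ (proj₂ system) (inj₂ y , i , j))
        (λ i j → S.θ-con (N₀ i j)) (λ y i j → S.θ-con (N y i j))

      con-⊡ : ∀ (Z : El I → El I → A.Carrier) (Y : Matrix I I) i j k →
              ((λ i j → S.con (Z i j)) ⊡ Y) i j k A.≈ ΣA.sum I (λ p → Z i p A.* Y p j k)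
      con-⊡ Z Y i j k = A.trans (sum-hom (S.coef-additive k) I _) (ΣA.sum-cong I (λ p → S.con-⋆ (Z i p) (Y p j) k))

    root : Word n → El I → El I → A.Carrier
    root []      i j = ΣA.δ I i j
    root (_ ∷ _) i j = A.0#

    -- `c k v` is the coefficient of v in the k-th power of N₀ + Σ N_y y. Describing it by its
    -- recursion keeps the group algebra out of the series computation.
    module _ (c : ℕ → Word n → El I → El I → A.Carrier)
      (c-zero : ∀ v i j → c 0 v i j A.≈ root (reduce v) i j)
      (c-suc : ∀ k v i j → c (suc k) v i j A.≈ ΣA.sum I (λ p → N₀ i p A.* c k v p j) A.+
        ΣA.sum L (λ y → ΣA.sum I (λ p → N y i p A.* c k (flip y ∷ v) p j))) where
      private
        U′ : Word n → Matrix I I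
        U′ = T.U G g g-equation G-equation

        root-coef : ∀ w i j → T.atRoot G g g-equation G-equation w i j 0 A.≈ root w i j
        root-coef []      i j with eqb I i j
        ... | true  = A.refl
        ... | false = A.refl
        root-coef (_ ∷ _) i j = A.refl

        root-coef-suc : ∀ w i j k → T.atRoot G g g-equation G-equation w i j (suc k) A.≈ A.0#
        root-coef-suc []      i j k with eqb I i j
        ... | true  = A.refl
        ... | false = A.refl
        root-coef-suc (_ ∷ _) i j k = A.refl

        -- Both sides obey the same recursion in k. `reduce (flip y ∷ v)` unfolds to
        -- `push (flip y) (reduce v)`, so words may stay unreduced in `c`.
        U-coef : ∀ k v i j → U′ (reduce v) i j k A.≈ c k v i j
        U-coef zero v i j = A.trans (T.U-equation G g g-equation G-equation (reduce v) i j 0)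
          (A.trans (A.+-cong (root-coef (reduce v) i j) (A.zeroˡ _)) (A.trans (A.+-identityʳ _) (A.sym (c-zero v i j))))
        U-coef (suc k) v i j = A.trans (T.U-equation G g g-equation G-equation (reduce v) i j (suc k))
          (A.trans (A.+-cong (root-coef-suc (reduce v) i j k) (S.X-⋆ _ (suc k)))
          (A.trans (A.+-identityˡ _) (A.trans (A.+-cong
            (A.trans (con-⊡ N₀ (U′ (reduce v)) i j k) (ΣA.sum-cong I (λ p → A.*-congˡ (U-coef k v p j))))
            (A.trans (sum-hom (entry i j) L (λ y → nₗ y ⊡ U′ (reduce (flip y ∷ v))) k)
              (A.trans (sum-hom (S.coef-additive k) L (λ y → (nₗ y ⊡ U′ (reduce (flip y ∷ v))) i j)) (ΣA.sum-cong L (λ y →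
                A.trans (con-⊡ (N y) (U′ (reduce (flip y ∷ v))) i j k)
                  (ΣA.sum-cong I (λ p → A.*-congˡ (U-coef k (flip y ∷ v) p j))))))))
            (A.sym (c-suc k v i j)))))

      trace-logAlg : ∀ h → h 0 A.≈ A.0# → (∀ k → h (suc k) A.≈ ΣA.sum I (λ i → c (suc k) [] i i)) → LogAlg h
      trace-logAlg h h-zero h-suc = LogAlg-resp coefs logAlg
        where
        one-suc : ∀ i k → M.1# i i (suc k) A.≈ A.0#
        one-suc i k with eqb I i i
        ... | true  = A.refl
        ... | false = A.refl
        one-zero : ∀ i → M.1# i i 0 A.≈ ΣA.δ I i i
        one-zero i with eqb I i i
        ... | true  = A.refl
        ... | false = A.refl
        tr-coef : ∀ (Z : Matrix I I) k → tr I Z k A.≈ ΣA.sum I (λ i → Z i i k)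
        tr-coef Z k = sum-hom (S.coef-additive k) I (λ i → Z i i)
        coefs : tr I g R.+ R.- tr I M.1# R.≈ h
        coefs zero = A.trans
          (A.+-cong (A.trans (tr-coef g 0) (ΣA.sum-cong I (λ i → A.trans (U-coef 0 [] i i) (c-zero [] i i))))
            (A.-‿cong (A.trans (tr-coef M.1# 0) (ΣA.sum-cong I one-zero))))
          (A.trans (A.-‿inverseʳ _) (A.sym h-zero))
        coefs (suc k) = A.trans
          (A.+-cong (A.trans (tr-coef g (suc k)) (ΣA.sum-cong I (λ i → U-coef (suc k) [] i i)))
            (A.trans (A.-‿cong (A.trans (tr-coef M.1# (suc k)) (ΣA.sum-zero I (λ i → one-suc i k)))) ε⁻¹≈ε))
          (A.trans (A.+-identityʳ _) (A.sym (h-suc k)))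
          where open import Algebra.Properties.AbelianGroup A.+-abelianGroup using (ε⁻¹≈ε)

-- Free reduction and the group algebra

module _ {n : ℕ} where

  Reduced : Word n → Set
  Reduced []      = ⊤
  Reduced (x ∷ w) = push x w ≡ x ∷ w × Reduced w

  cancels-sound : (x y : Letter n) → cancels x y ≡ true → y ≡ flip x
  cancels-sound (i , b) (j , c) e with i Fin.≟ j
  cancels-sound (i , true)  (.i , false) e  | yes ≡.refl = ≡.refl
  cancels-sound (i , false) (.i , true)  e  | yes ≡.refl = ≡.refl
  cancels-sound (i , true)  (.i , true)  () | yes ≡.refl
  cancels-sound (i , false) (.i , false) () | yes ≡.refl
  cancels-sound (i , b)     (j , c)      () | no _

  cancels-flipˡ : (x : Letter n) → cancels (flip x) x ≡ true
  cancels-flipˡ (i , b) with i Fin.≟ i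
  cancels-flipˡ (i , true)  | yes _ = ≡.refl
  cancels-flipˡ (i , false) | yes _ = ≡.refl
  cancels-flipˡ (i , b)     | no ¬p = contradiction ≡.refl ¬p

  push-Reduced : ∀ x {w} → Reduced w → Reduced (push x w)
  push-Reduced x {[]}    _ = ≡.refl , _
  push-Reduced x {y ∷ w} (p , r) with cancels x y in e
  ... | true  = r
  ... | false = helper , p , r
    where
    helper : push x (y ∷ w) ≡ x ∷ y ∷ w
    helper rewrite e = ≡.refl

  -- Reducedness matters when `push x` removes a letter: the letter pushed back must not cancel
  -- again. Letters thus permute the reduced words.
  push-flip-push : ∀ x {w} → Reduced w → push (flip x) (push x w) ≡ w
  push-flip-push x {[]} _ rewrite cancels-flipˡ x = ≡.refl
  push-flip-push x {y ∷ w} (p , r) with cancels x y in e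
  ... | true  rewrite ≡.sym (cancels-sound x y e) = p
  ... | false rewrite cancels-flipˡ x = ≡.refl

  -- The action on reduced words from van der Waerden's normal form argument. It replaces
  -- confluence: products are well defined because a word and its reduction act alike.
  act : Word n → Word n → Word n
  act u r = foldr push r u

  act-Reduced : ∀ u {r} → Reduced r → Reduced (act u r)
  act-Reduced []      red = red
  act-Reduced (x ∷ u) red = push-Reduced x (act-Reduced u red)

  reduce-Reduced : ∀ u → Reduced (reduce u)
  reduce-Reduced u = act-Reduced u _

  reduce-++ : ∀ u v → reduce (u ++ v) ≡ act u (reduce v)
  reduce-++ u v = Listₚ.foldr-++ push [] u v

  act-push : ∀ x w {r} → Reduced r → push x (act w r) ≡ act (push x w) r
  act-push x []      red = ≡.refl
  act-push x (y ∷ w) {r} red with cancels x y in e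
  ... | false = ≡.refl
  ... | true  = ≡.trans (≡.cong (λ z → push z (push y (act w r))) x≡) (push-flip-push y (act-Reduced w red))
    where
    x≡ : x ≡ flip y
    x≡ = ≡.trans (≡.sym (flip-involutive x)) (≡.cong flip (≡.sym (cancels-sound x y e)))

  act-reduce : ∀ u {r} → Reduced r → act u r ≡ act (reduce u) r
  act-reduce []      red = ≡.refl
  act-reduce (x ∷ u) red = ≡.trans (≡.cong (push x) (act-reduce u red)) (act-push x (reduce u) red)

  reduce-++-congˡ : ∀ {u u′} v → reduce u ≡ reduce u′ → reduce (u ++ v) ≡ reduce (u′ ++ v)
  reduce-++-congˡ {u} {u′} v e = begin
    reduce (u ++ v)              ≡⟨ reduce-++ u v ⟩
    act u (reduce v)             ≡⟨ act-reduce u (reduce-Reduced v) ⟩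
    act (reduce u) (reduce v)    ≡⟨ ≡.cong (λ w → act w (reduce v)) e ⟩
    act (reduce u′) (reduce v)   ≡⟨ act-reduce u′ (reduce-Reduced v) ⟨
    act u′ (reduce v)            ≡⟨ reduce-++ u′ v ⟨
    reduce (u′ ++ v)             ∎
    where open ≡.≡-Reasoning

  reduce-++-congʳ : ∀ u {v v′} → reduce v ≡ reduce v′ → reduce (u ++ v) ≡ reduce (u ++ v′)
  reduce-++-congʳ u {v} {v′} e = ≡.trans (reduce-++ u v) (≡.trans (≡.cong (act u) e) (≡.sym (reduce-++ u v′)))

  reduce-flip : ∀ x u v → reduce (x ∷ u) ≡ reduce v → reduce u ≡ reduce (flip x ∷ v)
  reduce-flip x u v e = ≡.trans (≡.sym (push-flip-push x (reduce-Reduced u))) (≡.cong (push (flip x)) e)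

  reduce-flip⁻¹ : ∀ x u v → reduce u ≡ reduce (flip x ∷ v) → reduce (x ∷ u) ≡ reduce v
  reduce-flip⁻¹ x u v e = reduce-flip (flip x) v u (≡.sym e) ▹ flip-involutive x
    where
    _▹_ : ∀ {y z} → reduce v ≡ reduce (y ∷ u) → y ≡ z → reduce (z ∷ u) ≡ reduce v
    e ▹ ≡.refl = ≡.sym e

  -- One letter moves at a time: if x u v = 1, then u v = x⁻¹ and hence u v x = 1.
  reduce-rotate : ∀ u v → reduce (u ++ v) ≡ [] → reduce (v ++ u) ≡ []
  reduce-rotate []      v e = ≡.trans (≡.cong reduce (Listₚ.++-identityʳ v)) e
  reduce-rotate (x ∷ u) v e = ≡.trans (≡.cong reduce (≡.sym (Listₚ.++-assoc v (x ∷ []) u)))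
    (reduce-rotate u (v ++ x ∷ []) (≡.trans (≡.cong reduce (≡.sym (Listₚ.++-assoc u v (x ∷ [])))) last))
    where
    last : reduce ((u ++ v) ++ x ∷ []) ≡ []
    last = ≡.trans (reduce-++-congˡ {u ++ v} {flip x ∷ []} (x ∷ []) (reduce-flip x (u ++ v) [] e)) (push-flip-push x {[]} _)

  _≟ʷ_ : (u v : Word n) → Dec (u ≡ v)
  _≟ʷ_ = Listₚ.≡-dec (Productₚ.≡-dec Finₚ._≟_ Boolₚ._≟_)

  χ : Word n → Word n → ℚ
  χ v w = if does (reduce w ≟ʷ reduce v) then 1ℚ else 0ℚ

  Invariant : (Word n → ℚ) → Set
  Invariant φ = ∀ u v → reduce u ≡ reduce v → φ u ≡ φ v

  χ-invariant : ∀ v → Invariant (χ v)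
  χ-invariant v u u′ e = ≡.cong (λ w → if does (w ≟ʷ reduce v) then 1ℚ else 0ℚ) e

  χ-flip : ∀ x v w → χ v (x ∷ w) ≡ χ (flip x ∷ v) w
  χ-flip x v w = ≡.cong (if_then 1ℚ else 0ℚ)
    (does-⇔ (mk⇔ (reduce-flip x w v) (reduce-flip⁻¹ x w v)) (reduce (x ∷ w) ≟ʷ reduce v) (reduce w ≟ʷ reduce (flip x ∷ v)))

  χ-rotate : ∀ u v → χ [] (u ++ v) ≡ χ [] (v ++ u)
  χ-rotate u v = ≡.cong (if_then 1ℚ else 0ℚ)
    (does-⇔ (mk⇔ (reduce-rotate u v) (reduce-rotate v u)) (reduce (u ++ v) ≟ʷ []) (reduce (v ++ u) ≟ʷ []))

  -- Linear extension of φ to formal sums; coefficients, the trace functional and equality in ℚF are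
  -- all expressed through it.
  pair : QF n → (Word n → ℚ) → ℚ
  pair []            φ = 0ℚ
  pair ((q , w) ∷ a) φ = q *ᵒ φ w +ᵒ pair a φ

  pair-cong : ∀ a {φ ψ} → (∀ w → φ w ≡ ψ w) → pair a φ ≡ pair a ψ
  pair-cong []            e = ≡.refl
  pair-cong ((q , w) ∷ a) e = ≡.cong₂ (λ x y → q *ᵒ x +ᵒ y) (e w) (pair-cong a e)

  pair-++ : ∀ a b φ → pair (a ++ b) φ ≡ pair a φ +ᵒ pair b φ
  pair-++ []            b φ = ≡.sym (Q.+-identityˡ _)
  pair-++ ((q , w) ∷ a) b φ = ≡.trans (≡.cong (q *ᵒ φ w +ᵒ_) (pair-++ a b φ)) (≡.sym (Q.+-assoc (q *ᵒ φ w) (pair a φ) (pair b φ)))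

  pair-0 : ∀ a → pair a (λ _ → 0ℚ) ≡ 0ℚ
  pair-0 []            = ≡.refl
  pair-0 ((q , w) ∷ a) = ≡.trans (≡.cong₂ _+ᵒ_ (Q.zeroʳ q) (pair-0 a)) (Q.+-identityˡ 0ℚ)

  pair-+ : ∀ a φ ψ → pair a (λ w → φ w +ᵒ ψ w) ≡ pair a φ +ᵒ pair a ψ
  pair-+ []            φ ψ = ≡.sym (Q.+-identityˡ 0ℚ)
  pair-+ ((q , w) ∷ a) φ ψ = ≡.trans (≡.cong₂ _+ᵒ_ (Q.distribˡ q (φ w) (ψ w)) (pair-+ a φ ψ))
    (interchange (q *ᵒ φ w) (q *ᵒ ψ w) (pair a φ) (pair a ψ))
    where open import Algebra.Properties.CommutativeSemigroup Q.+-commutativeSemigroup using (interchange)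

  pair-* : ∀ a c φ → pair a (λ w → c *ᵒ φ w) ≡ c *ᵒ pair a φ
  pair-* []            c φ = ≡.sym (Q.zeroʳ c)
  pair-* ((q , w) ∷ a) c φ = ≡.trans (≡.cong₂ _+ᵒ_ (x∙yz≈y∙xz q c (φ w)) (pair-* a c φ)) (≡.sym (Q.distribˡ c (q *ᵒ φ w) (pair a φ)))
    where open import Algebra.Properties.CommutativeSemigroup Q.*-commutativeSemigroup using (x∙yz≈y∙xz)

  pair-swap : ∀ a b (φ : Word n → Word n → ℚ) → pair a (λ u → pair b (φ u)) ≡ pair b (λ v → pair a (λ u → φ u v))
  pair-swap []            b φ = ≡.sym (pair-0 b)
  pair-swap ((q , w) ∷ a) b φ = ≡.trans (≡.cong₂ _+ᵒ_ (≡.sym (pair-* b q (φ w))) (pair-swap a b φ))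
    (≡.sym (pair-+ b (λ v → q *ᵒ φ w v) (λ v → pair a (λ u → φ u v))))

  pair-single-*F : ∀ p u b φ → pair (((p , u) ∷ []) *F b) φ ≡ p *ᵒ pair b (λ v → φ (u ++ v))
  pair-single-*F p u []            φ = ≡.sym (Q.zeroʳ p)
  pair-single-*F p u ((q , v) ∷ b) φ = ≡.trans
    (≡.cong₂ _+ᵒ_ (≡.trans (≡.cong (_*ᵒ φ (u ++ v)) (≡.sym (*ᵒ≡* p q))) (Q.*-assoc p q (φ (u ++ v)))) (pair-single-*F p u b φ))
    (≡.sym (Q.distribˡ p (q *ᵒ φ (u ++ v)) (pair b (λ v → φ (u ++ v)))))

  *F-++ : ∀ (a a′ b : QF n) → (a ++ a′) *F b ≡ (a *F b) ++ (a′ *F b)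
  *F-++ a a′ b = Listₚ.concatMap-++ _ a a′

  pair-*F : ∀ a b φ → pair (a *F b) φ ≡ pair a (λ u → pair b (λ v → φ (u ++ v)))
  pair-*F []            b φ = ≡.refl
  pair-*F ((p , u) ∷ a) b φ = begin
    pair (((p , u) ∷ a) *F b) φ
      ≡⟨ ≡.cong (λ c → pair c φ) (*F-++ ((p , u) ∷ []) a b) ⟩
    pair ((((p , u) ∷ []) *F b) ++ (a *F b)) φ
      ≡⟨ pair-++ (((p , u) ∷ []) *F b) (a *F b) φ ⟩
    pair (((p , u) ∷ []) *F b) φ +ᵒ pair (a *F b) φ
      ≡⟨ ≡.cong₂ _+ᵒ_ (pair-single-*F p u b φ) (pair-*F a b φ) ⟩
    p *ᵒ pair b (λ v → φ (u ++ v)) +ᵒ pair a (λ u → pair b (λ v → φ (u ++ v))) ∎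
    where open ≡.≡-Reasoning

  coeff≡pair : ∀ a v → coeff a v ≡ pair a (χ v)
  coeff≡pair []            v = ≡.refl
  coeff≡pair ((q , w) ∷ a) v = ≡.trans (≡.sym (+ᵒ≡+ _ _)) (≡.cong₂ _+ᵒ_ (helper (does (reduce w ≟ʷ reduce v))) (coeff≡pair a v))
    where
    helper : ∀ b → (if b then q else 0ℚ) ≡ q *ᵒ (if b then 1ℚ else 0ℚ)
    helper true  = ≡.sym (Q.*-identityʳ q)
    helper false = ≡.sym (Q.zeroʳ q)

  negF : QF n → QF n
  negF = map (λ t → -ᵒ proj₁ t , proj₂ t)

  pair-neg : ∀ a φ → pair (negF a) φ ≡ -ᵒ pair a φ
  pair-neg []            φ = ≡.sym ε⁻¹≈ε
    where open import Algebra.Properties.AbelianGroup Q.+-abelianGroup using (ε⁻¹≈ε)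
  pair-neg ((q , w) ∷ a) φ = ≡.trans (≡.cong₂ _+ᵒ_ (≡.sym (-‿distribˡ-* q (φ w))) (pair-neg a φ))
    (⁻¹-∙-comm (q *ᵒ φ w) (pair a φ))
    where
    open import Algebra.Properties.AbelianGroup Q.+-abelianGroup using (⁻¹-∙-comm)
    open import Algebra.Properties.Ring ℚ-ring using (-‿distribˡ-*)

  -- Equality in ℚF, tested against all functions of the reduced word.
  infix 4 _≈F_
  _≈F_ : QF n → QF n → Set
  a ≈F b = ∀ φ → Invariant φ → pair a φ ≡ pair b φ

  -- Translates of an invariant function, and their combinations over an element of ℚF, are again
  -- invariant and may serve as test functions.
  *F-cong : ∀ {a a′ b b′} → a ≈F a′ → b ≈F b′ → a *F b ≈F a′ *F b′
  *F-cong {a} {a′} {b} {b′} e f φ inv = begin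
    pair (a *F b) φ                              ≡⟨ pair-*F a b φ ⟩
    pair a (λ u → pair b (λ v → φ (u ++ v)))     ≡⟨ pair-cong a (λ u → f _ (λ v v′ p → inv _ _ (reduce-++-congʳ u p))) ⟩
    pair a (λ u → pair b′ (λ v → φ (u ++ v)))    ≡⟨ e _ (λ u u′ p → pair-cong b′ (λ v → inv _ _ (reduce-++-congˡ {u} {u′} v p))) ⟩
    pair a′ (λ u → pair b′ (λ v → φ (u ++ v)))   ≡⟨ pair-*F a′ b′ φ ⟨
    pair (a′ *F b′) φ                            ∎
    where open ≡.≡-Reasoning

  pair-one : ∀ φ → pair oneF φ ≡ φ []
  pair-one φ = ≡.trans (Q.+-identityʳ _) (Q.*-identityˡ (φ []))

  groupAlgebra : Ring 0ℓ 0ℓ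
  groupAlgebra = record
    { Carrier = QF n
    ; _≈_ = _≈F_
    ; _+_ = _+F_
    ; _*_ = _*F_
    ; -_ = negF
    ; 0# = zeroF
    ; 1# = oneF
    ; isRing = record
      { +-isAbelianGroup = record
        { isGroup = record
          { isMonoid = record
            { isSemigroup = record
              { isMagma = record
                { isEquivalence = record
                  { refl = λ φ _ → ≡.refl
                  ; sym = λ e φ i → ≡.sym (e φ i)
                  ; trans = λ e f φ i → ≡.trans (e φ i) (f φ i)
                  }
                ; ∙-cong = λ {a} {a′} {b} {b′} e f φ i →
                    ≡.trans (pair-++ a b φ) (≡.trans (≡.cong₂ _+ᵒ_ (e φ i) (f φ i)) (≡.sym (pair-++ a′ b′ φ)))
                }
              ; assoc = λ a b c φ _ → ≡.cong (λ d → pair d φ) (Listₚ.++-assoc a b c)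
              }
            ; identity = (λ a φ _ → ≡.refl) , (λ a φ _ → ≡.cong (λ d → pair d φ) (Listₚ.++-identityʳ a))
            }
          ; inverse =
              (λ a φ _ → ≡.trans (pair-++ (negF a) a φ) (≡.trans (≡.cong (_+ᵒ pair a φ) (pair-neg a φ)) (Q.-‿inverseˡ (pair a φ)))) ,
              (λ a φ _ → ≡.trans (pair-++ a (negF a) φ) (≡.trans (≡.cong (pair a φ +ᵒ_) (pair-neg a φ)) (Q.-‿inverseʳ (pair a φ))))
          ; ⁻¹-cong = λ {a} {b} e φ i → ≡.trans (pair-neg a φ) (≡.trans (≡.cong -ᵒ_ (e φ i)) (≡.sym (pair-neg b φ)))
          }
        ; comm = λ a b φ _ → ≡.trans (pair-++ a b φ) (≡.trans (Q.+-comm (pair a φ) (pair b φ)) (≡.sym (pair-++ b a φ)))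
        }
      ; *-cong = λ {a} {a′} {b} {b′} → *F-cong {a} {a′} {b} {b′}
      ; *-assoc = λ a b c φ _ → assoc a b c φ
      ; *-identity =
          (λ a φ _ → ≡.trans (pair-*F oneF a φ) (pair-one (λ u → pair a (λ v → φ (u ++ v))))) ,
          (λ a φ _ → ≡.trans (pair-*F a oneF φ) (pair-cong a (λ u → ≡.trans (pair-one (λ v → φ (u ++ v))) (≡.cong φ (Listₚ.++-identityʳ u)))))
      ; distrib =
          (λ a b c φ _ → ≡.trans (pair-*F a (b ++ c) φ) (≡.trans (pair-cong a (λ u → pair-++ b c (λ v → φ (u ++ v))))
            (≡.trans (pair-+ a (λ u → pair b (λ v → φ (u ++ v))) (λ u → pair c (λ v → φ (u ++ v))))
            (≡.trans (≡.cong₂ _+ᵒ_ (≡.sym (pair-*F a b φ)) (≡.sym (pair-*F a c φ))) (≡.sym (pair-++ (a *F b) (a *F c) φ)))))) ,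
          (λ a b c φ _ → ≡.cong (λ d → pair d φ) (*F-++ b c a))
      }
    }
    where
    assoc : ∀ a b c φ → pair ((a *F b) *F c) φ ≡ pair (a *F (b *F c)) φ
    assoc a b c φ = begin
      pair ((a *F b) *F c) φ
        ≡⟨ pair-*F (a *F b) c φ ⟩
      pair (a *F b) (λ u → pair c (λ w → φ (u ++ w)))
        ≡⟨ pair-*F a b _ ⟩
      pair a (λ u → pair b (λ v → pair c (λ w → φ ((u ++ v) ++ w))))
        ≡⟨ pair-cong a (λ u → pair-cong b (λ v → pair-cong c (λ w → ≡.cong φ (Listₚ.++-assoc u v w)))) ⟩
      pair a (λ u → pair b (λ v → pair c (λ w → φ (u ++ (v ++ w)))))
        ≡⟨ pair-cong a (λ u → pair-*F b c (λ v → φ (u ++ v))) ⟨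
      pair a (λ u → pair (b *F c) (λ v → φ (u ++ v)))
        ≡⟨ pair-*F a (b *F c) φ ⟨
      pair (a *F (b *F c)) φ ∎
      where open ≡.≡-Reasoning

  pairing : ∀ φ → Invariant φ → Additive groupAlgebra ℚ-ring
  pairing φ inv = record { fun = λ a → pair a φ ; cong = λ e → e φ inv ; zer = ≡.refl ; add = λ a b → pair-++ a b φ }

  τ : Additive groupAlgebra ℚ-ring
  τ = pairing (χ []) (χ-invariant [])

  τ-cyclic : ∀ a b → Additive.fun τ (a *F b) ≡ Additive.fun τ (b *F a)
  τ-cyclic a b = begin
    pair (a *F b) (χ [])                          ≡⟨ pair-*F a b (χ []) ⟩
    pair a (λ u → pair b (λ v → χ [] (u ++ v)))   ≡⟨ pair-swap a b (λ u v → χ [] (u ++ v)) ⟩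
    pair b (λ v → pair a (λ u → χ [] (u ++ v)))   ≡⟨ pair-cong b (λ v → pair-cong a (λ u → χ-rotate u v)) ⟩
    pair b (λ v → pair a (λ u → χ [] (v ++ u)))   ≡⟨ pair-*F b a (χ []) ⟨
    pair (b *F a) (χ [])                          ∎
    where open ≡.≡-Reasoning

-- Powers and moments of bipartite block matrices

double : ℕ → ℕ
double zero    = zero
double (suc n) = suc (suc (double n))

module MatrixPowers (R : Ring 0ℓ 0ℓ) where
  open Ring R using (Carrier; 0#)
  open Matrices R
  private
    module R = Ring R
    module ΣR = SumLaws R
    module M I = Ring (ring I)

  infixr 8 _^^_
  _^^_ : ∀ {I} → Matrix I I → ℕ → Matrix I I
  _^^_ {I} Z zero    = ΣR.δ I
  _^^_     Z (suc k) = Z ⊡ Z ^^ k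

  ^^-cong : ∀ {I} {Y Z : Matrix I I} → Y ≋ Z → ∀ k → Y ^^ k ≋ Z ^^ k
  ^^-cong e zero    = λ i j → R.refl
  ^^-cong e (suc k) = ⊡-cong e (^^-cong e k)

  ^^-sandwich : ∀ {I J} (A : Matrix I J) (B : Matrix J I) k → (A ⊡ (B ⊡ A) ^^ k) ⊡ B ≋ (A ⊡ B) ^^ suc k
  ^^-sandwich {I} {J} A B zero    = M.trans I (⊡-cong {B = B} (⊡-identityʳ A) (λ _ _ → R.refl)) (M.sym I (⊡-identityʳ (A ⊡ B)))
  ^^-sandwich {I} {J} A B (suc k) =
    M.trans I (⊡-assoc A ((B ⊡ A) ⊡ Z) B)
    (M.trans I (⊡-cong {A = A} (λ _ _ → R.refl) (λ i j → R.trans (⊡-assoc (B ⊡ A) Z B i j) (⊡-assoc B A (Z ⊡ B) i j)))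
    (M.trans I (M.sym I (⊡-assoc A B (A ⊡ (Z ⊡ B))))
    (⊡-cong {A = A ⊡ B} (λ _ _ → R.refl) (M.trans I (M.sym I (⊡-assoc A Z B)) (^^-sandwich A B k)))))
    where
    Z : Matrix J J
    Z = (B ⊡ A) ^^ k

  module _ {I J : Ix} (A : Matrix I J) (B : Matrix J I) where

    bipartite : Matrix (I ⊕ J) (I ⊕ J)
    bipartite (inj₁ i) (inj₁ _) = 0#
    bipartite (inj₁ i) (inj₂ j) = A i j
    bipartite (inj₂ j) (inj₁ i) = B j i
    bipartite (inj₂ j) (inj₂ _) = 0#

    -- Powers of (0 A; B 0) alternate between block diagonal and block antidiagonal; `Even k` and
    -- `Odd k` describe the exponents 2k and 2k + 1.
    record Even (k : ℕ) (Z : Matrix (I ⊕ J) (I ⊕ J)) : Set where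
      field
        ll : ∀ i i′ → Z (inj₁ i) (inj₁ i′) R.≈ ((A ⊡ B) ^^ k) i i′
        lr : ∀ i j  → Z (inj₁ i) (inj₂ j) R.≈ 0#
        rl : ∀ j i  → Z (inj₂ j) (inj₁ i) R.≈ 0#
        rr : ∀ j j′ → Z (inj₂ j) (inj₂ j′) R.≈ ((B ⊡ A) ^^ k) j j′

    record Odd (k : ℕ) (Z : Matrix (I ⊕ J) (I ⊕ J)) : Set where
      field
        ll : ∀ i i′ → Z (inj₁ i) (inj₁ i′) R.≈ 0#
        lr : ∀ i j  → Z (inj₁ i) (inj₂ j) R.≈ (A ⊡ (B ⊡ A) ^^ k) i j
        rl : ∀ j i  → Z (inj₂ j) (inj₁ i) R.≈ (B ⊡ (A ⊡ B) ^^ k) j i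
        rr : ∀ j j′ → Z (inj₂ j) (inj₂ j′) R.≈ 0#

    private
      left : ∀ (Z : Matrix (I ⊕ J) (I ⊕ J)) i p → (bipartite ⊡ Z) (inj₁ i) p R.≈ ΣR.sum J (λ j → A i j R.* Z (inj₂ j) p)
      left Z i p = R.trans (R.+-congʳ (ΣR.sum-zero I (λ _ → R.zeroˡ _))) (R.+-identityˡ _)

      right : ∀ (Z : Matrix (I ⊕ J) (I ⊕ J)) j p → (bipartite ⊡ Z) (inj₂ j) p R.≈ ΣR.sum I (λ i → B j i R.* Z (inj₁ i) p)
      right Z j p = R.trans (R.+-congˡ (ΣR.sum-zero J (λ _ → R.zeroˡ _))) (R.+-identityʳ _)

      vanish : ∀ c (f : El c → Carrier) {g : El c → Carrier} → (∀ x → g x R.≈ 0#) → ΣR.sum c (λ x → f x R.* g x) R.≈ 0#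
      vanish c f e = ΣR.sum-zero c (λ x → R.trans (R.*-congˡ (e x)) (R.zeroʳ _))

    step-odd : ∀ {k Z} → Even k Z → Odd k (bipartite ⊡ Z)
    step-odd {k} {Z} e = record
      { ll = λ i i′ → R.trans (left Z i _) (vanish J (A i) (λ j → rl j i′))
      ; lr = λ i j → R.trans (left Z i _) (ΣR.sum-cong J (λ j′ → R.*-congˡ (rr j′ j)))
      ; rl = λ j i → R.trans (right Z j _) (ΣR.sum-cong I (λ i′ → R.*-congˡ (ll i′ i)))
      ; rr = λ j j′ → R.trans (right Z j _) (vanish I (B j) (λ i → lr i j′))
      }
      where open Even e

    step-even : ∀ {k Z} → Odd k Z → Even (suc k) (bipartite ⊡ Z)
    step-even {k} {Z} o = record
      { ll = λ i i′ → R.trans (left Z i _) (R.trans (ΣR.sum-cong J (λ j → R.*-congˡ (rl j i′)))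
               (R.sym (⊡-assoc A B ((A ⊡ B) ^^ k) i i′)))
      ; lr = λ i j → R.trans (left Z i _) (vanish J (A i) (λ j′ → rr j′ j))
      ; rl = λ j i → R.trans (right Z j _) (vanish I (B j) (λ i′ → ll i′ i))
      ; rr = λ j j′ → R.trans (right Z j _) (R.trans (ΣR.sum-cong I (λ i → R.*-congˡ (lr i j′)))
               (R.sym (⊡-assoc B A ((B ⊡ A) ^^ k) j j′)))
      }
      where open Odd o

    even : ∀ k → Even k (bipartite ^^ double k)
    even zero    = record { ll = λ _ _ → R.refl ; lr = λ _ _ → R.refl ; rl = λ _ _ → R.refl ; rr = λ _ _ → R.refl }
    even (suc k) = step-even (step-odd (even k))

    odd : ∀ k → Odd k (bipartite ^^ suc (double k))
    odd k = step-odd (even k)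

module Moments {R S : Ring 0ℓ 0ℓ} (t : Additive R S)
  (t-cyclic : ∀ x y → Ring._≈_ S (Additive.fun t (Ring._*_ R x y)) (Additive.fun t (Ring._*_ R y x))) where
  open Matrices R
  open MatrixPowers R
  open Trace t t-cyclic
  private
    module S = Ring S
    module ΣS = SumLaws S

  moment : ∀ {I} → Matrix I I → ℕ → S.Carrier
  moment {I} M k = tr I (M ^^ k)

  moment-cong : ∀ {I} {M M′ : Matrix I I} → M ≋ M′ → ∀ k → moment M k S.≈ moment M′ k
  moment-cong {I} e k = Additive.cong (tr-additive I) (^^-cong e k)

  moment-swap : ∀ {I J} (A : Matrix I J) (B : Matrix J I) k → moment (B ⊡ A) (suc k) S.≈ moment (A ⊡ B) (suc k)
  moment-swap {I} {J} A B k = S.trans (Additive.cong (tr-additive J) (⊡-assoc B A ((B ⊡ A) ^^ k)))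
    (S.trans (tr-cyclic B (A ⊡ (B ⊡ A) ^^ k)) (Additive.cong (tr-additive I) (^^-sandwich A B k)))

  -- The diagonal blocks are powers of A B and of B A, whose traces agree by cyclicity.
  moment-even : ∀ {I J} (A : Matrix I J) (B : Matrix J I) k →
    moment (bipartite A B) (double (suc k)) S.≈ moment (A ⊡ B) (suc k) S.+ moment (A ⊡ B) (suc k)
  moment-even {I} {J} A B k = S.+-cong
    (ΣS.sum-cong I (λ i → Additive.cong t (ll i i)))
    (S.trans (ΣS.sum-cong J (λ j → Additive.cong t (rr j j))) (moment-swap A B k))
    where open Even (even A B (suc k))

  moment-odd : ∀ {I J} (A : Matrix I J) (B : Matrix J I) k → moment (bipartite A B) (suc (double k)) S.≈ S.0#
  moment-odd {I} {J} A B k = S.trans (S.+-cong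
    (ΣS.sum-zero I (λ i → S.trans (Additive.cong t (ll i i)) (Additive.zer t)))
    (ΣS.sum-zero J (λ j → S.trans (Additive.cong t (rr j j)) (Additive.zer t)))) (S.+-identityˡ S.0#)
    where open Odd (odd A B k)

-- Splitting off first letters

module _ {n : ℕ} where
  private
    Λ = groupAlgebra {n}
    module ΣΛ = SumLaws Λ
    module ΣQ = SumLaws ℚ-ring
  open Matrices Λ
  open MatrixPowers Λ

  Step : Ix
  Step = fin 1 ⊕ letter n

  word : El Step → Word n
  word (inj₁ _) = []
  word (inj₂ x) = x ∷ []

  first : Word n → El Step
  first []      = inj₁ zero
  first (x ∷ _) = inj₂ x

  rest : Word n → Word n
  rest []      = []
  rest (_ ∷ w) = w

  word-rest : ∀ w → word (first w) ++ rest w ≡ w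
  word-rest []      = ≡.refl
  word-rest (_ ∷ _) = ≡.refl

  -- The terms beginning with step l, with that step removed; the empty word counts as beginning
  -- with `inj₁ zero`. Other terms stay with coefficient 0, which turns the sum over l into a δ-sum.
  derivative : El Step → QF n → QF n
  derivative l = map (λ t → ΣQ.δ Step (first (proj₂ t)) l *ᵒ proj₁ t , rest (proj₂ t))

  pair-derivative : ∀ a (φ : El Step → Word n → ℚ) →
    ΣQ.sum Step (λ l → pair (derivative l a) (φ l)) ≡ pair a (λ w → φ (first w) (rest w))
  pair-derivative []            φ = ΣQ.sum-0 Step
  pair-derivative ((q , w) ∷ a) φ = begin
    ΣQ.sum Step (λ l → ΣQ.δ Step (first w) l *ᵒ q *ᵒ φ l (rest w) +ᵒ pair (derivative l a) (φ l))
      ≡⟨ ΣQ.sum-+ Step (λ l → ΣQ.δ Step (first w) l *ᵒ q *ᵒ φ l (rest w)) (λ l → pair (derivative l a) (φ l)) ⟩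
    ΣQ.sum Step (λ l → ΣQ.δ Step (first w) l *ᵒ q *ᵒ φ l (rest w)) +ᵒ ΣQ.sum Step (λ l → pair (derivative l a) (φ l))
      ≡⟨ ≡.cong₂ _+ᵒ_ (≡.trans (ΣQ.sum-cong Step (λ l → Q.*-assoc (ΣQ.δ Step (first w) l) q (φ l (rest w))))
           (ΣQ.sum-δˡ Step (first w) (λ l → q *ᵒ φ l (rest w)))) (pair-derivative a φ) ⟩
    q *ᵒ φ (first w) (rest w) +ᵒ pair a (λ w → φ (first w) (rest w)) ∎
    where open ≡.≡-Reasoning

  Bounded : ℕ → QF n → Set
  Bounded b = All (λ t → length (proj₂ t) ℕ.≤ b)

  module _ {I : Ix} (M : Matrix I I) where

    firstMatrix : Matrix I (Step ⊗ I)
    firstMatrix i (l , i′) = if eqb I i i′ then (1ℚ , word l) ∷ [] else []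

    restMatrix : Matrix (Step ⊗ I) I
    restMatrix (l , i) j = derivative l (M i j)

    first-rest : firstMatrix ⊡ restMatrix ≋ M
    first-rest i j φ inv = begin
      pair (ΣΛ.sum Step (λ l → ΣΛ.sum I (λ i′ → firstMatrix i (l , i′) *F derivative l (M i′ j)))) φ
        ≡⟨ sum-hom (pairing φ inv) Step (λ l → ΣΛ.sum I (λ i′ → firstMatrix i (l , i′) *F derivative l (M i′ j))) ⟩
      ΣQ.sum Step (λ l → pair (ΣΛ.sum I (λ i′ → firstMatrix i (l , i′) *F derivative l (M i′ j))) φ)
        ≡⟨ ΣQ.sum-cong Step (λ l → sum-hom (pairing φ inv) I (λ i′ → firstMatrix i (l , i′) *F derivative l (M i′ j))) ⟩
      ΣQ.sum Step (λ l → ΣQ.sum I (λ i′ → pair (firstMatrix i (l , i′) *F derivative l (M i′ j)) φ))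
        ≡⟨ ΣQ.sum-cong Step (λ l → ΣQ.sum-cong I (λ i′ → term l i′)) ⟩
      ΣQ.sum Step (λ l → ΣQ.sum I (λ i′ → ΣQ.δ I i i′ *ᵒ pair (derivative l (M i′ j)) (λ v → φ (word l ++ v))))
        ≡⟨ ΣQ.sum-cong Step (λ l → ΣQ.sum-δˡ I i (λ i′ → pair (derivative l (M i′ j)) (λ v → φ (word l ++ v)))) ⟩
      ΣQ.sum Step (λ l → pair (derivative l (M i j)) (λ v → φ (word l ++ v)))
        ≡⟨ pair-derivative (M i j) (λ l v → φ (word l ++ v)) ⟩
      pair (M i j) (λ w → φ (word (first w) ++ rest w))
        ≡⟨ pair-cong (M i j) (λ w → ≡.cong φ (word-rest w)) ⟩
      pair (M i j) φ ∎
      where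
      open ≡.≡-Reasoning
      term : ∀ l i′ → pair (firstMatrix i (l , i′) *F derivative l (M i′ j)) φ ≡
              ΣQ.δ I i i′ *ᵒ pair (derivative l (M i′ j)) (λ v → φ (word l ++ v))
      term l i′ with eqb I i i′
      ... | true  = pair-single-*F 1ℚ (word l) (derivative l (M i′ j)) φ
      ... | false = ≡.sym (Q.zeroˡ (pair (derivative l (M i′ j)) (λ v → φ (word l ++ v))))

    doubled : Matrix (I ⊕ (Step ⊗ I)) (I ⊕ (Step ⊗ I))
    doubled = bipartite firstMatrix restMatrix

    -- `restMatrix` loses a letter from each nonempty word, while `firstMatrix` has words of length
    -- at most 1. The bound therefore descends as far as 1, where the tree argument takes over.
    doubled-bounded : ∀ {b} → (∀ i j → Bounded (suc (suc b)) (M i j)) → ∀ p q → Bounded (suc b) (doubled p q)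
    doubled-bounded h (inj₁ i) (inj₁ _) = []
    doubled-bounded {b} h (inj₁ i) (inj₂ (l , i′)) with eqb I i i′
    ... | true  = ℕₚ.≤-trans (short l) (s≤s z≤n) ∷ []
      where
      short : ∀ l → length (word l) ℕ.≤ 1
      short (inj₁ _) = z≤n
      short (inj₂ _) = s≤s z≤n
    ... | false = []
    doubled-bounded {b} h (inj₂ (l , i)) (inj₁ j) = go (h i j)
      where
      shorter : ∀ w → length w ℕ.≤ suc (suc b) → length (rest w) ℕ.≤ suc b
      shorter []      p       = z≤n
      shorter (_ ∷ w) (s≤s p) = p
      go : ∀ {a} → Bounded (suc (suc b)) a → Bounded (suc b) (derivative l a)
      go []                 = []
      go (_∷_ {x = t} p ps) = shorter (proj₂ t) p ∷ go ps
    doubled-bounded h (inj₂ _) (inj₂ _) = []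

-- Substituting t² for t

module Parity {A : CommutativeRing 0ℓ 0ℓ} (dom : DecDomain A) where
  open CommutativeRing A hiding (zero)
  open Series A
  open Polynomials dom
  private
    module R = CommutativeRing ser
    module Alg = Algebraicity polynomials
    module ΣR = RangeSums R.ring
    open import Algebra.Properties.Semiring.Exp R.semiring using (_^_)
  open import Relation.Binary.Reasoning.Setoid setoid

  evenPart oddPart : Ser → Ser
  evenPart f n = f (double n)
  oddPart  f n = f (suc (double n))

  -- f(t) ↦ f(t²)
  dilate : Ser → Ser
  dilate f zero          = f 0
  dilate f (suc zero)    = 0#
  dilate f (suc (suc n)) = dilate (tail f) n

  even-dilate : ∀ f → evenPart (dilate f) ≐ f
  even-dilate f zero    = refl
  even-dilate f (suc n) = even-dilate (tail f) n

  odd-dilate : ∀ f n → oddPart (dilate f) n ≈ 0#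
  odd-dilate f zero    = refl
  odd-dilate f (suc n) = odd-dilate (tail f) n

  parity-ext : ∀ {f g} → evenPart f ≐ evenPart g → oddPart f ≐ oddPart g → f ≐ g
  parity-ext e o zero          = e 0
  parity-ext e o (suc zero)    = o 0
  parity-ext {f} {g} e o (suc (suc n)) = parity-ext {tail (tail f)} {tail (tail g)} (e ∘ suc) (o ∘ suc) n

  even-⋆-dilate : ∀ f g → evenPart (f ⋆ dilate g) ≐ evenPart f ⋆ g
  even-⋆-dilate f g zero    = refl
  even-⋆-dilate f g (suc n) = +-cong (*-congˡ (even-dilate (tail g) n)) (trans
    (+-cong (trans (*-congˡ (odd-dilate g n)) (zeroʳ _)) (even-⋆-dilate (tail (tail f)) g n)) (+-identityˡ _))

  odd-⋆-dilate : ∀ f g → oddPart (f ⋆ dilate g) ≐ oddPart f ⋆ g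
  odd-⋆-dilate f g n = trans (+-cong (trans (*-congˡ (odd-dilate g n)) (zeroʳ _)) (even-⋆-dilate (tail f) g n)) (+-identityˡ _)

  dilate-⋆ : ∀ f g → dilate f ⋆ dilate g ≐ dilate (f ⋆ g)
  dilate-⋆ f g = parity-ext
    (λ n → trans (even-⋆-dilate (dilate f) g n) (trans (⋆-cong {g = g} (even-dilate f) (λ _ → refl) n) (sym (even-dilate (f ⋆ g) n))))
    (λ n → trans (odd-⋆-dilate (dilate f) g n) (trans (⋆-zeroˡ g (odd-dilate f) n) (sym (odd-dilate (f ⋆ g) n))))

  dilate-^ : ∀ f k → dilate f ^ k ≐ dilate (f ^ k)
  dilate-^ f zero    = parity-ext (λ { zero → refl ; (suc n) → sym (even-dilate (con 1#) (suc n)) }) (λ n → sym (odd-dilate (con 1#) n))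
  dilate-^ f (suc k) = R.trans (R.*-congˡ {dilate f} (dilate-^ f k)) (dilate-⋆ f (f ^ k))

  n≤double : ∀ n → n ℕ.≤ double n
  n≤double zero    = z≤n
  n≤double (suc n) = s≤s (ℕₚ.m≤n⇒m≤1+n (n≤double n))

  even-Poly : ∀ {f} → Poly f → Poly (evenPart f)
  even-Poly (Df , b , e) = (λ i → Df (double i)) , b , λ i p → e (double i) (ℕₚ.≤-trans p (n≤double i))

  odd-Poly : ∀ {f} → Poly f → Poly (oddPart f)
  odd-Poly (Df , b , e) = (λ i → Df (suc (double i))) , b , λ i p → e (suc (double i)) (ℕₚ.m≤n⇒m≤1+n (ℕₚ.≤-trans p (n≤double i)))

  -- Serves both parities: `p` selects the even or the odd coefficients, and a factor that is a
  -- series in t² passes through the selection.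
  restrict : ∀ (p : ℕ → ℕ) → (∀ f g → (f ⋆ dilate g) ∘ p ≐ (f ∘ p) ⋆ g) → ∀ n (q g : ℕ → Ser) i →
             ΣR.Σ< n (λ k → (q k ∘ p) ⋆ g k) i ≈ ΣR.Σ< n (λ k → q k ⋆ dilate (g k)) (p i)
  restrict p h zero    q g i = refl
  restrict p h (suc n) q g i = +-cong (sym (h (q 0) (g 0) i)) (restrict p h n (q ∘ suc) (g ∘ suc) i)

  powers : ∀ {f} n (q : ℕ → Ser) → ΣR.Σ< n (λ k → q k ⋆ dilate (f ^ k)) ≐ ΣR.Σ< n (λ k → q k ⋆ (dilate f ^ k))
  powers {f} n q = ΣR.Σ<-cong n (λ k _ → R.*-congˡ {q k} (R.sym (dilate-^ f k)))

  -- A relation for f(t²) splits according to the parity of the exponents of its coefficients.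
  algebraic-dilate : ∀ {f} → Alg.Algebraic (dilate f) → Alg.Algebraic f
  algebraic-dilate {f} (n , q , Pq , (k , k<n , nz) , r) with DecDomain.zero? polynomials (even-Poly (Pq k))
  ... | no nz′ = n , evenPart ∘ q , even-Poly ∘ Pq , (k , k<n , nz′) ,
        λ i → trans (restrict double even-⋆-dilate n q (f ^_) i) (trans (powers n q (double i)) (r (double i)))
  ... | yes z  = n , oddPart ∘ q , odd-Poly ∘ Pq , (k , k<n , λ z′ → nz (parity-ext z z′)) ,
        λ i → trans (restrict (suc ∘ double) odd-⋆-dilate n q (f ^_) i) (trans (powers n q (suc (double i))) (r (suc (double i))))

  nat-double : ∀ n → nat (double n) ≈ nat n + nat n
  nat-double zero    = sym (+-identityˡ _)
  nat-double (suc n) = trans (+-congˡ (+-congˡ (nat-double n)))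
    (trans (+-congˡ (trans (sym (+-assoc _ _ _)) (trans (+-congʳ (+-comm _ _)) (+-assoc _ _ _)))) (sym (+-assoc _ _ _)))

  -- θ applied to f(t²) is 2 (θf)(t²). The factor 2 is matched by the two diagonal blocks of equal
  -- trace, hence the even part g + g of h.
  θ-dilate : ∀ {f g h} → θ f ≐ g ⋆ f → evenPart h ≐ g ⊹ g → (∀ n → oddPart h n ≈ 0#) → θ (dilate f) ≐ h ⋆ dilate f
  θ-dilate {f} {g} {h} e he ho = parity-ext evens odds
    where
    evens : evenPart (θ (dilate f)) ≐ evenPart (h ⋆ dilate f)
    evens n = begin
      nat (double n) * dilate f (double n)  ≈⟨ *-cong (nat-double n) (even-dilate f n) ⟩
      (nat n + nat n) * f n                 ≈⟨ distribʳ _ _ _ ⟩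
      θ f n + θ f n                         ≈⟨ +-cong (e n) (e n) ⟩
      (g ⋆ f) n + (g ⋆ f) n                 ≈⟨ ⋆-distribʳ f g g n ⟨
      ((g ⊹ g) ⋆ f) n                       ≈⟨ ⋆-cong {g = f} he (λ _ → refl) n ⟨
      (evenPart h ⋆ f) n                    ≈⟨ even-⋆-dilate h f n ⟨
      (h ⋆ dilate f) (double n)             ∎
    odds : oddPart (θ (dilate f)) ≐ oddPart (h ⋆ dilate f)
    odds n = trans (trans (*-congˡ (odd-dilate f n)) (zeroʳ _)) (sym (trans (odd-⋆-dilate h f n) (⋆-zeroˡ f ho n)))

-- The exponential series and its differential equation

module ExponentialRule (R : CommutativeRing 0ℓ 0ℓ) (θ-additive : Additive (CommutativeRing.ring R) (CommutativeRing.ring R))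
  (θ-leibniz : ∀ x y → CommutativeRing._≈_ R (Additive.fun θ-additive (CommutativeRing._*_ R x y))
    (CommutativeRing._+_ R (CommutativeRing._*_ R (Additive.fun θ-additive x) y) (CommutativeRing._*_ R x (Additive.fun θ-additive y)))) where
  open CommutativeRing R hiding (zero)
  open Additive θ-additive using () renaming (fun to θ; cong to θ-cong; add to θ-+)
  open RangeSums ring
  open import Algebra.Properties.Semiring.Exp semiring using (_^_)
  open import Algebra.Solver.Ring.NaturalCoefficients.Default commutativeSemiring using (solve; _:=_; _:+_; _:*_)
  open import Relation.Binary.Reasoning.Setoid setoid

  -- In the application `ν n` is n and `r n` is 1/n!, as constant series.
  module _ (ν r : ℕ → Carrier) (ν-0 : ν 0 ≈ 0#) (ν-suc : ∀ n → ν (suc n) ≈ 1# + ν n)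
    (θ-r : ∀ n → θ (r n) ≈ 0#) (ν-r : ∀ n → ν (suc n) * r (suc n) ≈ r n) (x : Carrier) where

    θ-^ : ∀ n → θ (x ^ suc n) ≈ ν (suc n) * (x ^ n * θ x)
    θ-^ zero = begin
      θ (x * 1#)                    ≈⟨ θ-cong (*-identityʳ x) ⟩
      θ x                           ≈⟨ trans (*-identityˡ _) (*-identityˡ _) ⟨
      1# * (1# * θ x)               ≈⟨ *-congʳ (trans (ν-suc 0) (trans (+-congˡ ν-0) (+-identityʳ 1#))) ⟨
      ν 1 * (1# * θ x)              ∎
    θ-^ (suc n) = begin
      θ (x * x ^ suc n)                                          ≈⟨ θ-leibniz _ _ ⟩
      θ x * x ^ suc n + x * θ (x ^ suc n)                        ≈⟨ +-congˡ (*-congˡ (θ-^ n)) ⟩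
      θ x * x ^ suc n + x * (ν (suc n) * (x ^ n * θ x))          ≈⟨ +-congʳ (*-identityˡ _) ⟨
      1# * (θ x * x ^ suc n) + x * (ν (suc n) * (x ^ n * θ x))
        ≈⟨ solve 5 (λ o t x p v → o :* (t :* (x :* p)) :+ x :* (v :* (p :* t)) := (o :+ v) :* (x :* p :* t)) refl 1# (θ x) x (x ^ n) (ν (suc n)) ⟩
      (1# + ν (suc n)) * (x * x ^ n * θ x)                       ≈⟨ *-congʳ (ν-suc (suc n)) ⟨
      ν (suc (suc n)) * (x ^ suc n * θ x)                        ∎

    truncated : ℕ → Carrier
    truncated n = Σ< n (λ m → r m * x ^ m)

    -- The derivative of x^(n+1)/(n+1)! is θx times x^n/n!, so differentiation shortens the
    -- truncated exponential by one term.
    θ-truncated : ∀ n → θ (truncated (suc n)) ≈ θ x * truncated n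
    θ-truncated zero = begin
      θ (r 0 * 1# + 0#)          ≈⟨ θ-cong (trans (+-identityʳ _) (*-identityʳ _)) ⟩
      θ (r 0)                    ≈⟨ θ-r 0 ⟩
      0#                         ≈⟨ zeroʳ _ ⟨
      θ x * 0#                   ∎
    θ-truncated (suc n) = begin
      θ (truncated (suc (suc n)))
        ≈⟨ θ-cong (Σ<-snoc (suc n) (λ m → r m * x ^ m)) ⟩
      θ (truncated (suc n) + r (suc n) * x ^ suc n)
        ≈⟨ θ-+ _ _ ⟩
      θ (truncated (suc n)) + θ (r (suc n) * x ^ suc n)
        ≈⟨ +-cong (θ-truncated n) (trans (θ-leibniz _ _) (trans (+-congʳ (trans (*-congʳ (θ-r (suc n))) (zeroˡ _))) (+-identityˡ _))) ⟩
      θ x * truncated n + r (suc n) * θ (x ^ suc n)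
        ≈⟨ +-congˡ (*-congˡ (θ-^ n)) ⟩
      θ x * truncated n + r (suc n) * (ν (suc n) * (x ^ n * θ x))
        ≈⟨ +-congˡ (solve 4 (λ r v p t → r :* (v :* (p :* t)) := t :* (v :* r :* p)) refl (r (suc n)) (ν (suc n)) (x ^ n) (θ x)) ⟩
      θ x * truncated n + θ x * (ν (suc n) * r (suc n) * x ^ n)
        ≈⟨ +-congˡ (*-congˡ (*-congʳ (ν-r n))) ⟩
      θ x * truncated n + θ x * (r n * x ^ n)
        ≈⟨ distribˡ _ _ _ ⟨
      θ x * (truncated n + r n * x ^ n)
        ≈⟨ *-congˡ (Σ<-snoc n (λ m → r m * x ^ m)) ⟨
      θ x * truncated (suc n) ∎

private
  module S = Series rationalRing
  module R = CommutativeRing S.ser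
  module ΣQ = RangeSums ℚ-ring
  module ΣR = RangeSums R.ring
  open import Algebra.Properties.Semiring.Exp R.semiring using (_^_)

rationals : DecDomain rationalRing
rationals = record
  { D = λ _ → ⊤ ; D-0 = tt ; D-1 = tt ; D-+ = λ _ _ → tt ; D-* = λ _ _ → tt ; D-neg = λ _ → tt
  ; zero? = λ {x} _ → x ℚ.≟ 0ℚ
  ; 1≉0 = λ ()
  ; domain = λ {x} {y} _ _ → nonzero x y
  }
  where
  nonzero : ∀ x y → ¬ x ≡ 0ℚ → ¬ y ≡ 0ℚ → ¬ x *ᵒ y ≡ 0ℚ
  nonzero x y x≢0 y≢0 e = y≢0 (begin
    y                        ≡⟨ ℚₚ.*-identityˡ y ⟨
    1ℚ ℚ.* y                 ≡⟨ ≡.cong (ℚ._* y) (ℚₚ.*-inverseˡ x) ⟨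
    ℚ.1/ x ℚ.* x ℚ.* y       ≡⟨ ℚₚ.*-assoc (ℚ.1/ x) x y ⟩
    ℚ.1/ x ℚ.* (x ℚ.* y)     ≡⟨ ≡.cong (ℚ.1/ x ℚ.*_) (≡.trans (≡.sym (*ᵒ≡* x y)) e) ⟩
    ℚ.1/ x ℚ.* 0ℚ            ≡⟨ ℚₚ.*-zeroʳ (ℚ.1/ x) ⟩
    0ℚ                       ∎)
    where
    open ≡.≡-Reasoning
    instance _ = ℚ.≢-nonZero x≢0

private
  module P = Polynomials rationals
  module Alg = Algebraicity P.polynomials
  module NN = NearestNeighbour rationals (λ _ → tt)
  module Par = Parity rationals

nat-toℚᵘ : ∀ n → ℚ.toℚᵘ (S.nat n) ℚᵘ.≃ mkℚᵘ (+ n) 0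
nat-toℚᵘ zero    = *≡* ≡.refl
nat-toℚᵘ (suc n) = ℚᵘₚ.≃-trans (ℚₚ.toℚᵘ-cong (+ᵒ≡+ 1ℚ (S.nat n))) (ℚᵘₚ.≃-trans (ℚₚ.toℚᵘ-homo-+ 1ℚ (S.nat n)) (ℚᵘₚ.≃-trans (ℚᵘₚ.+-congʳ (ℚ.toℚᵘ 1ℚ) (nat-toℚᵘ n))
  (*≡* (≡.cong (λ i → ((+ 1) ℤ.+ i) ℤ.* (+ 1)) (ℤₚ.*-identityʳ (+ n))))))

-- Used with b = m! for (m + 1)/(m + 1)! = 1/m! and with b = 1 for (a + 1)/(a + 1) = 1. The check
-- takes place on unnormalised fractions, where no gcd intervenes.
nat-recip : ∀ a b .{{_ : NonZero b}} .{{_ : NonZero (suc a ℕ.* b)}} → S.nat (suc a) *ᵒ (+ 1 / (suc a ℕ.* b)) ≡ + 1 / b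
nat-recip a (suc b) = ℚₚ.toℚᵘ-injective (begin
  ℚ.toℚᵘ (S.nat (suc a) *ᵒ (+ 1 / (suc a ℕ.* suc b)))
    ≈⟨ ℚᵘₚ.≃-trans (ℚₚ.toℚᵘ-cong (*ᵒ≡* (S.nat (suc a)) (+ 1 / (suc a ℕ.* suc b)))) (ℚₚ.toℚᵘ-homo-* (S.nat (suc a)) (+ 1 / (suc a ℕ.* suc b))) ⟩
  ℚ.toℚᵘ (S.nat (suc a)) ℚᵘ.* ℚ.toℚᵘ (+ 1 / (suc a ℕ.* suc b))
    ≈⟨ ℚᵘₚ.*-cong (nat-toℚᵘ (suc a)) (ℚₚ.toℚᵘ-fromℚᵘ (mkℚᵘ (+ 1) (b ℕ.+ a ℕ.* suc b))) ⟩
  mkℚᵘ (+ suc a) 0 ℚᵘ.* mkℚᵘ (+ 1) (b ℕ.+ a ℕ.* suc b)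
    ≈⟨ *≡* (≡.cong +_ (ℕ-eq a b)) ⟩
  mkℚᵘ (+ 1) b
    ≈⟨ ℚₚ.toℚᵘ-fromℚᵘ (mkℚᵘ (+ 1) b) ⟨
  ℚ.toℚᵘ (+ 1 / suc b) ∎)
  where
  open import Relation.Binary.Reasoning.Setoid ℚᵘₚ.≃-setoid
  ℕ-eq : ∀ a b → suc a ℕ.* 1 ℕ.* suc b ≡ 1 ℕ.* (1 ℕ.* (suc a ℕ.* suc b))
  ℕ-eq a b = ≡.trans (≡.cong (ℕ._* suc b) (ℕₚ.*-identityʳ (suc a)))
    (≡.sym (≡.trans (ℕₚ.*-identityˡ (1 ℕ.* (suc a ℕ.* suc b))) (ℕₚ.*-identityˡ (suc a ℕ.* suc b))))

nat-/ : ∀ a x → S.nat (suc a) *ᵒ (x *ᵒ (+ 1 / suc a)) ≡ x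
nat-/ a x = begin
  S.nat (suc a) *ᵒ (x *ᵒ (+ 1 / suc a))    ≡⟨ x∙yz≈y∙xz (S.nat (suc a)) x (+ 1 / suc a) ⟩
  x *ᵒ (S.nat (suc a) *ᵒ (+ 1 / suc a))    ≡⟨ ≡.cong (x *ᵒ_) unit ⟩
  x *ᵒ 1ℚ                                   ≡⟨ Q.*-identityʳ x ⟩
  x                                          ∎
  where
  open ≡.≡-Reasoning
  open import Algebra.Properties.CommutativeSemigroup Q.*-commutativeSemigroup using (x∙yz≈y∙xz)
  unit : S.nat (suc a) *ᵒ (+ 1 / suc a) ≡ 1ℚ
  unit = ≡.trans (≡.cong (λ m → S.nat (suc a) *ᵒ (+ 1 / suc m)) (≡.sym (ℕₚ.*-identityʳ a))) (nat-recip a 1)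

nat-cancel : ∀ a x → S.nat (suc a) *ᵒ x ≡ 0ℚ → x ≡ 0ℚ
nat-cancel a x e = ≡.trans (≡.sym (nat-/ a x)) (≡.trans (≡.sym (Q.*-assoc (S.nat (suc a)) x (+ 1 / suc a)))
  (≡.trans (≡.cong (_*ᵒ (+ 1 / suc a)) e) (Q.zeroˡ (+ 1 / suc a))))

sumℚ-applyUpTo : ∀ n (f : ℕ → ℚ) (g : ℕ → ℕ) → sumℚ (map f (applyUpTo g n)) ≡ ΣQ.Σ< n (f ∘ g)
sumℚ-applyUpTo zero    f g = ≡.refl
sumℚ-applyUpTo (suc n) f g = ≡.trans (≡.sym (+ᵒ≡+ _ _)) (≡.cong (f (g 0) +ᵒ_) (sumℚ-applyUpTo n f (g ∘ suc)))

*P≐⋆ : ∀ f g → f *P g S.≐ f S.⋆ g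
*P≐⋆ f g k = ≡.trans (sumℚ-applyUpTo (suc k) (λ i → f i ℚ.* g (k ℕ.∸ i)) (λ i → i))
  (≡.trans (ΣQ.Σ<-cong (suc k) (λ i _ → ≡.sym (*ᵒ≡* (f i) (g (k ℕ.∸ i))))) (cauchy f k))
  where
  cauchy : ∀ f k → ΣQ.Σ< (suc k) (λ i → f i *ᵒ g (k ℕ.∸ i)) ≡ (f S.⋆ g) k
  cauchy f zero    = Q.+-identityʳ (f 0 *ᵒ g 0)
  cauchy f (suc k) = ≡.cong (f 0 *ᵒ g (suc k) +ᵒ_) (cauchy (S.tail f) k)

^P≐^ : ∀ f m → f ^P m S.≐ f ^ m
^P≐^ f zero zero    = ≡.refl
^P≐^ f zero (suc k) = ≡.refl
^P≐^ f (suc m) k = ≡.trans (*P≐⋆ f (f ^P m) k) (S.⋆-cong {f} (λ _ → ≡.refl) (^P≐^ f m) k)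

module _ (L : PS) (L₀ : L 0 ≡ 0ℚ) where
  private
    recip : ℕ → ℚ
    recip m = (+ 1 / (m !)) {{m ℕₚ.!≢0}}

    r : ℕ → S.Ser
    r m = S.con (recip m)

    ν : ℕ → S.Ser
    ν m = S.con (S.nat m)

    ν-r : ∀ m → ν (suc m) R.* r (suc m) R.≈ r m
    ν-r m zero    = nat-recip m (m !) {{m ℕₚ.!≢0}} {{suc m ℕₚ.!≢0}}
    ν-r m (suc k) = ≡.trans (S.con-⋆ (S.nat (suc m)) (r (suc m)) (suc k)) (Q.zeroʳ (S.nat (suc m)))

    ν-suc : ∀ m → ν (suc m) R.≈ R.1# R.+ ν m
    ν-suc m zero    = ≡.refl
    ν-suc m (suc k) = ≡.sym (Q.+-identityˡ 0ℚ)

    ν-0 : ν 0 R.≈ R.0#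
    ν-0 zero    = ≡.refl
    ν-0 (suc k) = ≡.refl

    open ExponentialRule S.ser S.θ-additive S.θ-leibniz

    approx : ℕ → S.Ser
    approx = truncated ν r ν-0 ν-suc (λ m → S.θ-con (recip m)) ν-r L

    θ-approx : ∀ n → S.θ (approx (suc n)) R.≈ S.θ L R.* approx n
    θ-approx = θ-truncated ν r ν-0 ν-suc (λ m → S.θ-con (recip m)) ν-r L

    power-vanish : ∀ m k → k ℕ.< m → (L ^ m) k ≡ 0ℚ
    power-vanish (suc m) zero    p       = ≡.trans (≡.cong (_*ᵒ (L ^ m) 0) L₀) (Q.zeroˡ ((L ^ m) 0))
    power-vanish (suc m) (suc k) (s≤s p) = ≡.trans (≡.cong₂ _+ᵒ_
      (≡.trans (≡.cong (_*ᵒ (L ^ m) (suc k)) L₀) (Q.zeroˡ ((L ^ m) (suc k))))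
      (≡.trans (S.⋆-cong≤ k {S.tail L} {S.tail L} {L ^ m} {R.0#} (λ _ _ → ≡.refl) (λ i q → power-vanish m i (ℕₚ.≤-<-trans q p)))
        (R.zeroʳ (S.tail L) k))) (Q.+-identityˡ 0ℚ)

    Σ<-extend-zero : ∀ a b f → (∀ m → a ℕ.≤ m → f m ≡ 0ℚ) → ΣQ.Σ< (a ℕ.+ b) f ≡ ΣQ.Σ< a f
    Σ<-extend-zero zero    b f z = ΣQ.Σ<-zero b (λ m _ → z m z≤n)
    Σ<-extend-zero (suc a) b f z = ≡.cong (f 0 +ᵒ_) (Σ<-extend-zero a b (f ∘ suc) (λ m p → z (suc m) (s≤s p)))

    Σ<-coef : ∀ n (f : ℕ → S.Ser) k → ΣR.Σ< n f k ≡ ΣQ.Σ< n (λ m → f m k)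
    Σ<-coef zero    f k = ≡.refl
    Σ<-coef (suc n) f k = ≡.cong (f 0 k +ᵒ_) (Σ<-coef n (f ∘ suc) k)

    -- L has no constant term, so L^m begins in degree m or later and the terms with m > k do not
    -- reach the coefficient of t^k.
    expP-approx : ∀ n k → k ℕ.< n → expP L k ≡ approx n k
    expP-approx n k k<n = begin
      expP L k
        ≡⟨ sumℚ-applyUpTo (suc k) (λ m → (L ^P m) k ℚ.* recip m) (λ i → i) ⟩
      ΣQ.Σ< (suc k) (λ m → (L ^P m) k ℚ.* recip m)
        ≡⟨ ΣQ.Σ<-cong (suc k) (λ m _ → term m) ⟩
      ΣQ.Σ< (suc k) (λ m → (r m S.⋆ (L ^ m)) k)
        ≡⟨ Σ<-extend-zero (suc k) (n ℕ.∸ suc k) (λ m → (r m S.⋆ (L ^ m)) k) (λ m p → ≡.trans (S.con-⋆ (recip m) (L ^ m) k)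
             (≡.trans (≡.cong (recip m *ᵒ_) (power-vanish m k p)) (Q.zeroʳ (recip m)))) ⟨
      ΣQ.Σ< (suc k ℕ.+ (n ℕ.∸ suc k)) (λ m → (r m S.⋆ (L ^ m)) k)
        ≡⟨ ≡.cong (λ j → ΣQ.Σ< j (λ m → (r m S.⋆ (L ^ m)) k)) (ℕₚ.m+[n∸m]≡n k<n) ⟩
      ΣQ.Σ< n (λ m → (r m S.⋆ (L ^ m)) k)
        ≡⟨ Σ<-coef n (λ m → r m S.⋆ (L ^ m)) k ⟨
      approx n k ∎
      where
      open ≡.≡-Reasoning
      term : ∀ m → (L ^P m) k ℚ.* recip m ≡ (r m S.⋆ (L ^ m)) k
      term m = ≡.trans (≡.sym (*ᵒ≡* _ _)) (≡.trans (≡.cong (_*ᵒ recip m) (^P≐^ L m k)) (≡.trans (Q.*-comm ((L ^ m) k) (recip m)) (≡.sym (S.con-⋆ (recip m) (L ^ m) k))))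

  θ-expP : S.θ (expP L) S.≐ S.θ L S.⋆ expP L
  θ-expP k = ≡.trans (≡.cong (S.nat k *ᵒ_) (expP-approx (suc k) k (ℕₚ.n<1+n k)))
    (≡.trans (θ-approx k k) (helper k))
    where
    -- `approx k` agrees with the exponential only below degree k. Its coefficient k is multiplied
    -- by the constant term of θL, which is 0.
    helper : ∀ k → (S.θ L S.⋆ approx k) k ≡ (S.θ L S.⋆ expP L) k
    helper zero    = ≡.trans (≡.cong (_*ᵒ approx 0 0) (Q.zeroˡ (L 0)))
      (≡.trans (Q.zeroˡ (approx 0 0)) (≡.sym (≡.trans (≡.cong (_*ᵒ expP L 0) (Q.zeroˡ (L 0))) (Q.zeroˡ (expP L 0)))))
    helper (suc k) = ≡.cong₂ _+ᵒ_
      (≡.trans (≡.cong (_*ᵒ approx (suc k) (suc k)) (Q.zeroˡ (L 0))) (≡.trans (Q.zeroˡ (approx (suc k) (suc k)))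
        (≡.sym (≡.trans (≡.cong (_*ᵒ expP L (suc k)) (Q.zeroˡ (L 0))) (Q.zeroˡ (expP L (suc k)))))))
      (S.⋆-cong≤ k {S.tail (S.θ L)} {S.tail (S.θ L)} {approx (suc k)} {expP L} (λ _ _ → ≡.refl)
        (λ i p → ≡.sym (expP-approx (suc k) i (s≤s p))))

-- The induction on word length

module _ {n : ℕ} where
  private
    Λ : Ring 0ℓ 0ℓ
    Λ = groupAlgebra {n}
    module ΣΛ = SumLaws Λ
    module ΣI = SumLaws ℚ-ring
    open Matrices Λ
    open MatrixPowers Λ using (_^^_)
    open Moments (τ {n}) τ-cyclic

  -- Index 0 is set to 0, where `moment M 0` would be the trace of the identity, because θ log P has
  -- no constant term.
  momentSeries : ∀ {I} → Matrix I I → PS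
  momentSeries M zero    = 0ℚ
  momentSeries M (suc k) = moment M (suc k)

  pair-cong-All : ∀ {P : Word n → Set} {a φ ψ} → All (λ t → P (proj₂ t)) a → (∀ w → P w → φ w ≡ ψ w) → pair a φ ≡ pair a ψ
  pair-cong-All []                     e = ≡.refl
  pair-cong-All (_∷_ {x = q , w} p ps) e = ≡.cong₂ (λ x y → q *ᵒ x +ᵒ y) (e w p) (pair-cong-All ps e)

  mass : El (Step {n}) → QF n → ℚ
  mass l a = pair (derivative l a) (λ _ → 1ℚ)

  -- Nothing remains of a word of length at most 1 after its first step, so only the total
  -- coefficient `mass l` of each step matters.
  pair-short : ∀ {a} → Bounded 1 a → ∀ φ → pair a φ ≡ ΣI.sum Step (λ l → mass l a *ᵒ φ (word l))
  pair-short {a} short φ = begin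
    pair a φ
      ≡⟨ pair-cong a (λ w → ≡.cong φ (≡.sym (word-rest w))) ⟩
    pair a (λ w → φ (word (first w) ++ rest w))
      ≡⟨ pair-derivative a (λ l v → φ (word l ++ v)) ⟨
    ΣI.sum Step (λ l → pair (derivative l a) (λ v → φ (word l ++ v)))
      ≡⟨ ΣI.sum-cong Step (λ l → ≡.trans (pair-cong-All {φ = λ v → φ (word l ++ v)} {λ _ → φ (word l) *ᵒ 1ℚ} (empty l short) (λ { [] _ → at l })) (pair-* (derivative l a) (φ (word l)) (λ _ → 1ℚ))) ⟩
    ΣI.sum Step (λ l → φ (word l) *ᵒ mass l a)
      ≡⟨ ΣI.sum-cong Step (λ l → Q.*-comm (φ (word l)) (mass l a)) ⟩
    ΣI.sum Step (λ l → mass l a *ᵒ φ (word l)) ∎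
    where
    open ≡.≡-Reasoning
    at : ∀ l → φ (word l ++ []) ≡ φ (word l) *ᵒ 1ℚ
    at l = ≡.trans (≡.cong φ (Listₚ.++-identityʳ (word l))) (≡.sym (Q.*-identityʳ (φ (word l))))
    shorter : ∀ w → length w ℕ.≤ 1 → length (rest w) ℕ.≤ 0
    shorter []      p       = z≤n
    shorter (_ ∷ w) (s≤s p) = p
    empty : ∀ l {a} → Bounded 1 a → Bounded 0 (derivative l a)
    empty l []                 = []
    empty l (_∷_ {x = t} p ps) = shorter (proj₂ t) p ∷ empty l ps

  short-logAlg : ∀ {I} (M : Matrix I I) → (∀ i j → Bounded 1 (M i j)) → NN.LogAlg (momentSeries M)
  short-logAlg {I} M short = NN.trace-logAlg I n (λ i j → mass (inj₁ zero) (M i j)) (λ y i j → mass (inj₂ y) (M i j))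
    c c-zero c-suc (momentSeries M) ≡.refl (λ k → ≡.refl)
    where
    c : ℕ → Word n → El I → El I → ℚ
    c k v i j = pair ((M ^^ k) i j) (χ v)

    c-zero : ∀ v i j → c 0 v i j ≡ NN.root I n (λ i j → mass (inj₁ zero) (M i j)) (λ y i j → mass (inj₂ y) (M i j)) (reduce v) i j
    c-zero v i j with reduce v
    c-zero v i j | [] with eqb I i j
    ... | true  = ≡.trans (Q.+-identityʳ _) (Q.*-identityˡ _)
    ... | false = ≡.refl
    c-zero v i j | _ ∷ _ with eqb I i j
    ... | true  = ≡.trans (Q.+-identityʳ _) (Q.*-identityˡ _)
    ... | false = ≡.refl

    c-suc : ∀ k v i j → c (suc k) v i j ≡ ΣI.sum I (λ p → mass (inj₁ zero) (M i p) *ᵒ c k v p j) +ᵒ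
      ΣI.sum (letter n) (λ y → ΣI.sum I (λ p → mass (inj₂ y) (M i p) *ᵒ c k (flip y ∷ v) p j))
    c-suc k v i j = begin
      pair (ΣΛ.sum I (λ p → M i p *F (M ^^ k) p j)) (χ v)
        ≡⟨ sum-hom (pairing (χ v) (χ-invariant v)) I (λ p → M i p *F (M ^^ k) p j) ⟩
      ΣI.sum I (λ p → pair (M i p *F (M ^^ k) p j) (χ v))
        ≡⟨ ΣI.sum-cong I (λ p → ≡.trans (pair-*F (M i p) ((M ^^ k) p j) (χ v)) (pair-short (short i p) (λ u → pair ((M ^^ k) p j) (λ w → χ v (u ++ w))))) ⟩
      ΣI.sum I (λ p → ΣI.sum Step (λ l → mass l (M i p) *ᵒ pair ((M ^^ k) p j) (λ w → χ v (word l ++ w))))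
        ≡⟨ ΣI.sum-swap I Step (λ p l → mass l (M i p) *ᵒ pair ((M ^^ k) p j) (λ w → χ v (word l ++ w))) ⟩
      -- The trailing `0ℚ` is the empty tail of the sum over `fin 1`, the index of the empty word.
      (ΣI.sum I (λ p → mass (inj₁ zero) (M i p) *ᵒ c k v p j) +ᵒ 0ℚ) +ᵒ
        ΣI.sum (letter n) (λ y → ΣI.sum I (λ p → mass (inj₂ y) (M i p) *ᵒ pair ((M ^^ k) p j) (λ w → χ v (y ∷ w))))
        ≡⟨ ≡.cong₂ _+ᵒ_ (Q.+-identityʳ (ΣI.sum I (λ p → mass (inj₁ zero) (M i p) *ᵒ c k v p j)))
             (ΣI.sum-cong (letter n) (λ y → ΣI.sum-cong I (λ p → ≡.cong (mass (inj₂ y) (M i p) *ᵒ_) (pair-cong ((M ^^ k) p j) (χ-flip y v))))) ⟩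
      ΣI.sum I (λ p → mass (inj₁ zero) (M i p) *ᵒ c k v p j) +ᵒ
        ΣI.sum (letter n) (λ y → ΣI.sum I (λ p → mass (inj₂ y) (M i p) *ᵒ c k (flip y ∷ v) p j)) ∎
      where open ≡.≡-Reasoning

  -- Since h(0) = 0, the equation expresses (k + 1) f_(k+1) through f_0, ..., f_k, and k + 1 is
  -- invertible in ℚ.
  linear-ode-unique : ∀ {h f} → h 0 ≡ 0ℚ → S.θ f S.≐ h S.⋆ f → f 0 ≡ 0ℚ → ∀ k i → i ℕ.≤ k → f i ≡ 0ℚ
  linear-ode-unique h₀ e f₀ zero .0 z≤n = f₀
  linear-ode-unique {h} {f} h₀ e f₀ (suc k) i i≤k with ℕₚ.m≤n⇒m<n∨m≡n i≤k
  ... | inj₁ (s≤s p)   = linear-ode-unique {h} h₀ e f₀ k i p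
  ... | inj₂ ≡.refl = nat-cancel k (f (suc k)) (≡.trans (e (suc k)) (≡.trans (≡.cong₂ _+ᵒ_
      (≡.trans (≡.cong (_*ᵒ f (suc k)) h₀) (Q.zeroˡ (f (suc k))))
      (≡.trans (S.⋆-cong≤ k {S.tail h} {S.tail h} {f} {R.0#} (λ _ _ → ≡.refl) (λ i p → linear-ode-unique {h} h₀ e f₀ k i p)) (R.zeroʳ (S.tail h) k)))
      (Q.+-identityˡ 0ℚ)))

  logAlg-algebraic : ∀ {h f} → h 0 ≡ 0ℚ → NN.LogAlg h → S.θ f S.≐ h S.⋆ f → Alg.Algebraic f
  logAlg-algebraic {h} {f} h₀ (u , v , uv , Au , du) df = Alg.algebraic-resp {S.con c S.⋆ u} {f} multiple
    (Alg.algebraic-* (Alg.algebraic-D (P.Poly-con tt)) Au)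
    where
    c : ℚ
    -- This is f(0)/u(0), so that f and c u have the same constant term while solving the same
    -- linear equation.
    c = f 0 *ᵒ v 0
    d : S.Ser
    d = f R.+ R.- (S.con c S.⋆ u)
    d₀ : d 0 ≡ 0ℚ
    d₀ = ≡.trans (≡.cong (λ x → f 0 +ᵒ -ᵒ x) (≡.trans (Q.*-assoc (f 0) (v 0) (u 0))
      (≡.trans (≡.cong (f 0 *ᵒ_) (≡.trans (Q.*-comm (v 0) (u 0)) (uv 0))) (Q.*-identityʳ (f 0))))) (Q.-‿inverseʳ (f 0))
    θd : S.θ d S.≐ h S.⋆ d
    θd = begin
      S.θ (f R.+ R.- (S.con c S.⋆ u))
        ≈⟨ Additive.add S.θ-additive f (R.- (S.con c S.⋆ u)) ⟩
      S.θ f R.+ S.θ (R.- (S.con c S.⋆ u))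
        ≈⟨ R.+-cong df θ-neg ⟩
      h S.⋆ f R.+ R.- (h S.⋆ (S.con c S.⋆ u))
        ≈⟨ R.sym (RingFacts.*-distribˡ-sub R.ring h f (S.con c S.⋆ u)) ⟩
      h S.⋆ d ∎
      where
      open import Relation.Binary.Reasoning.Setoid R.setoid
      open import Algebra.Properties.CommutativeSemigroup R.*-commutativeSemigroup using (x∙yz≈y∙xz)
      open import Algebra.Properties.Ring ℚ-ring using (-‿distribʳ-*)
      θ-neg : S.θ (R.- (S.con c S.⋆ u)) R.≈ R.- (h S.⋆ (S.con c S.⋆ u))
      θ-neg k = ≡.trans (≡.sym (-‿distribʳ-* (S.nat k) ((S.con c S.⋆ u) k))) (≡.cong -ᵒ_ (scaled k))
        where
        scaled : S.θ (S.con c S.⋆ u) R.≈ h S.⋆ (S.con c S.⋆ u)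
        scaled = begin
          S.θ (S.con c S.⋆ u)
            ≈⟨ S.θ-leibniz (S.con c) u ⟩
          S.θ (S.con c) S.⋆ u R.+ S.con c S.⋆ S.θ u
            ≈⟨ R.+-cong {S.θ (S.con c) S.⋆ u} {R.0#} (S.⋆-zeroˡ u (S.θ-con c)) (R.*-congˡ {S.con c} du) ⟩
          R.0# R.+ S.con c S.⋆ (h S.⋆ u)
            ≈⟨ R.+-identityˡ (S.con c S.⋆ (h S.⋆ u)) ⟩
          S.con c S.⋆ (h S.⋆ u)
            ≈⟨ x∙yz≈y∙xz (S.con c) h u ⟩
          h S.⋆ (S.con c S.⋆ u) ∎
    multiple : S.con c S.⋆ u R.≈ f
    multiple k = ≡.sym (≡.trans (RingFacts.unmove ℚ-ring {f k} {0ℚ} {(S.con c S.⋆ u) k} (linear-ode-unique {h} {d} h₀ θd d₀ k k ℕₚ.≤-refl))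
      (Q.+-identityˡ ((S.con c S.⋆ u) k)))

  -- Quantifying over all solutions f lets the induction hypothesis apply to f(t²), which solves the
  -- equation of the doubled matrix.
  moments-algebraic : ∀ b {I} (M : Matrix I I) → (∀ i j → Bounded (suc b) (M i j)) →
    ∀ f → S.θ f S.≐ momentSeries M S.⋆ f → Alg.Algebraic f
  moments-algebraic zero    M short f e = logAlg-algebraic ≡.refl (short-logAlg M short) e
  moments-algebraic (suc b) M short f e = Par.algebraic-dilate (moments-algebraic b (doubled M) (doubled-bounded M short) (Par.dilate f)
    (Par.θ-dilate {f} {momentSeries M} {momentSeries (doubled M)} e evens (moment-odd (firstMatrix M) (restMatrix M))))
    where
    evens : Par.evenPart (momentSeries (doubled M)) S.≐ momentSeries M S.⊹ momentSeries M
    evens zero    = ≡.sym (Q.+-identityˡ 0ℚ)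
    evens (suc k) = ≡.trans (moment-even (firstMatrix M) (restMatrix M) k)
      (≡.cong (λ x → x +ᵒ x) (moment-cong {M = firstMatrix M ⊡ restMatrix M} {M′ = M} (first-rest M) (suc k)))

  sumF-tabulate : ∀ {d m} (f : Fin m → QF n) (g : Fin d → Fin m) → sumF (map f (tabulate g)) ≡ ΣΛ.sum (fin d) (f ∘ g)
  sumF-tabulate {zero}  f g = ≡.refl
  sumF-tabulate {suc d} f g = ≡.cong (f (g zero) ++_) (sumF-tabulate f (g ∘ suc))

  ^M≡^^ : ∀ {d} (M : Mat n d) k i j → (M ^M k) i j ≡ (_^^_ {fin d} M k) i j
  ^M≡^^ {d} M zero    i j = ≡.refl
  ^M≡^^ {d} M (suc k) i j = ≡.trans (sumF-tabulate (λ p → M i p *F (M ^M k) p j) (λ p → p))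
    (sum-≡ d (λ p → ≡.cong (M i p *F_) (^M≡^^ M k p j)))
    where
    sum-≡ : ∀ d {f g : Fin d → QF n} → (∀ p → f p ≡ g p) → ΣΛ.sum (fin d) f ≡ ΣΛ.sum (fin d) g
    sum-≡ zero    e = ≡.refl
    sum-≡ (suc d) e = ≡.cong₂ _++_ (e zero) (sum-≡ d (e ∘ suc))

  aCoeff≡moment : ∀ {d} (M : Mat n d) k → aCoeff M k ≡ moment {fin d} M k
  aCoeff≡moment {d} M k = begin
    coeff (Tr (M ^M k)) []
      ≡⟨ coeff≡pair (Tr (M ^M k)) [] ⟩
    pair (Tr (M ^M k)) (χ [])
      ≡⟨ ≡.cong (λ a → pair a (χ [])) (sumF-tabulate (λ i → (M ^M k) i i) (λ i → i)) ⟩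
    pair (ΣΛ.sum (fin d) (λ i → (M ^M k) i i)) (χ [])
      ≡⟨ sum-hom τ (fin d) (λ i → (M ^M k) i i) ⟩
    ΣI.sum (fin d) (λ i → pair ((M ^M k) i i) (χ []))
      ≡⟨ ΣI.sum-cong (fin d) (λ i → ≡.cong (λ a → pair a (χ [])) (^M≡^^ M k i i)) ⟩
    moment {fin d} M k ∎
    where open ≡.≡-Reasoning

  θ-logSeries : ∀ {d} (M : Mat n d) k → S.θ (logSeries M) k ≡ momentSeries {fin d} M k
  θ-logSeries M zero        = Q.zeroˡ 0ℚ
  θ-logSeries {d} M (suc k) = ≡.trans (θ-coef (aCoeff M (suc k)) k (logSeries M) (≡.sym (*ᵒ≡* _ _))) (aCoeff≡moment {d} M (suc k))
    where
    θ-coef : ∀ a k (f : PS) → f (suc k) ≡ a *ᵒ (+ 1 / suc k) → S.θ f (suc k) ≡ a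
    θ-coef a k f e = ≡.trans (≡.cong (S.nat (suc k) *ᵒ_) e) (nat-/ k a)

  bounded-mono : ∀ {b b′} → b ℕ.≤ b′ → ∀ {a : QF n} → Bounded b a → Bounded b′ a
  bounded-mono p = All.map (λ q → ℕₚ.≤-trans q p)

  wordBound : QF n → ℕ
  wordBound []            = 0
  wordBound ((_ , w) ∷ a) = length w ℕ.+ wordBound a

  bounded : ∀ a → Bounded (wordBound a) a
  bounded []            = []
  bounded ((_ , w) ∷ a) = ℕₚ.m≤m+n (length w) (wordBound a) ∷ bounded-mono (ℕₚ.m≤n+m (wordBound a) (length w)) (bounded a)

  zeta-algebraic : ∀ {d} (M : Mat n d) → Alg.Algebraic (zeta M)
  zeta-algebraic {d} M = moments-algebraic b {fin d} M
    (λ i j → bounded-mono (ℕₚ.m≤n⇒m≤1+n (≤-addUp (fin d ⊗ fin d) (λ p → wordBound (M (proj₁ p) (proj₂ p))) (i , j))) (bounded (M i j)))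
    (zeta M) (λ k → ≡.trans (θ-expP (logSeries M) ≡.refl k) (S.⋆-cong {g = zeta M} (θ-logSeries M) (λ _ → ≡.refl) k))
    where
    b : ℕ
    b = addUp (fin d ⊗ fin d) (λ p → wordBound (M (proj₁ p) (proj₂ p)))

-- From relations between series to lists of coefficients

coefficients : ℕ → PS → List ℚ
coefficients zero    f = []
coefficients (suc b) f = f 0 ∷ coefficients b (S.tail f)

polyPS-coefficients : ∀ b f → (∀ i → b ℕ.≤ i → f i ≡ 0ℚ) → polyPS (coefficients b f) S.≐ f
polyPS-coefficients zero    f z k       = ≡.sym (z k z≤n)
polyPS-coefficients (suc b) f z zero    = ≡.refl
polyPS-coefficients (suc b) f z (suc k) = polyPS-coefficients b (S.tail f) (λ i p → z (suc i) (s≤s p)) k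

coefficients-Any : ∀ b f → (∀ i → b ℕ.≤ i → f i ≡ 0ℚ) → ∀ k → ¬ f k ≡ 0ℚ → Any (λ q → ¬ q ≡ 0ℚ) (coefficients b f)
coefficients-Any zero    f z k       nz = contradiction (z k z≤n) nz
coefficients-Any (suc b) f z zero    nz = here nz
coefficients-Any (suc b) f z (suc k) nz = there (coefficients-Any b (S.tail f) (λ i p → z (suc i) (s≤s p)) k nz)

-- The support bound contained in `Pq` decides where each coefficient series is cut to a list.
relationList : ∀ (n : ℕ) (q : ℕ → PS) → (∀ k → P.Poly (q k)) → List (List ℚ)
relationList zero    q Pq = []
relationList (suc n) q Pq = coefficients (proj₁ (proj₂ (Pq 0))) (q 0) ∷ relationList n (q ∘ suc) (Pq ∘ suc)

-- `evalY` is Horner's scheme: each step factors one f out of all terms but the first.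
evalY-relationList : ∀ n q Pq f → evalY (relationList n q Pq) f S.≐ ΣR.Σ< n (λ k → q k S.⋆ (f ^ k))
evalY-relationList zero    q Pq f i = ≡.refl
evalY-relationList (suc n) q Pq f = begin
  evalY (relationList (suc n) q Pq) f
    ≈⟨ (λ i → ≡.sym (+ᵒ≡+ _ _)) ⟩
  polyPS (coefficients (proj₁ (proj₂ (Pq 0))) (q 0)) R.+ (f *P evalY (relationList n (q ∘ suc) (Pq ∘ suc)) f)
    ≈⟨ R.+-cong {polyPS (coefficients (proj₁ (proj₂ (Pq 0))) (q 0))} {q 0} (polyPS-coefficients _ (q 0) (proj₂ (proj₂ (Pq 0))))
         (R.trans (*P≐⋆ f (evalY (relationList n (q ∘ suc) (Pq ∘ suc)) f)) (R.*-congˡ {f} (evalY-relationList n (q ∘ suc) (Pq ∘ suc) f))) ⟩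
  q 0 R.+ f R.* ΣR.Σ< n (λ k → q (suc k) R.* f ^ k)
    ≈⟨ R.+-cong {q 0} (R.sym (R.*-identityʳ (q 0))) (R.trans (ΣR.Σ<-*ˡ n f (λ k → q (suc k) R.* f ^ k))
         (ΣR.Σ<-cong n (λ k _ → x∙yz≈y∙xz f (q (suc k)) (f ^ k)))) ⟩
  ΣR.Σ< (suc n) (λ k → q k R.* f ^ k) ∎
  where
  open import Relation.Binary.Reasoning.Setoid R.setoid
  open import Algebra.Properties.CommutativeSemigroup R.*-commutativeSemigroup using (x∙yz≈y∙xz)

relationList-Any : ∀ n q Pq k → k ℕ.< n → ¬ q k S.≐ R.0# → Any (Any (λ q → ¬ q ≡ 0ℚ)) (relationList n q Pq)
relationList-Any (suc n) q Pq zero    p       nz with P.order (Pq 0)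
... | inj₁ z            = contradiction z nz
... | inj₂ (i , nzᵢ , _) = here (coefficients-Any _ (q 0) (proj₂ (proj₂ (Pq 0))) i nzᵢ)
relationList-Any (suc n) q Pq (suc k) (s≤s p) nz = there (relationList-Any n (q ∘ suc) (Pq ∘ suc) k p nz)

algebraic-overℚt : ∀ {f} → Alg.Algebraic f → IsAlgebraicOverℚt f
algebraic-overℚt {f} (n , q , Pq , (k , k<n , nz) , r) =
  relationList n q Pq , relationList-Any n q Pq k k<n nz , λ i → ≡.trans (evalY-relationList n q Pq f i) (r i)

theorem1p1 : (n d : ℕ) → 1 ≤ d → (M : Mat n d) → IsAlgebraicOverℚt (zeta M)
theorem1p1 n d _ M = algebraic-overℚt (zeta-algebraic M)
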